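{- The online algorithm Pseudo-BAF for Colored Bin Packing is absolutely $3.5$-competitive, i.e., it uses at most $3.5\cdot\mathrm{OPT}(L)$ bins on every input $L$. If all items have size at most $1/d$ for a real $d\ge 2$, it uses at most $\lceil (1.5 + d/(d-1))\,\mathrm{OPT}(L)\rceil$ bins. Moreover, the analysis is asymptotically tight.
   Context: Colored Bin Packing: items arrive as a sequence; each item has a size in $[0,1]$ and a color from a finite set $C$. A packing places items into unit-capacity bins, items in a bin ordered by arrival; it is valid if each bin has total size at most $1$ and no two consecutive items in a bin share a color. $\mathrm{OPT}(L)$ is the minimum number of bins in a valid packing of $L$ without reordering. The top item of a bin is its last item; a $c$-bin is a bin whose top item has color $c$. BAF (Balancing Any Fit) is the following online algorithm for items treated as having size zero, using these quantities evaluated before the incoming item (items so far indexed $1,\dots,k$): $s_{c,\ell}=1$ if item $\ell$ has color $c$ and $-1$ otherwise; $D=\max_c\max_{1\le i\le j\le k}\sum_{\ell=i}^j s_{c,\ell}$; $N_c$ = number of $c$-bins; $\mathrm{CD}_c=\max_{i\le k+1}\sum_{\ell=i}^k s_{c,\ell}$ (empty sum $=0$). For an incoming item of color $c$: (1) if there are no bins or all bins are $c$-bins, open a new bin for it; (2) otherwise, if at most one color $c''$ has $N_{c''}>\lceil D/2\rceil$, put it into a bin of a color $c'\ne c$ maximizing $N_{c'}$ among colors $\neq c$ (ties arbitrary); (3) otherwise, with $b,w$ the two colors having $N_b,N_w>\lceil D/2\rceil$: if $c=w$ put it into a $b$-bin, if $c=b$ into a $w$-bin, and if $c\notin\{b,w\}$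 into a $w$-bin when $N_b-\lceil D/2\rceil<\mathrm{CD}_b$ and into a $b$-bin otherwise. Pseudo-BAF: each incoming item is first assigned to a pseudo bin (a bin of unbounded capacity) by running BAF on the pseudo bins, treating the item as having size zero. Within each pseudo bin, the items assigned to it are packed into real unit-capacity bins by Next Fit: the item goes into the current (most recent) real bin of that pseudo bin if the total size stays at most $1$, otherwise a new real bin is opened for that pseudo bin and becomes its current one. The algorithm's cost is the total number of real bins. "Asymptotically tight" means there are inputs on which the number of bins used divided by $\mathrm{OPT}$ tends to the stated ratio as $\mathrm{OPT}\to\infty$.
   Formalization: Item sizes and the parameter d are taken to be rational numbers rather than real numbers. -}

module Defs where

open import Data.Nat as ℕ using (ℕ; zero; suc)
open import Data.Integer as ℤ using (ℤ; +_; -[1+_]; _⊔_)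
open import Data.Rational as ℚ using (ℚ; 0ℚ; 1ℚ; _÷_; ≢-nonZero; floor; ceiling)
open import Data.Rational.Properties as ℚP using ()
open import Data.Rational.Properties using (_≟_)
open import Data.Fin as Fin using (Fin)
import Data.Fin.Properties as FinP
open import Data.List as List using (List; []; _∷_; _++_; [_]; length; map; filter; concatMap; allFin; tails; inits; updateAt; sum)
open import Data.List.Relation.Unary.All using (All)
open import Data.Maybe using (Maybe; just; nothing)
open import Data.Product using (_×_; _,_; proj₁; proj₂; Σ; ∃; ∃-syntax)
open import Data.Sum using (_⊎_)
open import Relation.Nullary using (¬_; yes; no)
open import Relation.Binary.PropositionalEquality using (_≡_; _≢_; refl)
open import Function using (_∘_)

Item : ℕ → Set
Item k = ℚ × Fin k

size : ∀ {k} → Item k → ℚ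
size = proj₁

colour : ∀ {k} → Item k → Fin k
colour = proj₂

ValidSizes : ∀ {k} → List (Item k) → Set
ValidSizes = All (λ it → (0ℚ ℚ.≤ size it) × (size it ℚ.≤ 1ℚ))

-- total division on ℚ (only used with nonzero denominators)
_/q_ : ℚ → ℚ → ℚ
x /q y with y ≟ 0ℚ
... | yes _  = 0ℚ
... | no y≢0 = _÷_ x y {{≢-nonZero y≢0}}

-- Offline packings (for OPT).
-- A packing into m unit bins, processed in arrival order: each bin
-- records its current load and its top item colour (nothing = empty).
-- Placing an item into bin b is allowed iff the load stays ≤ 1 and the
-- current top item of b (the previous item of b) has a different colour.

record BinsState (k m : ℕ) : Set where
  constructor bins
  field
    load : Fin m → ℚ
    top  : Fin m → Maybe (Fin k)
open BinsState public

sel : ∀ {m} {A : Set} → Fin m → Fin m → A → A → A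
sel b b' x y with b' Fin.≟ b
... | yes _ = x
... | no  _ = y

putIn : ∀ {k m} → BinsState k m → Fin m → Item k → BinsState k m
putIn (bins l t) b (s , c) =
  bins (λ b' → sel b b' (l b' ℚ.+ s) (l b'))
       (λ b' → sel b b' (just c) (t b'))

data Packs {k m : ℕ} : BinsState k m → List (Item k) → Set where
  done : ∀ {st} → Packs st []
  put  : ∀ {st s c L} (b : Fin m) →
         load st b ℚ.+ s ℚ.≤ 1ℚ →
         top st b ≢ just c →
         Packs (putIn st b (s , c)) L →
         Packs st ((s , c) ∷ L)

emptyBins : ∀ {k m} → BinsState k m
emptyBins = bins (λ _ → 0ℚ) (λ _ → nothing)

Packable : ∀ {k} → List (Item k) → ℕ → Set
Packable L m = Packs (emptyBins {m = m}) L

IsOPT : ∀ {k} → List (Item k) → ℕ → Set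
IsOPT L m = Packable L m × (∀ m' → Packable L m' → m ℕ.≤ m')

-- BAF quantities.  h is the list of colours of the items seen so far,
-- in arrival order (items 1..k).

sgn : ∀ {k} → Fin k → Fin k → ℤ
sgn c x with c Fin.≟ x
... | yes _ = + 1
... | no  _ = -[1+ 0 ]

sumS : ∀ {k} → Fin k → List (Fin k) → ℤ
sumS c xs = List.foldr ℤ._+_ (+ 0) (map (sgn c) xs)

-- maximum of a list of integers (only used on nonempty lists; [] ↦ 0)
maxOf : List ℤ → ℤ
maxOf []       = + 0
maxOf (x ∷ xs) = List.foldr _⊔_ x xs

segments : ∀ {A : Set} → List A → List (List A)
segments h = concatMap (λ t → List.drop 1 (inits t)) (tails h)

Dval : ∀ {k} → List (Fin k) → ℤ
Dval {k} h = maxOf (concatMap (λ c → map (sumS c) (segments h)) (allFin k))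

halfD : ∀ {k} → List (Fin k) → ℤ
halfD h = ceiling (Dval h ℚ./ 2)

CD : ∀ {k} → Fin k → List (Fin k) → ℤ
CD c h = maxOf (map (sumS c) (tails h))

-- Pseudo-BAF state.  A pseudo bin records the colour of its top item,
-- the load of its current (most recent) real bin and the number of real
-- bins opened for it so far.

record PseudoBin (k : ℕ) : Set where
  constructor pbin
  field
    ptop   : Fin k
    pload  : ℚ
    nreal  : ℕ
open PseudoBin public

Ncount : ∀ {k} → List (PseudoBin k) → Fin k → ℕ
Ncount bs c = length (filter (λ b → ptop b Fin.≟ c) bs)

NZ : ∀ {k} → List (PseudoBin k) → Fin k → ℤ
NZ bs c = + Ncount bs c

data Choice (n : ℕ) : Set where
  new : Choice n
  old : Fin n → Choice n

topAt : ∀ {k} (bs : List (PseudoBin k)) → Fin (length bs) → Fin k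
topAt bs j = ptop (List.lookup bs j)

-- The BAF rule: which choices are allowed for an incoming item of
-- colour c, given colour history h and pseudo bins bs (ties arbitrary).
data BAFAllowed {k : ℕ} (h : List (Fin k)) (bs : List (PseudoBin k))
                (c : Fin k) : Choice (length bs) → Set where
  rule1 : All (λ b → ptop b ≡ c) bs → BAFAllowed h bs c new
  rule2 : (j : Fin (length bs)) →
          ¬ All (λ b → ptop b ≡ c) bs →
          (∀ c₁ c₂ → halfD h ℤ.< NZ bs c₁ → halfD h ℤ.< NZ bs c₂ → c₁ ≡ c₂) →
          topAt bs j ≢ c →
          (∀ c' → c' ≢ c → Ncount bs c' ℕ.≤ Ncount bs (topAt bs j)) →
          BAFAllowed h bs c (old j)
  rule3 : (b w : Fin k) (j : Fin (length bs)) →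
          ¬ All (λ x → ptop x ≡ c) bs →
          b ≢ w →
          halfD h ℤ.< NZ bs b → halfD h ℤ.< NZ bs w →
          (∀ c'' → halfD h ℤ.< NZ bs c'' → c'' ≡ b ⊎ c'' ≡ w) →
          (  (c ≡ w × topAt bs j ≡ b)
           ⊎ (c ≡ b × topAt bs j ≡ w)
           ⊎ (c ≢ b × c ≢ w × NZ bs b ℤ.- halfD h ℤ.< CD b h × topAt bs j ≡ w)
           ⊎ (c ≢ b × c ≢ w × ¬ (NZ bs b ℤ.- halfD h ℤ.< CD b h) × topAt bs j ≡ b)) →
          BAFAllowed h bs c (old j)
  -- (degenerate) if three distinct colours had N > ⌈D/2⌉ (a situation
  -- the algorithm's description presupposes never arises) any choice
  -- is allowed; this only strengthens the statement.
  rule3+ : ∀ ch (x y z : Fin k) →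
           ¬ All (λ b → ptop b ≡ c) bs →
           x ≢ y → y ≢ z → x ≢ z →
           halfD h ℤ.< NZ bs x → halfD h ℤ.< NZ bs y → halfD h ℤ.< NZ bs z →
           BAFAllowed h bs c ch

nextFit : ∀ {k} → Item k → PseudoBin k → PseudoBin k
nextFit (s , c) (pbin _ l n) with (l ℚ.+ s) ℚP.≤? 1ℚ
... | yes _ = pbin c (l ℚ.+ s) n
... | no  _ = pbin c s (suc n)

place : ∀ {k} (bs : List (PseudoBin k)) → Choice (length bs) → Item k →
        List (PseudoBin k)
place bs new     (s , c) = bs ++ [ pbin c s 1 ]
place bs (old j) it      = updateAt bs j (nextFit it)

cost : ∀ {k} → List (PseudoBin k) → ℕ
cost bs = List.foldr ℕ._+_ 0 (map nreal bs)

-- Run h bs L n : continuing from history h and pseudo bins bs, some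
-- execution of Pseudo-BAF (with some resolution of ties) on the
-- remaining items L ends using n real bins in total.
data Run {k : ℕ} : List (Fin k) → List (PseudoBin k) → List (Item k) → ℕ → Set where
  finish : ∀ {h bs} → Run h bs [] (cost bs)
  step   : ∀ {h bs s c L n} (ch : Choice (length bs)) →
           BAFAllowed h bs c ch →
           Run (h ++ [ c ]) (place bs ch (s , c)) L n →
           Run h bs ((s , c) ∷ L) n

PseudoBAF : ∀ {k} → List (Item k) → ℕ → Set
PseudoBAF L n = Run [] [] L n

toℚ : ℕ → ℚ
toℚ n = + n ℚ./ 1

{-# OPTIONS --safe #-}
module Submission where

-- Upper bound: with N_c the number of c-bins and H = ⌈D/2⌉, BAF keeps N_c ≤ H + CD_c for every colour and
-- 2(N_b + N_x) ≤ 4H + CD_b + CD_x + 1 for every pair, so it never opens more than D + H pseudo bins, where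
-- D ≤ OPT because a bin cannot hold two consecutive items of one colour. Next Fit pays for each further real
-- bin with strictly more than 1/2 (or (d-1)/d) of volume, and the volume is at most OPT.
-- Tightness: with three colours, 3i bins of one colour are first balanced into i + i + i by alternating the
-- other two; a run of 2i + 3 items of one of these then yields 3i + 3 bins although only 2i + 3 are needed.
-- Afterwards zero-size items of the common top colour w separate sized items of another colour, so that one
-- pseudo bin receives all of them while they may be distributed freely offline.

open import Defs
import Data.Nat
open import Data.Nat as ℕ using (ℕ; zero; suc; z≤n; s≤s)
open import Data.Integer as ℤ using (ℤ; +_; -[1+_]) renaming (_≤_ to _≤ℤ_)
open import Data.Rational as ℚ using (ℚ; 0ℚ; 1ℚ; _+_; _-_; _*_; -_; _≤_; _<_; floor; ceiling; mkℚ) renaming (_/_ to _//_)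
import Data.Rational.Unnormalised as ℚᵘ
import Data.Rational.Unnormalised.Properties as ℚᵘP
import Data.Nat.Properties as ℕP
import Data.Integer.Properties as ℤP
import Data.Integer.DivMod as ℤD
import Data.Rational.Properties as ℚP
import Data.Nat.Tactic.RingSolver as ℕS
import Data.Integer.Tactic.RingSolver as ℤS
open import Tactic.RingSolver using (solve-∀; solve)
open import Tactic.RingSolver.Core.AlmostCommutativeRing using (AlmostCommutativeRing; fromCommutativeRing)
open import Data.Fin as Fin using (Fin; toℕ; fromℕ<)
import Data.Fin.Properties as FinP
open import Data.List as List using (List; []; _∷_; _++_; [_]; length; map; concatMap; allFin; tails; inits; updateAt; replicate; take; drop)
import Data.List.Properties as ListP
open import Data.List.Membership.Propositional using (_∈_; find)
open import Data.List.Membership.Propositional.Properties using (∈-map⁺; ∈-map⁻; ∈-concatMap⁺; ∈-concatMap⁻; ∈-allFin)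
open import Data.List.Relation.Unary.Any as Any using (Any; here; there)
open import Data.List.Relation.Unary.All as All using (All; []; _∷_)
import Data.List.Relation.Unary.All.Properties as AllP
open import Data.Maybe using (Maybe; just; nothing)
open import Data.Product using (_×_; _,_; proj₁; proj₂; Σ; ∃-syntax)
open import Data.Sum using (_⊎_; inj₁; inj₂; [_,_]′)
open import Data.Empty using (⊥-elim)
open import Function using (_∘_; id)
open import Level using (0ℓ)
open import Relation.Nullary using (¬_; yes; no; contradiction)
open import Relation.Nullary.Decidable using (dec⇒maybe; toWitness)
open import Relation.Binary.PropositionalEquality using (_≡_; _≢_; refl; sym; trans; cong; cong₂; subst; subst₂; ≢-sym)
open import Algebra.Bundles using (CommutativeMonoid)
import Algebra.Properties.CommutativeMonoid.Sum as SumProperties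
import Algebra.Solver.CommutativeMonoid as MonoidSolver

-- Rational and linear arithmetic

-- The bound `D + H` comes from rule 1: a new pseudo bin appears only when all `T` bins are
-- `c`-bins, so `T = N_c ≤ H + CD_c`, and the new item raises `CD_c`, which never exceeds `D`.
-- Rounding in `H = ⌈D/2⌉` leaves `2T ≤ 3·OPT + 1`, which by itself would give only an additive
-- bound. Strictness saves the absolute ratio: either Next Fit never overflows and the cost is `T`,
-- or the cost is strictly below `T + 2·OPT`, so by integrality one less, and this outweighs the
-- rounding. For sizes at most `1/d` the outer ceiling absorbs the same half. For tightness the
-- colour part and the sized part have to share one value `m` of OPT: the last run of equal colours
-- has length `m` and forces `m` bins, while the sized part is dimensioned to fit into these `m`
-- bins. As `d` need not be an integer, sizes are measured in grains of size `1/(dK)`: a big item of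
-- `K` grains has size exactly `1/d`, and `Q = ⌊(d-2)K⌋` makes `Q + 2K` the capacity of a bin in
-- grains.

ℚ-ring : AlmostCommutativeRing 0ℓ 0ℓ
ℚ-ring = fromCommutativeRing ℚP.+-*-commutativeRing λ x → dec⇒maybe (0ℚ ℚP.≟ x)

-- In the linear-arithmetic lemmas below, a linear inequality is reduced to the sum l ≤ r of its
-- hypotheses and a ring identity; k is the slack.
lin : ∀ {a b l r} k → l ℕ.≤ r → a ℕ.+ r ℕ.+ k ≡ b ℕ.+ l → a ℕ.≤ b
lin {a} {b} {l} {r} k p e = ℕP.+-cancelʳ-≤ l a b
  (ℕP.≤-trans (ℕP.+-monoʳ-≤ a p) (ℕP.≤-trans (ℕP.m≤m+n (a ℕ.+ r) k) (ℕP.≤-reflexive e)))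

infixl 5 _⊕_ _⊞_
_⊕_ : ∀ {a b c d} → a ℕ.≤ b → c ℕ.≤ d → a ℕ.+ c ℕ.≤ b ℕ.+ d
_⊕_ = ℕP.+-mono-≤

_⊞_ : ∀ {a b c d} → a ≤ b → c ≤ d → a + c ≤ b + d
_⊞_ = ℚP.+-mono-≤

linℤ : ∀ {a b l r} → l ℤ.≤ r → a ℤ.+ r ≡ b ℤ.+ l → a ℤ.≤ b
linℤ {a} {b} {l} {r} p e = ℤP.≤-trans (ℤP.≤-reflexive (trans (eq a r) (cong (ℤ._- r) e)))
  (ℤP.≤-trans (ℤP.+-monoʳ-≤ (b ℤ.+ l) (ℤP.neg-mono-≤ p)) (ℤP.≤-reflexive (sym (eq b l))))
  where
  eq : ∀ x y → x ≡ x ℤ.+ y ℤ.- y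
  eq = ℤS.solve-∀

linℚ : ∀ {a b l r} → l ≤ r → a + r ≡ b + l → a ≤ b
linℚ {a} {b} {l} {r} p e = ℚP.≤-trans (ℚP.≤-reflexive (trans (eq a r) (cong (_- r) e)))
  (ℚP.≤-trans (ℚP.+-monoʳ-≤ (b + l) (ℚP.neg-antimono-≤ p)) (ℚP.≤-reflexive (sym (eq b l))))
  where
  eq : ∀ x y → x ≡ x + y - y
  eq = solve-∀ ℚ-ring

lin<ℚ : ∀ {a b l r} → l < r → a + r ≡ b + l → a < b
lin<ℚ {a} {b} {l} {r} p e = ℚP.≤-<-trans (ℚP.≤-reflexive (trans (eq a r) (cong (_- r) e)))
  (ℚP.<-≤-trans (ℚP.+-monoʳ-< (b + l) (ℚP.neg-antimono-< p)) (ℚP.≤-reflexive (sym (eq b l))))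
  where
  eq : ∀ x y → x ≡ x + y - y
  eq = solve-∀ ℚ-ring

mulʳ-≤ : ∀ {p q r} → 0ℚ ≤ r → p ≤ q → p * r ≤ q * r
mulʳ-≤ {r = r} 0≤r = ℚP.*-monoʳ-≤-nonNeg r {{ℚ.nonNegative 0≤r}}

mulʳ-< : ∀ {p q r} → 0ℚ < r → p < q → p * r < q * r
mulʳ-< {r = r} 0<r = ℚP.*-monoˡ-<-pos r {{ℚ.positive 0<r}}

cancelʳ-≤ : ∀ {p q r} → 0ℚ < r → p * r ≤ q * r → p ≤ q
cancelʳ-≤ {r = r} 0<r = ℚP.*-cancelʳ-≤-pos r {{ℚ.positive 0<r}}

cancelʳ-≡ : ∀ {p q r} → 0ℚ < r → p * r ≡ q * r → p ≡ q
cancelʳ-≡ 0<r e = ℚP.≤-antisym (cancelʳ-≤ 0<r (ℚP.≤-reflexive e)) (cancelʳ-≤ 0<r (ℚP.≤-reflexive (sym e)))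

mul-nonneg : ∀ {p q} → 0ℚ ≤ p → 0ℚ ≤ q → 0ℚ ≤ p * q
mul-nonneg {p} {q} 0≤p 0≤q = subst (_≤ p * q) (ℚP.*-zeroˡ q) (mulʳ-≤ 0≤q 0≤p)

mul-pos : ∀ {p q} → 0ℚ < p → 0ℚ < q → 0ℚ < p * q
mul-pos {p} {q} 0<p 0<q = subst (_< p * q) (ℚP.*-zeroˡ q) (mulʳ-< 0<q 0<p)

-- Quotients are handled through their defining product: identities between them are proved after
-- cancelling a positive denominator.
/q-* : ∀ x {y} → 0ℚ < y → (x /q y) * y ≡ x
/q-* x {y} 0<y with y ℚP.≟ 0ℚ
... | yes refl = contradiction 0<y (ℚP.<-irrefl refl)
... | no y≢0 = trans (ℚP.*-assoc x _ y) (trans (cong (x *_) (ℚP.*-inverseˡ y {{ℚ.≢-nonZero y≢0}})) (ℚP.*-identityʳ x))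

-- Integers inside ℚ, floors and ceilings

ι : ℤ → ℚ
ι z = z // 1

ι-toℚᵘ : ∀ z → ℚ.toℚᵘ (ι z) ℚᵘ.≃ ℚᵘ.mkℚᵘ z 0
ι-toℚᵘ z = ℚP.toℚᵘ-fromℚᵘ (ℚᵘ.mkℚᵘ z 0)

ι-+ : ∀ x y → ι (x ℤ.+ y) ≡ ι x + ι y
ι-+ x y = ℚP.toℚᵘ-injective (begin-equality
  ℚ.toℚᵘ (ι (x ℤ.+ y))                  ≃⟨ ι-toℚᵘ (x ℤ.+ y) ⟩
  ℚᵘ.mkℚᵘ (x ℤ.+ y) 0                   ≃⟨ ℚᵘ.*≡* (eq x y) ⟩
  ℚᵘ.mkℚᵘ x 0 ℚᵘ.+ ℚᵘ.mkℚᵘ y 0          ≃⟨ ℚᵘP.≃-sym (ℚᵘP.+-cong (ι-toℚᵘ x) (ι-toℚᵘ y)) ⟩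
  ℚ.toℚᵘ (ι x) ℚᵘ.+ ℚ.toℚᵘ (ι y)        ≃⟨ ℚᵘP.≃-sym (ℚP.toℚᵘ-homo-+ (ι x) (ι y)) ⟩
  ℚ.toℚᵘ (ι x + ι y)                    ∎)
  where
  open ℚᵘP.≤-Reasoning
  eq : ∀ x y → (x ℤ.+ y) ℤ.* + 1 ≡ (x ℤ.* + 1 ℤ.+ y ℤ.* + 1) ℤ.* + 1
  eq = ℤS.solve-∀

ι-mono-≤ : ∀ {x y} → x ℤ.≤ y → ι x ≤ ι y
ι-mono-≤ {x} {y} x≤y = ℚP.toℚᵘ-cancel-≤ (ℚᵘP.≤-respˡ-≃ (ℚᵘP.≃-sym (ι-toℚᵘ x))
  (ℚᵘP.≤-respʳ-≃ (ℚᵘP.≃-sym (ι-toℚᵘ y)) (ℚᵘ.*≤* (ℤP.*-monoʳ-≤-nonNeg (+ 1) x≤y))))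

ι-cancel-≤ : ∀ {x y} → ι x ≤ ι y → x ℤ.≤ y
ι-cancel-≤ {x} {y} p with ℚᵘP.≤-respˡ-≃ (ι-toℚᵘ x) (ℚᵘP.≤-respʳ-≃ (ι-toℚᵘ y) (ℚP.toℚᵘ-mono-≤ p))
... | ℚᵘ.*≤* q = ℤP.*-cancelʳ-≤-pos x y (+ 1) q

ι-cancel-< : ∀ {x y} → ι x < ι y → x ℤ.< y
ι-cancel-< p = ℤP.≰⇒> λ y≤x → ℚP.<-irrefl refl (ℚP.<-≤-trans p (ι-mono-≤ y≤x))

ι-mono-< : ∀ {x y} → x ℤ.< y → ι x < ι y
ι-mono-< p = ℚP.≰⇒> λ y≤x → ℤP.<-irrefl refl (ℤP.<-≤-trans p (ι-cancel-≤ y≤x))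

toℚ-+ : ∀ m n → toℚ (m ℕ.+ n) ≡ toℚ m + toℚ n
toℚ-+ m n = trans (cong ι (ℤP.pos-+ m n)) (ι-+ (+ m) (+ n))

toℚ-mono : ∀ {m n} → m ℕ.≤ n → toℚ m ≤ toℚ n
toℚ-mono p = ι-mono-≤ (ℤ.+≤+ p)

toℚ-nonneg : ∀ n → 0ℚ ≤ toℚ n
toℚ-nonneg n = toℚ-mono {0} {n} z≤n

toℚ-cancel-< : ∀ {m n} → toℚ m < toℚ n → m ℕ.< n
toℚ-cancel-< p = ℤP.drop‿+<+ (ι-cancel-< p)

floor-lower : ∀ p → ι (floor p) ≤ p
floor-lower p@(mkℚ n d-1 _) = ℚP.toℚᵘ-cancel-≤ (ℚᵘP.≤-respˡ-≃ (ℚᵘP.≃-sym (ι-toℚᵘ (floor p)))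
  (ℚᵘ.*≤* (ℤP.≤-trans (ℤD.[n/d]*d≤n n (+ suc d-1)) (ℤP.≤-reflexive (sym (ℤP.*-identityʳ n))))))

floor-upper : ∀ p → p < ι (floor p ℤ.+ + 1)
floor-upper p@(mkℚ n d-1 _) = ℚP.toℚᵘ-cancel-< (ℚᵘP.<-respʳ-≃ (ℚᵘP.≃-sym (ι-toℚᵘ (floor p ℤ.+ + 1)))
  (ℚᵘ.*<* (ℤP.≤-<-trans (ℤP.≤-reflexive (ℤP.*-identityʳ n)) (ℤP.<-≤-trans (ℤD.n<s[n/ℕd]*d n (suc d-1))
    (ℤP.≤-reflexive (cong (ℤ._* + suc d-1) (trans (ℤP.+-comm (+ 1) (n ℤD./ℕ suc d-1))
      (cong (ℤ._+ + 1) (sym (ℤD.div-pos-is-/ℕ n (suc d-1)))))))))))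

ι-neg : ∀ z → ι (ℤ.- z) ≡ - ι z
ι-neg z = trans (eq (ι (ℤ.- z)) (ι z)) (trans (cong (_- ι z)
  (trans (sym (ι-+ (ℤ.- z) z)) (cong ι (ℤP.+-inverseˡ z)))) (ℚP.+-identityˡ (- ι z)))
  where
  eq : ∀ x y → x ≡ x + y + - y
  eq = solve-∀ ℚ-ring

-- The record pattern lets `ceiling p` reduce to `-⌊-p⌋`, so both bounds on ceilings follow from
-- those on floors.
ι-ceiling : ∀ p → ι (ceiling p) ≡ - ι (floor (- p))
ι-ceiling p@record{} = ι-neg (floor (- p))

ceiling-upper : ∀ p → p ≤ ι (ceiling p)
ceiling-upper p = subst (p ≤_) (sym (ι-ceiling p)) (linℚ (floor-lower (- p)) (eq p (ι (floor (- p)))))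
  where
  eq : ∀ x y → x + - x ≡ - y + y
  eq = solve-∀ ℚ-ring

ceiling-lower : ∀ p → ι (ceiling p) < p + 1ℚ
ceiling-lower p = subst (_< p + 1ℚ) (sym (ι-ceiling p))
  (lin<ℚ (subst (- p <_) (ι-+ (floor (- p)) (+ 1)) (floor-upper (- p))) (eq p (ι (floor (- p)))))
  where
  eq : ∀ x y → - y + (y + 1ℚ) ≡ x + 1ℚ + - x
  eq = solve-∀ ℚ-ring

half-double : ∀ z → (z // 2) + (z // 2) ≡ ι z
half-double z = ℚP.toℚᵘ-injective (begin-equality
  ℚ.toℚᵘ ((z // 2) + (z // 2))                    ≃⟨ ℚP.toℚᵘ-homo-+ (z // 2) (z // 2) ⟩
  ℚ.toℚᵘ (z // 2) ℚᵘ.+ ℚ.toℚᵘ (z // 2)            ≃⟨ ℚᵘP.+-cong (ℚP.toℚᵘ-fromℚᵘ (ℚᵘ.mkℚᵘ z 1)) (ℚP.toℚᵘ-fromℚᵘ (ℚᵘ.mkℚᵘ z 1)) ⟩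
  ℚᵘ.mkℚᵘ z 1 ℚᵘ.+ ℚᵘ.mkℚᵘ z 1                    ≃⟨ ℚᵘ.*≡* (eq z) ⟩
  ℚᵘ.mkℚᵘ z 0                                     ≃⟨ ℚᵘP.≃-sym (ι-toℚᵘ z) ⟩
  ℚ.toℚᵘ (ι z)                                    ∎)
  where
  open ℚᵘP.≤-Reasoning
  eq : ∀ z → (z ℤ.* + 2 ℤ.+ z ℤ.* + 2) ℤ.* + 1 ≡ z ℤ.* + 4
  eq = ℤS.solve-∀

-- Together with `ceiling-half-≤` this is the integral form `D ≤ 2⌈D/2⌉ ≤ D + 1`, which is all that
-- is used about `⌈D/2⌉`.
≤-ceiling-half : ∀ z → z ℤ.≤ ceiling (z // 2) ℤ.+ ceiling (z // 2)
≤-ceiling-half z = ι-cancel-≤ (subst₂ _≤_ (half-double z) (sym (ι-+ c c)) (ceiling-upper (z // 2) ⊞ ceiling-upper (z // 2)))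
  where c = ceiling (z // 2)

<+2⇒≤+1 : ∀ {x z} → x ℤ.< z ℤ.+ + 2 → x ℤ.≤ z ℤ.+ + 1
<+2⇒≤+1 {x} {z} p = linℤ (ℤP.i<j⇒suc[i]≤j p) (eq x z)
  where
  eq : ∀ x z → x ℤ.+ (z ℤ.+ + 2) ≡ z ℤ.+ + 1 ℤ.+ (+ 1 ℤ.+ x)
  eq = ℤS.solve-∀

ceiling-half-≤ : ∀ z → ceiling (z // 2) ℤ.+ ceiling (z // 2) ℤ.≤ z ℤ.+ + 1
ceiling-half-≤ z = <+2⇒≤+1 {z = z} (ι-cancel-< {y = z ℤ.+ + 2} (subst₂ _<_ (sym (ι-+ c c)) eq (ℚP.+-mono-< (ceiling-lower (z // 2)) (ceiling-lower (z // 2)))))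
  where
  c = ceiling (z // 2)
  swap : ∀ x → x + 1ℚ + (x + 1ℚ) ≡ (x + x) + (1ℚ + 1ℚ)
  swap = solve-∀ ℚ-ring
  eq : (z // 2) + 1ℚ + ((z // 2) + 1ℚ) ≡ ι (z ℤ.+ + 2)
  eq = trans (swap (z // 2)) (trans (cong (_+ (1ℚ + 1ℚ)) (half-double z)) (sym (ι-+ z (+ 2))))

-- Discrepancies

maxOf-upper : ∀ {x xs} → x ∈ xs → x ℤ.≤ maxOf xs
maxOf-upper {xs = y ∷ ys} x∈ = go ys x∈
  where
  go : ∀ {x y} ys → x ∈ y ∷ ys → x ℤ.≤ List.foldr ℤ._⊔_ y ys
  go []       (here refl)         = ℤP.≤-refl
  go (z ∷ ys) (here refl)         = ℤP.≤-trans (go ys (here refl)) (ℤP.i≤j⊔i z _)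
  go (z ∷ ys) (there (here refl)) = ℤP.i≤i⊔j z _
  go (z ∷ ys) (there (there x∈))  = ℤP.≤-trans (go ys (there x∈)) (ℤP.i≤j⊔i z _)

maxOf-∈ : ∀ x xs → maxOf (x ∷ xs) ∈ x ∷ xs
maxOf-∈ x []       = here refl
maxOf-∈ x (y ∷ xs) with ℤP.⊔-sel y (List.foldr ℤ._⊔_ x xs)
... | inj₁ e rewrite e = there (here refl)
... | inj₂ e rewrite e with maxOf-∈ x xs
...   | here p  = here p
...   | there p = there (there p)

maxOf-least : ∀ {z} xs → ℤ.0ℤ ℤ.≤ z → (∀ {x} → x ∈ xs → x ℤ.≤ z) → maxOf xs ℤ.≤ z
maxOf-least []       0≤z ub = 0≤z
maxOf-least (x ∷ xs) 0≤z ub = ub (maxOf-∈ x xs)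

-- The list may be empty, with default maximum 0, so a nonnegative element can be demanded only once
-- some element is given.
maxOf-nonneg : ∀ xs → (∀ {x} → x ∈ xs → ∃[ y ] (y ∈ xs × ℤ.0ℤ ℤ.≤ y)) → ℤ.0ℤ ℤ.≤ maxOf xs
maxOf-nonneg []       wit = ℤP.≤-refl
maxOf-nonneg (x ∷ xs) wit with wit (here refl)
... | y , y∈ , 0≤y = ℤP.≤-trans 0≤y (maxOf-upper y∈)

module _ {A : Set} where

  tails⁺ : ∀ (p t : List A) → t ∈ tails (p ++ t)
  tails⁺ []      t = here refl
  tails⁺ (x ∷ p) t = there (tails⁺ p t)

  tails⁻ : ∀ h {t : List A} → t ∈ tails h → ∃[ p ] h ≡ p ++ t
  tails⁻ h       (here refl) = [] , refl
  tails⁻ (x ∷ h) (there t∈) with tails⁻ h t∈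
  ... | p , e = x ∷ p , cong (x ∷_) e

  inits⁺ : ∀ (s r : List A) → s ∈ inits (s ++ r)
  inits⁺ []      r = here refl
  inits⁺ (x ∷ s) r = there (∈-map⁺ (x ∷_) (inits⁺ s r))

  inits⁻ : ∀ t {s : List A} → s ∈ inits t → ∃[ r ] t ≡ s ++ r
  inits⁻ t       (here refl) = t , refl
  inits⁻ (x ∷ t) (there s∈) with ∈-map⁻ (x ∷_) {xs = inits t} s∈
  ... | s , s∈′ , refl with inits⁻ t s∈′
  ...   | r , e = r , cong (x ∷_) e

  segments⁺ : ∀ p x (s r : List A) → x ∷ s ∈ segments (p ++ (x ∷ s) ++ r)
  segments⁺ p x s r = ∈-concatMap⁺ (λ t → drop 1 (inits t))
    (Any.map (λ { refl → ∈-map⁺ (x ∷_) (inits⁺ s r) }) (tails⁺ p ((x ∷ s) ++ r)))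

  segments⁻ : ∀ h {s : List A} → s ∈ segments h →
              ∃[ p ] ∃[ x ] ∃[ s′ ] ∃[ r ] (s ≡ x ∷ s′ × h ≡ p ++ (x ∷ s′) ++ r)
  segments⁻ h s∈ with find (∈-concatMap⁻ (λ t → drop 1 (inits t)) {xs = tails h} s∈)
  ... | (x ∷ t) , t∈ , s∈′ with ∈-map⁻ (x ∷_) {xs = inits t} s∈′ | tails⁻ h t∈
  ...   | s′ , s′∈ , refl | p , refl with inits⁻ t s′∈
  ...     | r , refl = p , x , s′ , r , refl , refl

sgn-same : ∀ {k} (c : Fin k) → sgn c c ≡ + 1
sgn-same c with c Fin.≟ c
... | yes _   = refl
... | no  c≢c = contradiction refl c≢c

sgn-≥-1 : ∀ {k} (c x : Fin k) → ℤ.-1ℤ ℤ.≤ sgn c x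
sgn-≥-1 c x with c Fin.≟ x
... | yes _ = ℤ.-≤+
... | no  _ = ℤP.≤-refl

sumS-snoc : ∀ {k} (c : Fin k) t x → sumS c (t ++ [ x ]) ≡ sumS c t ℤ.+ sgn c x
sumS-snoc c []      x = ℤP.+-comm (sgn c x) (+ 0)
sumS-snoc c (y ∷ t) x = trans (cong (ℤ._+_ (sgn c y)) (sumS-snoc c t x)) (sym (ℤP.+-assoc (sgn c y) (sumS c t) (sgn c x)))

module _ {k : ℕ} where

  sumS≤Dval : ∀ (c : Fin k) h {s} → s ∈ segments h → sumS c s ℤ.≤ Dval h
  sumS≤Dval c h s∈ = maxOf-upper (∈-concatMap⁺ (λ c → map (sumS c) (segments h))
    (Any.map (λ { refl → ∈-map⁺ (sumS c) s∈ }) (∈-allFin c)))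

  private
    Dval-element : ∀ h {z} → z ∈ concatMap (λ c → map (sumS c) (segments h)) (allFin k) →
                   ∃[ c ] ∃[ s ] (s ∈ segments h × z ≡ sumS c s)
    Dval-element h z∈ with find (∈-concatMap⁻ (λ c → map (sumS c) (segments h)) {xs = allFin k} z∈)
    ... | c , _ , z∈′ with ∈-map⁻ (sumS c) z∈′
    ...   | s , s∈ , e = c , s , s∈ , e

  Dval-least : ∀ h {z} → ℤ.0ℤ ℤ.≤ z → (∀ (c : Fin k) {s} → s ∈ segments h → sumS c s ℤ.≤ z) → Dval h ℤ.≤ z
  Dval-least h 0≤z ub = maxOf-least _ 0≤z bound
    where
    bound : ∀ {x} → x ∈ concatMap (λ c → map (sumS c) (segments h)) (allFin k) → x ℤ.≤ _
    bound x∈ with Dval-element h x∈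
    ... | c , s , s∈ , refl = ub c s∈

  Dval-nonneg : ∀ (h : List (Fin k)) → ℤ.0ℤ ℤ.≤ Dval h
  Dval-nonneg h = maxOf-nonneg _ wit
    where
    wit : ∀ {x} → x ∈ concatMap (λ c → map (sumS c) (segments h)) (allFin k) →
          ∃[ y ] (y ∈ concatMap (λ c → map (sumS c) (segments h)) (allFin k) × ℤ.0ℤ ℤ.≤ y)
    wit x∈ with Dval-element h x∈
    ... | _ , s , s∈ , _ with segments⁻ h s∈
    -- The first item of the segment alone has sum 1 in its own colour.
    ...   | p , x , s′ , r , _ , refl = sumS x [ x ] ,
            ∈-concatMap⁺ (λ c → map (sumS c) (segments h)) (Any.map (λ { refl → ∈-map⁺ (sumS x) (segments⁺ p x [] (s′ ++ r)) }) (∈-allFin x)) ,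
            subst (λ z → ℤ.0ℤ ℤ.≤ z ℤ.+ + 0) (sym (sgn-same x)) (ℤ.+≤+ z≤n)

  Dval-mono : ∀ (h : List (Fin k)) x → Dval h ℤ.≤ Dval (h ++ [ x ])
  Dval-mono h x = Dval-least h (Dval-nonneg (h ++ [ x ])) λ c s∈ → sumS≤Dval c (h ++ [ x ]) (extend s∈)
    where
    extend : ∀ {s} → s ∈ segments h → s ∈ segments (h ++ [ x ])
    extend s∈ with segments⁻ h s∈
    ... | p , y , s′ , r , refl , refl = subst (λ l → y ∷ s′ ∈ segments l)
          (sym (trans (ListP.++-assoc p ((y ∷ s′) ++ r) [ x ]) (cong (p ++_) (ListP.++-assoc (y ∷ s′) r [ x ]))))
          (segments⁺ p y s′ (r ++ [ x ]))

  sumS≤CD : ∀ (c : Fin k) p t → sumS c t ℤ.≤ CD c (p ++ t)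
  sumS≤CD c p t = maxOf-upper (∈-map⁺ (sumS c) (tails⁺ p t))

  CD-attained : ∀ (c : Fin k) h → ∃[ p ] ∃[ t ] (h ≡ p ++ t × CD c h ≡ sumS c t)
  CD-attained c h with ∈-map⁻ (sumS c) {xs = tails h} (maxOf-∈ (sumS c h) _)
  ... | t , t∈ , e with tails⁻ h t∈
  ...   | p , e′ = p , t , e′ , e

  CD-nonneg : ∀ (c : Fin k) h → ℤ.0ℤ ℤ.≤ CD c h
  CD-nonneg c h = subst (λ l → ℤ.0ℤ ℤ.≤ CD c l) (ListP.++-identityʳ h) (sumS≤CD c h [])

  CD≤Dval : ∀ (c : Fin k) h → CD c h ℤ.≤ Dval h
  CD≤Dval c h with CD-attained c h
  -- The empty suffix counts for `CD` but is not a segment; its sum 0 is covered by nonnegativity.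
  ... | p , []    , _    , e = subst (ℤ._≤ Dval h) (sym e) (Dval-nonneg h)
  ... | p , y ∷ t , refl , e = subst (ℤ._≤ Dval h) (sym e)
        (sumS≤Dval c h (subst (λ l → y ∷ t ∈ segments (p ++ l)) (ListP.++-identityʳ (y ∷ t)) (segments⁺ p y t [])))

  -- A best suffix of `h`, extended by `x`, competes for `h ++ [ x ]`. The invariants have `CD` on
  -- their larger side, so bounds from below are the ones that matter.
  CD-snoc : ∀ (c : Fin k) h x → CD c h ℤ.+ sgn c x ℤ.≤ CD c (h ++ [ x ])
  CD-snoc c h x with CD-attained c h
  ... | p , t , refl , e = subst₂ ℤ._≤_ (trans (sumS-snoc c t x) (cong (ℤ._+ sgn c x) (sym e)))
        (cong (CD c) (sym (ListP.++-assoc p t [ x ]))) (sumS≤CD c p (t ++ [ x ]))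

  halfD-nonneg : ∀ (h : List (Fin k)) → ℤ.0ℤ ℤ.≤ halfD h
  halfD-nonneg h = nonneg (halfD h) (ℤP.≤-trans (Dval-nonneg h) (≤-ceiling-half (Dval h)))
    where
    nonneg : ∀ z → ℤ.0ℤ ℤ.≤ z ℤ.+ z → ℤ.0ℤ ℤ.≤ z
    nonneg (+ n)    _ = ℤ.+≤+ z≤n
    nonneg -[1+ n ] ()

  -- All three quantities are nonnegative; in ℕ the invariants become accessible to `lin` and the
  -- ring solver.
  d hd : List (Fin k) → ℕ
  d h  = ℤ.∣ Dval h ∣
  hd h = ℤ.∣ halfD h ∣

  cd : Fin k → List (Fin k) → ℕ
  cd c h = ℤ.∣ CD c h ∣

  +d : ∀ h → + d h ≡ Dval h
  +d h = ℤP.0≤i⇒+∣i∣≡i (Dval-nonneg h)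

  +hd : ∀ h → + hd h ≡ halfD h
  +hd h = ℤP.0≤i⇒+∣i∣≡i (halfD-nonneg h)

  +cd : ∀ c h → + cd c h ≡ CD c h
  +cd c h = ℤP.0≤i⇒+∣i∣≡i (CD-nonneg c h)

  d-mono : ∀ h x → d h ℕ.≤ d (h ++ [ x ])
  d-mono h x = ℤP.drop‿+≤+ (subst₂ ℤ._≤_ (sym (+d h)) (sym (+d (h ++ [ x ]))) (Dval-mono h x))

  cd≤d : ∀ c h → cd c h ℕ.≤ d h
  cd≤d c h = ℤP.drop‿+≤+ (subst₂ ℤ._≤_ (sym (+cd c h)) (sym (+d h)) (CD≤Dval c h))

  d≤hd+hd : ∀ h → d h ℕ.≤ hd h ℕ.+ hd h
  d≤hd+hd h = ℤP.drop‿+≤+ (subst₂ ℤ._≤_ (sym (+d h)) (cong₂ ℤ._+_ (sym (+hd h)) (sym (+hd h))) (≤-ceiling-half (Dval h)))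

  hd+hd≤d+1 : ∀ h → hd h ℕ.+ hd h ℕ.≤ d h ℕ.+ 1
  hd+hd≤d+1 h = ℤP.drop‿+≤+ (subst₂ ℤ._≤_ (cong₂ ℤ._+_ (sym (+hd h)) (sym (+hd h))) (cong (ℤ._+ + 1) (sym (+d h))) (ceiling-half-≤ (Dval h)))

  -- Inherited from `D` by integrality: a smaller new value would give `2⌈D′/2⌉ + 1 ≤ D ≤ D′`,
  -- although `D′ ≤ 2⌈D′/2⌉`.
  hd-mono : ∀ h x → hd h ℕ.≤ hd (h ++ [ x ])
  hd-mono h x = ℕP.≮⇒≥ λ lt → ℕP.<-irrefl refl
    (ℕP.<-≤-trans (ℕP.≤-<-trans (d-mono h x) (ℕP.≤-<-trans (d≤hd+hd (h ++ [ x ])) (ℕP.n<1+n _)))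
      (arith lt (hd+hd≤d+1 h)))
    where
    arith : ∀ {a b e} → a ℕ.< b → b ℕ.+ b ℕ.≤ e ℕ.+ 1 → suc (a ℕ.+ a) ℕ.≤ e
    arith {a} {b} {e} p q = lin 0 (p ⊕ p ⊕ q) (eq a b e)
      where
      eq : ∀ a b e → suc (a ℕ.+ a) ℕ.+ (b ℕ.+ b ℕ.+ (e ℕ.+ 1)) ℕ.+ 0 ≡ e ℕ.+ (suc a ℕ.+ suc a ℕ.+ (b ℕ.+ b))
      eq = ℕS.solve-∀

  cd-snoc-same : ∀ c h → suc (cd c h) ℕ.≤ cd c (h ++ [ c ])
  cd-snoc-same c h = ℤP.drop‿+≤+ (subst₂ ℤ._≤_ (trans (cong₂ ℤ._+_ (sym (+cd c h)) (sgn-same c)) (cong +_ (ℕP.+-comm (cd c h) 1)))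
    (sym (+cd c (h ++ [ c ]))) (CD-snoc c h c))

  cd-snoc : ∀ c h x → cd c h ℕ.≤ suc (cd c (h ++ [ x ]))
  cd-snoc c h x = ℤP.drop‿+≤+ (subst₂ ℤ._≤_ (sym (+cd c h)) (cong (ℤ._+_ (+ 1)) (sym (+cd c (h ++ [ x ]))))
    (linℤ (ℤP.+-mono-≤ (CD-snoc c h x) (sgn-≥-1 c x)) (eq (CD c h) (CD c (h ++ [ x ])) (sgn c x))))
    where
    eq : ∀ a b s → a ℤ.+ (b ℤ.+ s) ≡ + 1 ℤ.+ b ℤ.+ (a ℤ.+ s ℤ.+ ℤ.-1ℤ)
    eq = ℤS.solve-∀

-- The BAF invariants

δ : ∀ {k} → Fin k → Fin k → ℕ
δ c x with x Fin.≟ c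
... | yes _ = 1
... | no  _ = 0

δ-same : ∀ {k} (c : Fin k) → δ c c ≡ 1
δ-same c with c Fin.≟ c
... | yes _   = refl
... | no  c≢c = contradiction refl c≢c

δ-diff : ∀ {k} {c x : Fin k} → x ≢ c → δ c x ≡ 0
δ-diff {c = c} {x} x≢c with x Fin.≟ c
... | yes x≡c = contradiction x≡c x≢c
... | no  _   = refl

module _ {k : ℕ} where

  Ncount-∷ : ∀ (b : PseudoBin k) bs c → Ncount (b ∷ bs) c ≡ δ c (ptop b) ℕ.+ Ncount bs c
  Ncount-∷ b bs c with ptop b Fin.≟ c
  ... | yes _ = refl
  ... | no  _ = refl

  Ncount-snoc : ∀ (bs : List (PseudoBin k)) b c → Ncount (bs ++ [ b ]) c ≡ Ncount bs c ℕ.+ δ c (ptop b)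
  Ncount-snoc []       b c = trans (Ncount-∷ b [] c) (ℕP.+-identityʳ _)
  Ncount-snoc (x ∷ bs) b c = trans (Ncount-∷ x (bs ++ [ b ]) c) (trans (cong (δ c (ptop x) ℕ.+_) (Ncount-snoc bs b c))
    (trans (sym (ℕP.+-assoc (δ c (ptop x)) _ _)) (cong (ℕ._+ δ c (ptop b)) (sym (Ncount-∷ x bs c)))))

  -- The old top stays on the left side to avoid truncated subtraction.
  Ncount-updateAt : ∀ (bs : List (PseudoBin k)) j f c →
    Ncount (updateAt bs j f) c ℕ.+ δ c (topAt bs j) ≡ Ncount bs c ℕ.+ δ c (ptop (f (List.lookup bs j)))
  Ncount-updateAt (x ∷ bs) Fin.zero f c
    rewrite Ncount-∷ (f x) bs c | Ncount-∷ x bs c = eq (δ c (ptop (f x))) (Ncount bs c) (δ c (ptop x))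
    where
    eq : ∀ a n b → a ℕ.+ n ℕ.+ b ≡ b ℕ.+ n ℕ.+ a
    eq = ℕS.solve-∀
  Ncount-updateAt (x ∷ bs) (Fin.suc j) f c
    rewrite Ncount-∷ x (updateAt bs j f) c | Ncount-∷ x bs c =
      trans (ℕP.+-assoc (δ c (ptop x)) _ _) (trans (cong (δ c (ptop x) ℕ.+_) (Ncount-updateAt bs j f c))
        (sym (ℕP.+-assoc (δ c (ptop x)) _ _)))

  Ncount-absent : ∀ {c} {bs : List (PseudoBin k)} → All (λ b → ptop b ≡ c) bs → ∀ {x} → x ≢ c → Ncount bs x ≡ 0
  Ncount-absent []                          x≢c = refl
  Ncount-absent {bs = b ∷ bs} (refl ∷ all) x≢c =
    trans (Ncount-∷ b bs _) (cong₂ ℕ._+_ (δ-diff (≢-sym x≢c)) (Ncount-absent all x≢c))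

  Ncount-all : ∀ {c} {bs : List (PseudoBin k)} → All (λ b → ptop b ≡ c) bs → Ncount bs c ≡ length bs
  Ncount-all []                         = refl
  Ncount-all {bs = b ∷ bs} (refl ∷ all) = trans (Ncount-∷ b bs _) (cong₂ ℕ._+_ (δ-same (ptop b)) (Ncount-all all))

  Ncount-three : ∀ {x y z : Fin k} → x ≢ y → y ≢ z → x ≢ z → ∀ bs →
    Ncount bs x ℕ.+ Ncount bs y ℕ.+ Ncount bs z ℕ.≤ length bs
  Ncount-three                 x≢y y≢z x≢z []       = z≤n
  Ncount-three {x} {y} {z} x≢y y≢z x≢z (b ∷ bs)
    rewrite Ncount-∷ b bs x | Ncount-∷ b bs y | Ncount-∷ b bs z =
      lin 0 (one (ptop b) ⊕ Ncount-three x≢y y≢z x≢z bs)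
        (eq (δ x (ptop b)) (δ y (ptop b)) (δ z (ptop b)) (Ncount bs x) (Ncount bs y) (Ncount bs z) (length bs))
    where
    one : ∀ t → δ x t ℕ.+ δ y t ℕ.+ δ z t ℕ.≤ 1
    one t with t Fin.≟ x | t Fin.≟ y | t Fin.≟ z
    ... | yes p | yes q | _     = contradiction (trans (sym p) q) x≢y
    ... | yes p | no  _ | yes r = contradiction (trans (sym p) r) x≢z
    ... | no  _ | yes q | yes r = contradiction (trans (sym q) r) y≢z
    ... | yes _ | no  _ | no  _ = ℕP.≤-refl
    ... | no  _ | yes _ | no  _ = ℕP.≤-refl
    ... | no  _ | no  _ | yes _ = ℕP.≤-refl
    ... | no  _ | no  _ | no  _ = z≤n
    eq : ∀ a b c n m p l → (a ℕ.+ n) ℕ.+ (b ℕ.+ m) ℕ.+ (c ℕ.+ p) ℕ.+ (1 ℕ.+ l) ℕ.+ 0 ≡ suc l ℕ.+ (a ℕ.+ b ℕ.+ c ℕ.+ (n ℕ.+ m ℕ.+ p))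
    eq = ℕS.solve-∀

  nextFit-top : ∀ (s : ℚ) (c : Fin k) b → ptop (nextFit (s , c) b) ≡ c
  nextFit-top s c (pbin _ l n) with (l + s) ℚP.≤? 1ℚ
  ... | yes _ = refl
  ... | no  _ = refl

  length-updateAt : ∀ {A : Set} (xs : List A) j f → length (updateAt xs j f) ≡ length xs
  length-updateAt (x ∷ xs) Fin.zero    f = refl
  length-updateAt (x ∷ xs) (Fin.suc j) f = cong suc (length-updateAt xs j f)

  -- A pair of colours may exceed 2⌈D/2⌉ by only half of its joint current discrepancy: this is
  -- what keeps rule 3 from being blocked, as both colours above ⌈D/2⌉ cannot lack slack at once.
  record Invariant (h : List (Fin k)) (bs : List (PseudoBin k)) : Set where
    constructor invariant
    field
      total  : length bs ℕ.≤ d h ℕ.+ hd h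
      single : ∀ c → Ncount bs c ℕ.≤ hd h ℕ.+ cd c h
      pair   : ∀ {b x} → b ≢ x → Ncount bs b ℕ.+ Ncount bs x ℕ.+ (Ncount bs b ℕ.+ Ncount bs x)
                 ℕ.≤ 4 ℕ.* hd h ℕ.+ cd b h ℕ.+ cd x h ℕ.+ 1
  open Invariant public

  -- This form serves three purposes: it excludes three colours above `⌈D/2⌉`, it bounds two colours
  -- once a third is large, and on the tight instances it bounds `⌈D/2⌉` from below.
  total≤3hd : ∀ {h bs} → Invariant h bs → length bs ℕ.≤ hd h ℕ.+ hd h ℕ.+ hd h
  total≤3hd {h} inv = ℕP.≤-trans (total inv) (ℕP.+-monoˡ-≤ (hd h) (d≤hd+hd h))

  initial : Invariant [] []
  initial = invariant z≤n (λ _ → z≤n) (λ _ → z≤n)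

  module _ {h : List (Fin k)} {bs : List (PseudoBin k)} (inv : Invariant h bs) (c : Fin k) (s : ℚ) where

    private
      N  = Ncount bs
      H  = hd h
      H′ = hd (h ++ [ c ])
      C  = λ x → cd x h
      C′ = λ x → cd x (h ++ [ c ])

      3H : ∀ {x y z} → x ≢ y → y ≢ z → x ≢ z → N x ℕ.+ N y ℕ.+ N z ℕ.≤ H ℕ.+ H ℕ.+ H
      3H x≢y y≢z x≢z = ℕP.≤-trans (Ncount-three x≢y y≢z x≢z bs) (total≤3hd inv)

    -- Here `N_c` is the number of all bins, so the bound on a single colour, whose `CD_c` the item
    -- raises, becomes the bound on the total.
    place-new : All (λ b → ptop b ≡ c) bs → Invariant (h ++ [ c ]) (place bs new (s , c))
    place-new all = invariant total′ single′ pair′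
      where
      N′ = Ncount (bs ++ [ pbin c s 1 ])
      T  = length bs
      N′c : N′ c ≡ T ℕ.+ 1
      N′c = trans (Ncount-snoc bs (pbin c s 1) c) (cong₂ ℕ._+_ (Ncount-all all) (δ-same c))
      N′z : ∀ {z} → z ≢ c → N′ z ≡ 0
      N′z {z} z≢c = trans (Ncount-snoc bs (pbin c s 1) z) (cong₂ ℕ._+_ (Ncount-absent all z≢c) (δ-diff (≢-sym z≢c)))
      bound : T ℕ.+ 1 ℕ.≤ H′ ℕ.+ C′ c
      bound = lin 0 (subst (ℕ._≤ H ℕ.+ C c) (Ncount-all all) (single inv c) ⊕ cd-snoc-same c h ⊕ hd-mono h c)
        (eq T H (C c) H′ (C′ c))
        where
        eq : ∀ t h c h′ c′ → t ℕ.+ 1 ℕ.+ (h ℕ.+ c ℕ.+ c′ ℕ.+ h′) ℕ.+ 0 ≡ h′ ℕ.+ c′ ℕ.+ (t ℕ.+ suc c ℕ.+ h)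
        eq = ℕS.solve-∀
      bound′ : T ℕ.+ 1 ℕ.≤ d (h ++ [ c ]) ℕ.+ H′
      bound′ = lin 0 (bound ⊕ cd≤d c (h ++ [ c ])) (eq (T ℕ.+ 1) H′ (C′ c) (d (h ++ [ c ])))
        where
        eq : ∀ t h c d → t ℕ.+ (h ℕ.+ c ℕ.+ d) ℕ.+ 0 ≡ d ℕ.+ h ℕ.+ (t ℕ.+ c)
        eq = ℕS.solve-∀
      total′ : length (bs ++ [ pbin c s 1 ]) ℕ.≤ d (h ++ [ c ]) ℕ.+ H′
      total′ = subst (ℕ._≤ d (h ++ [ c ]) ℕ.+ H′) (sym (ListP.length-++ bs)) bound′
      single′ : ∀ x → N′ x ℕ.≤ H′ ℕ.+ C′ x
      single′ x with x Fin.≟ c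
      ... | yes refl = subst (ℕ._≤ _) (sym N′c) bound
      ... | no  x≢c  = subst (ℕ._≤ _) (sym (N′z x≢c)) z≤n
      with-c : ∀ {z} → z ≢ c → N′ c ℕ.+ N′ z ℕ.+ (N′ c ℕ.+ N′ z) ℕ.≤ 4 ℕ.* H′ ℕ.+ C′ c ℕ.+ C′ z ℕ.+ 1
      -- One copy of `T + 1` is bounded by `H′ + CD′_c`, the other by `D′ + H′ ≤ 3H′`.
      with-c {z} z≢c rewrite N′c | N′z z≢c = lin (C′ z ℕ.+ 1) (bound ⊕ bound′ ⊕ d≤hd+hd (h ++ [ c ]))
        (eq T H′ (C′ c) (d (h ++ [ c ])) (C′ z))
        where
        eq : ∀ t h c d z → t ℕ.+ 1 ℕ.+ 0 ℕ.+ (t ℕ.+ 1 ℕ.+ 0) ℕ.+ (h ℕ.+ c ℕ.+ (d ℕ.+ h) ℕ.+ (h ℕ.+ h)) ℕ.+ (z ℕ.+ 1)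
               ≡ 4 ℕ.* h ℕ.+ c ℕ.+ z ℕ.+ 1 ℕ.+ (t ℕ.+ 1 ℕ.+ (t ℕ.+ 1) ℕ.+ d)
        eq = ℕS.solve-∀
      pair′ : ∀ {b x} → b ≢ x → N′ b ℕ.+ N′ x ℕ.+ (N′ b ℕ.+ N′ x) ℕ.≤ 4 ℕ.* H′ ℕ.+ C′ b ℕ.+ C′ x ℕ.+ 1
      pair′ {b} {x} b≢x with b Fin.≟ c | x Fin.≟ c
      ... | yes refl | yes refl = contradiction refl b≢x
      ... | yes refl | no  x≢c  = with-c x≢c
      ... | no  b≢c  | yes refl = lin 0 (with-c b≢c) (eq (N′ b) (N′ c) (4 ℕ.* H′) (C′ b) (C′ c))
        where
        eq : ∀ b x h p q → b ℕ.+ x ℕ.+ (b ℕ.+ x) ℕ.+ (h ℕ.+ q ℕ.+ p ℕ.+ 1) ℕ.+ 0 ≡ h ℕ.+ p ℕ.+ q ℕ.+ 1 ℕ.+ (x ℕ.+ b ℕ.+ (x ℕ.+ b))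
        eq = ℕS.solve-∀
      ... | no  b≢c  | no  x≢c  rewrite N′z b≢c | N′z x≢c = z≤n

    -- An item of colour `c` put on a `y`-bin leaves `N_z` alone for every third colour `z`, while
    -- `CD_z` may drop by one. The bound on `N_z` survives either because it holds without `CD_z` or
    -- because it is not tight; the remaining conditions serve the pairs.
    Safe : Fin k → Fin k → Set
    Safe y z = (N z ℕ.≤ H × N z ℕ.≤ N y) ⊎ (H ℕ.< N y × N z ℕ.< H ℕ.+ C z)

    -- Pairs containing `y` need only the old pair bound: for `c` and `y` the joint count is
    -- unchanged and one `CD` gains what the other may lose; for `y` and `z` the lost bin pays for
    -- two drops of `CD`. Pairs avoiding `y` use the bound `3H` on all bins, or that both counts are
    -- at most `H`.
    place-old : ∀ j → topAt bs j ≢ c → (∀ z → z ≢ c → z ≢ topAt bs j → Safe (topAt bs j) z) →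
                Invariant (h ++ [ c ]) (place bs (old j) (s , c))
    place-old j y≢c safe = invariant total′ single′ pair′
      where
      y  = topAt bs j
      bs′ = updateAt bs j (nextFit (s , c))
      N′ = Ncount bs′
      H≤H′ = hd-mono h c
      update : ∀ z → N′ z ℕ.+ δ z y ≡ N z ℕ.+ δ z c
      update z = trans (Ncount-updateAt bs j (nextFit (s , c)) z) (cong (λ t → N z ℕ.+ δ z t) (nextFit-top s c (List.lookup bs j)))
      N′c : N′ c ≡ N c ℕ.+ 1
      N′c = trans (sym (ℕP.+-identityʳ _)) (trans (cong (N′ c ℕ.+_) (sym (δ-diff y≢c))) (trans (update c) (cong (N c ℕ.+_) (δ-same c))))
      N′y : N′ y ℕ.+ 1 ≡ N y
      N′y = trans (cong (N′ y ℕ.+_) (sym (δ-same y))) (trans (update y) (trans (cong (N y ℕ.+_) (δ-diff (≢-sym y≢c))) (ℕP.+-identityʳ _)))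
      N′z : ∀ {z} → z ≢ c → z ≢ y → N′ z ≡ N z
      N′z {z} z≢c z≢y = trans (sym (ℕP.+-identityʳ _)) (trans (cong (N′ z ℕ.+_) (sym (δ-diff (≢-sym z≢y))))
        (trans (update z) (trans (cong (N z ℕ.+_) (δ-diff (≢-sym z≢c))) (ℕP.+-identityʳ _))))
      total′ : length bs′ ℕ.≤ d (h ++ [ c ]) ℕ.+ H′
      total′ = subst (ℕ._≤ _) (sym (length-updateAt bs j (nextFit (s , c))))
        (ℕP.≤-trans (total inv) (ℕP.+-mono-≤ (d-mono h c) H≤H′))
      single-c : N c ℕ.+ 1 ℕ.≤ H′ ℕ.+ C′ c
      single-c = lin 0 (single inv c ⊕ cd-snoc-same c h ⊕ H≤H′) (eq (N c) H (C c) H′ (C′ c))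
        where
        eq : ∀ t h c h′ c′ → t ℕ.+ 1 ℕ.+ (h ℕ.+ c ℕ.+ c′ ℕ.+ h′) ℕ.+ 0 ≡ h′ ℕ.+ c′ ℕ.+ (t ℕ.+ suc c ℕ.+ h)
        eq = ℕS.solve-∀
      single′ : ∀ x → N′ x ℕ.≤ H′ ℕ.+ C′ x
      single′ x with x Fin.≟ c | x Fin.≟ y
      ... | yes refl | _        = subst (ℕ._≤ _) (sym N′c) single-c
      ... | no  _    | yes refl = lin 0 (ℕP.≤-reflexive N′y ⊕ single inv y ⊕ cd-snoc y h c ⊕ H≤H′) (eq (N′ y) (N y) H (C y) (C′ y) H′)
        where
        eq : ∀ m n h c c′ h′ → m ℕ.+ (n ℕ.+ (h ℕ.+ c) ℕ.+ suc c′ ℕ.+ h′) ℕ.+ 0 ≡ h′ ℕ.+ c′ ℕ.+ (m ℕ.+ 1 ℕ.+ n ℕ.+ c ℕ.+ h)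
        eq = ℕS.solve-∀
      ... | no  x≢c  | no  x≢y  rewrite N′z x≢c x≢y with safe x x≢c x≢y
      ...   | inj₁ (p , _) = ℕP.≤-trans p (ℕP.≤-trans H≤H′ (ℕP.m≤m+n H′ (C′ x)))
      ...   | inj₂ (_ , q) = lin 0 (q ⊕ cd-snoc x h c ⊕ H≤H′) (eq (N x) H (C x) (C′ x) H′)
        where
        eq : ∀ n h c c′ h′ → n ℕ.+ (h ℕ.+ c ℕ.+ suc c′ ℕ.+ h′) ℕ.+ 0 ≡ h′ ℕ.+ c′ ℕ.+ (suc n ℕ.+ c ℕ.+ h)
        eq = ℕS.solve-∀
      Pair : Fin k → Fin k → Set
      Pair b x = N′ b ℕ.+ N′ x ℕ.+ (N′ b ℕ.+ N′ x) ℕ.≤ 4 ℕ.* H′ ℕ.+ C′ b ℕ.+ C′ x ℕ.+ 1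
      swap : ∀ {b x} → Pair b x → Pair x b
      swap {b} {x} p = lin 0 p (eq (N′ x) (N′ b) (4 ℕ.* H′) (C′ x) (C′ b))
        where
        eq : ∀ b x h p q → b ℕ.+ x ℕ.+ (b ℕ.+ x) ℕ.+ (h ℕ.+ q ℕ.+ p ℕ.+ 1) ℕ.+ 0 ≡ h ℕ.+ p ℕ.+ q ℕ.+ 1 ℕ.+ (x ℕ.+ b ℕ.+ (x ℕ.+ b))
        eq = ℕS.solve-∀
      pair-cy : Pair c y
      pair-cy rewrite N′c = lin 0 (pair inv (≢-sym y≢c) ⊕ cd-snoc-same c h ⊕ cd-snoc y h c ⊕ H≤H′ ⊕ H≤H′ ⊕ H≤H′ ⊕ H≤H′ ⊕ ℕP.≤-reflexive N′y ⊕ ℕP.≤-reflexive N′y)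
        (eq (N c) (N y) (N′ y) H (C c) (C y) H′ (C′ c) (C′ y))
        where
        eq : ∀ n m m′ h c y h′ c′ y′ →
          n ℕ.+ 1 ℕ.+ m′ ℕ.+ (n ℕ.+ 1 ℕ.+ m′) ℕ.+ (4 ℕ.* h ℕ.+ c ℕ.+ y ℕ.+ 1 ℕ.+ c′ ℕ.+ suc y′ ℕ.+ h′ ℕ.+ h′ ℕ.+ h′ ℕ.+ h′ ℕ.+ m ℕ.+ m) ℕ.+ 0
          ≡ 4 ℕ.* h′ ℕ.+ c′ ℕ.+ y′ ℕ.+ 1 ℕ.+ (n ℕ.+ m ℕ.+ (n ℕ.+ m) ℕ.+ suc c ℕ.+ y ℕ.+ h ℕ.+ h ℕ.+ h ℕ.+ h ℕ.+ (m′ ℕ.+ 1) ℕ.+ (m′ ℕ.+ 1))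
        eq = ℕS.solve-∀
      pair-yz : ∀ {z} → z ≢ c → z ≢ y → Pair y z
      pair-yz {z} z≢c z≢y rewrite N′z z≢c z≢y =
        lin 0 (pair inv (≢-sym z≢y) ⊕ cd-snoc z h c ⊕ cd-snoc y h c ⊕ H≤H′ ⊕ H≤H′ ⊕ H≤H′ ⊕ H≤H′ ⊕ ℕP.≤-reflexive N′y ⊕ ℕP.≤-reflexive N′y)
          (eq (N z) (N y) (N′ y) H (C z) (C y) H′ (C′ z) (C′ y))
        where
        eq : ∀ n m m′ h c y h′ c′ y′ →
          m′ ℕ.+ n ℕ.+ (m′ ℕ.+ n) ℕ.+ (4 ℕ.* h ℕ.+ y ℕ.+ c ℕ.+ 1 ℕ.+ suc c′ ℕ.+ suc y′ ℕ.+ h′ ℕ.+ h′ ℕ.+ h′ ℕ.+ h′ ℕ.+ m ℕ.+ m) ℕ.+ 0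
          ≡ 4 ℕ.* h′ ℕ.+ y′ ℕ.+ c′ ℕ.+ 1 ℕ.+ (m ℕ.+ n ℕ.+ (m ℕ.+ n) ℕ.+ c ℕ.+ y ℕ.+ h ℕ.+ h ℕ.+ h ℕ.+ h ℕ.+ (m′ ℕ.+ 1) ℕ.+ (m′ ℕ.+ 1))
        eq = ℕS.solve-∀
      pair-cz : ∀ {z} → z ≢ c → z ≢ y → Pair c z
      pair-cz {z} z≢c z≢y rewrite N′c | N′z z≢c z≢y with safe z z≢c z≢y
      -- `N_c + 2N_z ≤ N_c + N_z + N_y ≤ 3H` and `N_c + 1 ≤ H′ + CD′_c` fall short of the goal by
      -- one unit: this is the `+ 1` in the invariant for pairs.
      ... | inj₁ (_ , z≤y) = lin (C′ z) (3H (≢-sym z≢c) z≢y (≢-sym y≢c) ⊕ z≤y ⊕ single-c ⊕ H≤H′ ⊕ H≤H′ ⊕ H≤H′) (eq (N c) (N z) (N y) H H′ (C′ c) (C′ z))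
        where
        eq : ∀ n m p h h′ c z → n ℕ.+ 1 ℕ.+ m ℕ.+ (n ℕ.+ 1 ℕ.+ m) ℕ.+ (h ℕ.+ h ℕ.+ h ℕ.+ p ℕ.+ (h′ ℕ.+ c) ℕ.+ h′ ℕ.+ h′ ℕ.+ h′) ℕ.+ z
          ≡ 4 ℕ.* h′ ℕ.+ c ℕ.+ z ℕ.+ 1 ℕ.+ (n ℕ.+ m ℕ.+ p ℕ.+ m ℕ.+ (n ℕ.+ 1) ℕ.+ h ℕ.+ h ℕ.+ h)
        eq = ℕS.solve-∀
      -- With at least `H + 1` bins of colour `y`, the other two colours share at most `2H - 1`.
      ... | inj₂ (H<y , _) = lin (C′ c ℕ.+ C′ z ℕ.+ 1)
            (3H (≢-sym z≢c) z≢y (≢-sym y≢c) ⊕ H<y ⊕ 3H (≢-sym z≢c) z≢y (≢-sym y≢c) ⊕ H<y ⊕ H≤H′ ⊕ H≤H′ ⊕ H≤H′ ⊕ H≤H′)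
            (eq (N c) (N z) (N y) H H′ (C′ c) (C′ z))
        where
        eq : ∀ n m p h h′ c z → n ℕ.+ 1 ℕ.+ m ℕ.+ (n ℕ.+ 1 ℕ.+ m) ℕ.+ (h ℕ.+ h ℕ.+ h ℕ.+ p ℕ.+ (h ℕ.+ h ℕ.+ h) ℕ.+ p ℕ.+ h′ ℕ.+ h′ ℕ.+ h′ ℕ.+ h′) ℕ.+ (c ℕ.+ z ℕ.+ 1)
          ≡ 4 ℕ.* h′ ℕ.+ c ℕ.+ z ℕ.+ 1 ℕ.+ (n ℕ.+ m ℕ.+ p ℕ.+ suc h ℕ.+ (n ℕ.+ m ℕ.+ p) ℕ.+ suc h ℕ.+ h ℕ.+ h ℕ.+ h ℕ.+ h)
        eq = ℕS.solve-∀
      pair-zz : ∀ {z x} → z ≢ x → z ≢ c → z ≢ y → x ≢ c → x ≢ y → Pair z x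
      pair-zz {z} {x} z≢x z≢c z≢y x≢c x≢y rewrite N′z z≢c z≢y | N′z x≢c x≢y = go (safe z z≢c z≢y) (safe x x≢c x≢y)
        where
        Goal = N z ℕ.+ N x ℕ.+ (N z ℕ.+ N x) ℕ.≤ 4 ℕ.* H′ ℕ.+ C′ z ℕ.+ C′ x ℕ.+ 1
        above : H ℕ.< N y → Goal
        above H<y = lin (C′ z ℕ.+ C′ x ℕ.+ 3) (3H z≢x x≢y z≢y ⊕ H<y ⊕ 3H z≢x x≢y z≢y ⊕ H<y ⊕ H≤H′ ⊕ H≤H′ ⊕ H≤H′ ⊕ H≤H′)
          (eq (N z) (N x) (N y) H H′ (C′ z) (C′ x))
          where
          eq : ∀ n m p h h′ c z → n ℕ.+ m ℕ.+ (n ℕ.+ m) ℕ.+ (h ℕ.+ h ℕ.+ h ℕ.+ p ℕ.+ (h ℕ.+ h ℕ.+ h) ℕ.+ p ℕ.+ h′ ℕ.+ h′ ℕ.+ h′ ℕ.+ h′) ℕ.+ (c ℕ.+ z ℕ.+ 3)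
            ≡ 4 ℕ.* h′ ℕ.+ c ℕ.+ z ℕ.+ 1 ℕ.+ (n ℕ.+ m ℕ.+ p ℕ.+ suc h ℕ.+ (n ℕ.+ m ℕ.+ p) ℕ.+ suc h ℕ.+ h ℕ.+ h ℕ.+ h ℕ.+ h)
          eq = ℕS.solve-∀
        go : Safe y z → Safe y x → Goal
        go (inj₂ (H<y , _)) _                = above H<y
        go (inj₁ _)         (inj₂ (H<y , _)) = above H<y
        go (inj₁ (p , _))   (inj₁ (q , _))   = lin (C′ z ℕ.+ C′ x ℕ.+ 1) (p ⊕ q ⊕ p ⊕ q ⊕ H≤H′ ⊕ H≤H′ ⊕ H≤H′ ⊕ H≤H′)
          (eq (N z) (N x) H H′ (C′ z) (C′ x))
          where
          eq : ∀ n m h h′ c z → n ℕ.+ m ℕ.+ (n ℕ.+ m) ℕ.+ (h ℕ.+ h ℕ.+ h ℕ.+ h ℕ.+ h′ ℕ.+ h′ ℕ.+ h′ ℕ.+ h′) ℕ.+ (c ℕ.+ z ℕ.+ 1)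
            ≡ 4 ℕ.* h′ ℕ.+ c ℕ.+ z ℕ.+ 1 ℕ.+ (n ℕ.+ m ℕ.+ n ℕ.+ m ℕ.+ h ℕ.+ h ℕ.+ h ℕ.+ h)
          eq = ℕS.solve-∀
      pair′ : ∀ {b x} → b ≢ x → Pair b x
      pair′ {b} {x} b≢x with b Fin.≟ c | x Fin.≟ c
      ... | yes refl | yes refl = contradiction refl b≢x
      ... | yes refl | no  x≢c  with x Fin.≟ y
      ...   | yes refl = pair-cy
      ...   | no  x≢y  = pair-cz x≢c x≢y
      pair′ {b} {x} b≢x | no b≢c | yes refl with b Fin.≟ y
      ...   | yes refl = swap {c} {y} pair-cy
      ...   | no  b≢y  = swap {c} {b} (pair-cz b≢c b≢y)
      pair′ {b} {x} b≢x | no b≢c | no x≢c with b Fin.≟ y | x Fin.≟ y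
      ...   | yes refl | yes refl = contradiction refl b≢x
      ...   | yes refl | no  x≢y  = pair-yz x≢c x≢y
      ...   | no  b≢y  | yes refl = swap {y} {b} (pair-yz b≢c b≢y)
      ...   | no  b≢y  | no  x≢y  = pair-zz b≢x b≢c b≢y x≢c x≢y

    above⇒ : ∀ {x} → halfD h ℤ.< NZ bs x → H ℕ.< N x
    above⇒ {x} p = ℤP.drop‿+<+ (subst (ℤ._< NZ bs x) (sym (+hd h)) p)

    above⇐ : ∀ {x} → H ℕ.< N x → halfD h ℤ.< NZ bs x
    above⇐ {x} p = subst (ℤ._< NZ bs x) (+hd h) (ℤ.+<+ p)

    private
      slack⇒ : ∀ {x} → NZ bs x ℤ.- halfD h ℤ.< CD x h → N x ℕ.< H ℕ.+ C x
      slack⇒ {x} p = ℤP.drop‿+≤+ (subst₂ ℤ._≤_ refl (cong₂ ℤ._+_ (sym (+hd h)) (sym (+cd x h)))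
        (linℤ (ℤP.i<j⇒suc[i]≤j p) (eq (NZ bs x) (halfD h) (CD x h))))
        where
        eq : ∀ n h c → + 1 ℤ.+ n ℤ.+ c ≡ h ℤ.+ c ℤ.+ (+ 1 ℤ.+ (n ℤ.- h))
        eq = ℤS.solve-∀

      slack⇐ : ∀ {x} → N x ℕ.< H ℕ.+ C x → NZ bs x ℤ.- halfD h ℤ.< CD x h
      slack⇐ {x} p = ℤP.suc[i]≤j⇒i<j (linℤ (subst₂ ℤ._≤_ refl (cong₂ ℤ._+_ (+hd h) (+cd x h)) (ℤ.+≤+ p))
        (eq (NZ bs x) (halfD h) (CD x h)))
        where
        eq : ∀ n h c → + 1 ℤ.+ (n ℤ.- h) ℤ.+ (h ℤ.+ c) ≡ c ℤ.+ (+ 1 ℤ.+ n)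
        eq = ℤS.solve-∀

    place-allowed : ∀ {ch} → BAFAllowed h bs c ch → Invariant (h ++ [ c ]) (place bs ch (s , c))
    place-allowed (rule1 all) = place-new all
    place-allowed (rule2 j ¬all one y≢c maximal) = place-old j y≢c λ z z≢c z≢y → safe z z≢y (maximal z z≢c)
      where
      safe : ∀ z → z ≢ topAt bs j → N z ℕ.≤ N (topAt bs j) → Safe (topAt bs j) z
      safe z z≢y z≤y with N z ℕP.≤? H
      ... | yes z≤H = inj₁ (z≤H , z≤y)
      -- A third colour above `H` would force the maximal colour `y` above `H` as well, so rule 2
      -- would not apply.
      ... | no  z≰H = contradiction (one z _ (above⇐ (ℕP.≰⇒> z≰H)) (above⇐ (ℕP.<-≤-trans (ℕP.≰⇒> z≰H) z≤y))) z≢y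
    place-allowed (rule3 b w j ¬all b≢w H<b H<w only choice) = go choice
      where
      low : ∀ {z y} → z ≢ b → z ≢ w → H ℕ.< N y → Safe y z
      low {z} z≢b z≢w H<y with N z ℕP.≤? H
      ... | yes z≤H = inj₁ (z≤H , ℕP.≤-trans z≤H (ℕP.<⇒≤ H<y))
      ... | no  z≰H = ⊥-elim ([ z≢b , z≢w ]′ (only z (above⇐ (ℕP.≰⇒> z≰H))))
      go : _ → Invariant (h ++ [ c ]) (place bs (old j) (s , c))
      go (inj₁ (refl , refl)) = place-old j b≢w λ z z≢c z≢y → low z≢y z≢c (above⇒ H<b)
      go (inj₂ (inj₁ (refl , refl))) = place-old j (≢-sym b≢w) λ z z≢c z≢y → low z≢c z≢y (above⇒ H<w)
      go (inj₂ (inj₂ (inj₁ (c≢b , c≢w , slack , refl)))) = place-old j (≢-sym c≢w) safe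
        where
        safe : ∀ z → z ≢ c → z ≢ w → Safe w z
        safe z z≢c z≢w with z Fin.≟ b
        ... | yes refl = inj₂ (above⇒ H<w , slack⇒ slack)
        ... | no  z≢b  = low z≢b z≢w (above⇒ H<w)
      go (inj₂ (inj₂ (inj₂ (c≢b , c≢w , ¬slack , refl)))) = place-old j (≢-sym c≢b) safe
        where
        -- If both colours were tight, `2(N_b + N_w)` would be at least
        -- `(2H + CD_b + CD_w) + (2H + 2)`, one more than the pair bound permits.
        w-slack : N w ℕ.< H ℕ.+ C w
        w-slack = ℕP.≰⇒> λ tight → ℕP.<-irrefl refl
          (lin {suc 0} {0} 0 (pair inv b≢w ⊕ ℕP.≮⇒≥ (λ lt → ¬slack (slack⇐ lt)) ⊕ tight ⊕ above⇒ H<b ⊕ above⇒ H<w)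
            (eq (N b) (N w) H (C b) (C w)))
          where
          eq : ∀ b w h p q → 1 ℕ.+ (4 ℕ.* h ℕ.+ p ℕ.+ q ℕ.+ 1 ℕ.+ b ℕ.+ w ℕ.+ b ℕ.+ w) ℕ.+ 0
            ≡ 0 ℕ.+ (b ℕ.+ w ℕ.+ (b ℕ.+ w) ℕ.+ (h ℕ.+ p) ℕ.+ (h ℕ.+ q) ℕ.+ suc h ℕ.+ suc h)
          eq = ℕS.solve-∀
        safe : ∀ z → z ≢ c → z ≢ b → Safe b z
        safe z z≢c z≢b with z Fin.≟ w
        ... | yes refl = inj₂ (above⇒ H<b , w-slack)
        ... | no  z≢w  = low z≢b z≢w (above⇒ H<b)
    -- Three colours above `H` would need more than `3H` bins, so the degenerate case never arises.
    place-allowed (rule3+ ch x y z ¬all x≢y y≢z x≢z H<x H<y H<z) = ⊥-elim (ℕP.<-irrefl refl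
      (lin {suc 0} {0} 2 (3H x≢y y≢z x≢z ⊕ above⇒ H<x ⊕ above⇒ H<y ⊕ above⇒ H<z) (eq (N x) (N y) (N z) H)))
      where
      eq : ∀ x y z h → 1 ℕ.+ (h ℕ.+ h ℕ.+ h ℕ.+ x ℕ.+ y ℕ.+ z) ℕ.+ 2 ≡ 0 ℕ.+ (x ℕ.+ y ℕ.+ z ℕ.+ suc h ℕ.+ suc h ℕ.+ suc h)
      eq = ℕS.solve-∀

-- Offline packings

sel-same : ∀ {m} {A : Set} (b : Fin m) {x y : A} → sel b b x y ≡ x
sel-same b with b Fin.≟ b
... | yes _   = refl
... | no  b≢b = contradiction refl b≢b

sel-other : ∀ {m} {A : Set} {b b′ : Fin m} {x y : A} → b′ ≢ b → sel b b′ x y ≡ y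
sel-other {b = b} {b′} b′≢b with b′ Fin.≟ b
... | yes e = contradiction e b′≢b
... | no  _ = refl

module SumUpdate (M : CommutativeMonoid 0ℓ 0ℓ) where
  open CommutativeMonoid M
  open SumProperties M public using () renaming (sum to ∑)
  open SumProperties M using (sum-remove; sum-cong-≋)
  open MonoidSolver M using (_⊜_) renaming (_⊕_ to infixl 5 _:+_; solve to monoid-solve)
  open import Relation.Binary.Reasoning.Setoid setoid
  open import Data.Vec.Functional using (removeAt)

  -- Stated without subtraction, so that one proof covers counts in ℕ and loads in ℚ.
  sum-update : ∀ {m} (f g : Fin m → Carrier) b → (∀ b′ → b′ ≢ b → g b′ ≈ f b′) → ∑ g ∙ f b ≈ ∑ f ∙ g b
  sum-update {suc m} f g b same = begin
    ∑ g ∙ f b                     ≈⟨ ∙-congʳ (sum-remove {i = b} g) ⟩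
    g b ∙ ∑ (removeAt g b) ∙ f b  ≈⟨ ∙-congʳ (∙-congˡ (sum-cong-≋ {n = m} (λ i → same (Fin.punchIn b i) (FinP.punchInᵢ≢i b i)))) ⟩
    g b ∙ ∑ (removeAt f b) ∙ f b  ≈⟨ monoid-solve 3 (λ x y z → x :+ y :+ z ⊜ z :+ y :+ x) refl′ (g b) (∑ (removeAt f b)) (f b) ⟩
    f b ∙ ∑ (removeAt f b) ∙ g b  ≈⟨ ∙-congʳ (sum-remove {i = b} f) ⟨
    ∑ f ∙ g b                     ∎
    where refl′ = CommutativeMonoid.refl M

open SumUpdate ℕP.+-0-commutativeMonoid using () renaming (∑ to ∑ℕ; sum-update to ∑ℕ-update)
open SumUpdate ℚP.+-0-commutativeMonoid using () renaming (∑ to ∑ℚ; sum-update to ∑ℚ-update)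

∑ℕ-≤ : ∀ {m} (f : Fin m → ℕ) → (∀ b → f b ℕ.≤ 1) → ∑ℕ f ℕ.≤ m
∑ℕ-≤ {zero}  f f≤1 = z≤n
∑ℕ-≤ {suc m} f f≤1 = f≤1 Fin.zero ⊕ ∑ℕ-≤ (f ∘ Fin.suc) (f≤1 ∘ Fin.suc)

∑ℚ-≤ : ∀ {m} (f : Fin m → ℚ) → (∀ b → f b ≤ 1ℚ) → ∑ℚ f ≤ toℚ m
∑ℚ-≤ {zero}  f f≤1 = ℚP.≤-refl
∑ℚ-≤ {suc m} f f≤1 = ℚP.≤-trans (f≤1 Fin.zero ⊞ ∑ℚ-≤ (f ∘ Fin.suc) (f≤1 ∘ Fin.suc)) (ℚP.≤-reflexive (sym (toℚ-+ 1 m)))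

module _ {k : ℕ} where

  -- Marks the bins whose top does not block `c`; their number is the potential that bounds
  -- discrepancies.
  admits : Fin k → Maybe (Fin k) → ℕ
  admits c nothing  = 1
  admits c (just x) with x Fin.≟ c
  ... | yes _ = 0
  ... | no  _ = 1

  admits≤1 : ∀ c t → admits c t ℕ.≤ 1
  admits≤1 c nothing = ℕP.≤-refl
  admits≤1 c (just x) with x Fin.≟ c
  ... | yes _ = z≤n
  ... | no  _ = ℕP.≤-refl

  admits-≢ : ∀ c t → t ≢ just c → admits c t ≡ 1
  admits-≢ c nothing  t≢ = refl
  admits-≢ c (just x) t≢ with x Fin.≟ c
  ... | yes refl = contradiction refl t≢
  ... | no  _    = refl

  ∑admits : ∀ {m} → Fin k → BinsState k m → ℕ
  ∑admits c st = ∑ℕ (admits c ∘ top st)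

  -- Each item of colour c closes a bin for c, every other item reopens at most one.
  sgn-∑admits : ∀ {m} c (st : BinsState k m) b s x → top st b ≢ just x →
              sgn c x ℤ.+ + ∑admits c (putIn st b (s , x)) ℤ.≤ + ∑admits c st
  sgn-∑admits c st b s x t≢ = bound (∑ℕ-update (admits c ∘ top st) (admits c ∘ top (putIn st b (s , x))) b
      (λ b′ b′≢b → cong (admits c) (sel-other b′≢b)))
    where
    W  = ∑admits c st
    W′ = ∑admits c (putIn st b (s , x))
    bound : W′ ℕ.+ admits c (top st b) ≡ W ℕ.+ admits c (top (putIn st b (s , x)) b) → sgn c x ℤ.+ + W′ ℤ.≤ + W
    bound e with trans e (cong (λ t → W ℕ.+ admits c t) (sel-same b))
    ... | e′ with c Fin.≟ x
    ...   | yes refl = ℤP.≤-reflexive (cong +_ (ℕP.+-cancelʳ-≡ 0 _ _ (trans (trans (eq W′) (trans (cong (W′ ℕ.+_) (sym (admits-≢ c (top st b) t≢))) e′))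
                         (cong (W ℕ.+_) closed))))
      where
      eq : ∀ w → suc w ℕ.+ 0 ≡ w ℕ.+ 1
      eq = ℕS.solve-∀
      closed : admits c (just c) ≡ 0
      closed with c Fin.≟ c
      ... | yes _   = refl
      ... | no  c≢c = contradiction refl c≢c
    ...   | no c≢x = linℤ (ℤ.+≤+ {m = W′ ℕ.+ 0} {n = W ℕ.+ 1} (ℕP.≤-trans (ℕP.+-monoʳ-≤ W′ z≤n)
                       (ℕP.≤-trans (ℕP.≤-reflexive e′) (ℕP.+-monoʳ-≤ W (admits≤1 c (just x)))))) (eq (+ W′) (+ W))
      where
      eq : ∀ w′ w → ℤ.-1ℤ ℤ.+ w′ ℤ.+ (w ℤ.+ + 1) ≡ w ℤ.+ (w′ ℤ.+ + 0)
      eq = ℤS.solve-∀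

  sumS-prefix : ∀ {m} c {st : BinsState k m} {L} → Packs st L → ∀ p r → map colour L ≡ p ++ r → sumS c p ℤ.≤ + ∑admits c st
  sumS-prefix c pk [] r e = ℤ.+≤+ z≤n
  sumS-prefix c (put {st = st} {s = s} {c = x} b _ t≢ pk) (_ ∷ p) r e with ListP.∷-injective e
  ... | refl , e′ = ℤP.≤-trans (ℤP.+-monoʳ-≤ (sgn c x) (sumS-prefix c pk p r e′)) (sgn-∑admits c st b s x t≢)

  -- Packing the part before the segment only changes the state, and the prefix bound holds from any
  -- state.
  sumS-segment : ∀ {m} c {st : BinsState k m} {L} → Packs st L → ∀ q p r → map colour L ≡ q ++ p ++ r → sumS c p ℤ.≤ + m
  sumS-segment c {st} pk [] p r e =
    ℤP.≤-trans (sumS-prefix c pk p r e) (ℤ.+≤+ (∑ℕ-≤ (admits c ∘ top st) (λ b → admits≤1 c (top st b))))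
  sumS-segment c (put b _ _ pk) (x ∷ q) p r e = sumS-segment c pk q p r (ListP.∷-injectiveʳ e)

  Dval≤bins : ∀ {m} {st : BinsState k m} {L} → Packs st L → Dval (map colour L) ℤ.≤ + m
  Dval≤bins {m} {L = L} pk = Dval-least (map colour L) (ℤ.+≤+ z≤n) bound
    where
    bound : ∀ c {s} → s ∈ segments (map colour L) → sumS c s ℤ.≤ + m
    bound c s∈ with segments⁻ (map colour L) s∈
    ... | q , x , s , r , refl , e = sumS-segment c pk q (x ∷ s) r e

  volume : List (Item k) → ℚ
  volume = List.foldr (λ it v → size it + v) 0ℚ

  -- Load already packed plus volume still to come is constant along a packing, and at the end every
  -- load is at most 1.
  volume-bound : ∀ {m} {st : BinsState k m} {L} → Packs st L → (∀ b → load st b ≤ 1ℚ) → ∑ℚ (load st) + volume L ≤ toℚ m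
  volume-bound {st = st} done ≤1 = ℚP.≤-trans (ℚP.≤-reflexive (ℚP.+-identityʳ _)) (∑ℚ-≤ (load st) ≤1)
  volume-bound {m} {st} (put {s = s} {c = c} {L = L} b fits _ pk) ≤1 =
    ℚP.≤-trans (ℚP.≤-reflexive eq) (volume-bound pk ≤1′)
    where
    st′ = putIn st b (s , c)
    ≤1′ : ∀ b′ → load st′ b′ ≤ 1ℚ
    ≤1′ b′ with b′ Fin.≟ b
    ... | yes refl = fits
    ... | no  _    = ≤1 b′
    e : ∑ℚ (load st′) + load st b ≡ ∑ℚ (load st) + (load st b + s)
    e = trans (∑ℚ-update (load st) (load st′) b (λ b′ b′≢b → sel-other b′≢b)) (cong (_+_ (∑ℚ (load st))) (sel-same b))
    eq₁ : ∀ w l s v → w + (s + v) ≡ (w + (l + s)) - l + v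
    eq₁ = solve-∀ ℚ-ring
    eq₂ : ∀ w l v → w + l - l + v ≡ w + v
    eq₂ = solve-∀ ℚ-ring
    eq : ∑ℚ (load st) + (s + volume L) ≡ ∑ℚ (load st′) + volume L
    eq = trans (eq₁ (∑ℚ (load st)) (load st b) s (volume L)) (trans (cong (λ x → x - load st b + volume L) (sym e))
      (eq₂ (∑ℚ (load st′)) (load st b) (volume L)))

-- Next Fit

All-updateAt : ∀ {A : Set} {P : A → Set} {xs : List A} {f} → All P xs → ∀ j →
               (P (List.lookup xs j) → P (f (List.lookup xs j))) → All P (updateAt xs j f)
All-updateAt (p ∷ ps) Fin.zero    g = g p ∷ ps
All-updateAt (p ∷ ps) (Fin.suc j) g = p ∷ All-updateAt ps j g

All-lookup : ∀ {A : Set} {P : A → Set} {xs : List A} → All P xs → ∀ j → P (List.lookup xs j)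
All-lookup (p ∷ ps) Fin.zero    = p
All-lookup (p ∷ ps) (Fin.suc j) = All-lookup ps j

Single : ∀ {k} → PseudoBin k → Set
Single b = nreal b ≡ 1

cost-single : ∀ {k} {bs : List (PseudoBin k)} → All Single bs → cost bs ≡ length bs
cost-single []       = refl
cost-single (p ∷ ps) = cong₂ ℕ._+_ p (cost-single ps)

-- θ is charged per unit of volume and ρ ≤ θ is refunded per unit of load of the current real bin;
-- an overflow of Next Fit must then strictly pay for the new real bin.
Charges : ∀ {k} → ℚ → ℚ → Item k → Set
Charges θ ρ it = ∀ l → 1ℚ < l + size it → 1ℚ + ρ * size it < ρ * l + θ * size it

nextFit-cases : ∀ {k} s c (b : PseudoBin k) →
  (nextFit (s , c) b ≡ pbin c (pload b + s) (nreal b) × pload b + s ≤ 1ℚ) ⊎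
  (nextFit (s , c) b ≡ pbin c s (suc (nreal b)) × 1ℚ < pload b + s)
nextFit-cases s c (pbin _ l n) with (l + s) ℚP.≤? 1ℚ
... | yes fits = inj₁ (refl , fits)
... | no  ¬fits = inj₂ (refl , ℚP.≰⇒> ¬fits)

module NextFitPotential {k : ℕ} (θ ρ : ℚ) (0≤ρ : 0ℚ ≤ ρ) (ρ≤θ : ρ ≤ θ) where

  -- The first real bin of a pseudo bin is free, hence the `- 1ℚ`: it is accounted for by the number
  -- of pseudo bins. The term `ρ * pload b` is volume already charged and set aside for the next
  -- overflow.
  φ : PseudoBin k → ℚ
  φ b = toℚ (nreal b) + ρ * pload b - 1ℚ

  Φ : List (PseudoBin k) → ℚ
  Φ = List.foldr (λ b v → φ b + v) 0ℚ

  Φ-snoc : ∀ bs b → Φ (bs ++ [ b ]) ≡ Φ bs + φ b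
  Φ-snoc []       b = ℚP.+-comm (φ b) 0ℚ
  Φ-snoc (x ∷ bs) b = trans (cong (_+_ (φ x)) (Φ-snoc bs b)) (sym (ℚP.+-assoc (φ x) (Φ bs) (φ b)))

  Φ-updateAt : ∀ bs j f → Φ (updateAt bs j f) + φ (List.lookup bs j) ≡ Φ bs + φ (f (List.lookup bs j))
  Φ-updateAt (x ∷ bs) Fin.zero f = eq (φ (f x)) (Φ bs) (φ x)
    where
    eq : ∀ a b c → a + b + c ≡ c + b + a
    eq = solve-∀ ℚ-ring
  Φ-updateAt (x ∷ bs) (Fin.suc j) f =
    trans (ℚP.+-assoc (φ x) _ _) (trans (cong (_+_ (φ x)) (Φ-updateAt bs j f)) (sym (ℚP.+-assoc (φ x) _ _)))

  cost≤Φ : ∀ {bs} → All (λ b → 0ℚ ≤ pload b) bs → toℚ (cost bs) ≤ Φ bs + toℚ (length bs)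
  cost≤Φ [] = ℚP.≤-refl
  cost≤Φ {b ∷ bs} (0≤l ∷ 0≤ls) = subst₂ _≤_ (sym (toℚ-+ (nreal b) (cost bs))) (cong (_+_ (Φ (b ∷ bs))) (sym (toℚ-+ 1 (length bs))))
    (linℚ (mul-nonneg 0≤ρ 0≤l ⊞ cost≤Φ 0≤ls) (eq (toℚ (nreal b)) (toℚ (cost bs)) (ρ * pload b) (Φ bs) (toℚ (length bs))))
    where
    eq : ∀ n c l p t → n + c + (l + (p + t)) ≡ n + l - 1ℚ + p + (1ℚ + t) + (0ℚ + c)
    eq = solve-∀ ℚ-ring

  -- Strictness is gained at the first overflow and kept from then on; before it every pseudo bin
  -- has a single real bin.
  record NextFit (bs : List (PseudoBin k)) (σ : ℚ) : Set where
    constructor nextfit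
    field
      loads    : All (λ b → 0ℚ ≤ pload b) bs
      charged  : Φ bs ≤ θ * σ
      strictly : All Single bs ⊎ Φ bs < θ * σ
  open NextFit public

  NextFit-initial : NextFit [] 0ℚ
  NextFit-initial = nextfit [] (ℚP.≤-reflexive (sym (ℚP.*-zeroʳ θ))) (inj₁ [])

  -- If the item fits, its charge at rate `θ` covers the refund at rate `ρ`; if it overflows,
  -- `Charges` is exactly the strict inequality between the two potentials.
  nextFit-φ : ∀ (it : Item k) → 0ℚ ≤ size it → Charges θ ρ it → ∀ b → 0ℚ ≤ pload b → 0ℚ ≤ pload (nextFit it b) ×
    (nreal (nextFit it b) ≡ nreal b × φ (nextFit it b) ≤ φ b + θ * size it ⊎ φ (nextFit it b) < φ b + θ * size it)
  nextFit-φ it@(s , c) 0≤s charges b@(pbin t l n) 0≤l =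
    [ (λ (e , _) → subst Goal (sym e) stays) , (λ (e , over) → subst Goal (sym e) (opens over)) ]′ (nextFit-cases s c b)
    where
    Goal = λ b′ → 0ℚ ≤ pload b′ × (nreal b′ ≡ n × φ b′ ≤ φ b + θ * s ⊎ φ b′ < φ b + θ * s)
    stays : Goal (pbin c (l + s) n)
    stays = (0≤l ⊞ 0≤s) , inj₁ (refl , linℚ (mulʳ-≤ 0≤s ρ≤θ) (eq (toℚ n) ρ θ l s))
      where
      eq : ∀ n ρ θ l s → n + ρ * (l + s) - 1ℚ + θ * s ≡ n + ρ * l - 1ℚ + θ * s + ρ * s
      eq = solve-∀ ℚ-ring
    opens : 1ℚ < l + s → Goal (pbin c s (suc n))
    opens over = 0≤s , inj₂ (subst (λ x → x + ρ * s - 1ℚ < toℚ n + ρ * l - 1ℚ + θ * s) (sym (toℚ-+ 1 n))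
      (lin<ℚ (charges l over) (eq (toℚ n) (ρ * s) (ρ * l) (θ * s))))
      where
      eq : ∀ n a b c → 1ℚ + n + a - 1ℚ + (b + c) ≡ n + b - 1ℚ + c + (1ℚ + a)
      eq = solve-∀ ℚ-ring

  place-NextFit : ∀ {bs σ} ch (it : Item k) → 0ℚ ≤ size it → Charges θ ρ it → NextFit bs σ → NextFit (place bs ch it) (σ + size it)
  place-NextFit {bs} {σ} new (s , c) 0≤s _ (nextfit ls ch st) =
    nextfit (AllP.++⁺ ls (0≤s ∷ [])) (bound ch) ([ (λ a → inj₁ (AllP.++⁺ a (refl ∷ []))) , inj₂ ∘ bound< ]′ st)
    where
    Φ≡ : Φ (bs ++ [ pbin c s 1 ]) ≡ Φ bs + (1ℚ + ρ * s - 1ℚ)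
    Φ≡ = Φ-snoc bs (pbin c s 1)
    eq : ∀ p θ ρ σ s → p + (1ℚ + ρ * s - 1ℚ) + (θ * σ + θ * s) ≡ θ * (σ + s) + (p + ρ * s)
    eq = solve-∀ ℚ-ring
    bound : Φ bs ≤ θ * σ → Φ (bs ++ [ pbin c s 1 ]) ≤ θ * (σ + s)
    bound p = subst (_≤ θ * (σ + s)) (sym Φ≡) (linℚ (p ⊞ mulʳ-≤ 0≤s ρ≤θ) (eq (Φ bs) θ ρ σ s))
    bound< : Φ bs < θ * σ → Φ (bs ++ [ pbin c s 1 ]) < θ * (σ + s)
    bound< p = subst (_< θ * (σ + s)) (sym Φ≡) (lin<ℚ (ℚP.+-mono-<-≤ p (mulʳ-≤ 0≤s ρ≤θ)) (eq (Φ bs) θ ρ σ s))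
  place-NextFit {bs} {σ} (old j) it 0≤s charges (nextfit ls ch st) =
    nextfit (All-updateAt ls j (λ _ → proj₁ change)) (charged′ (proj₂ change)) (strictly′ (proj₂ change) st)
    where
    s  = size it
    b  = List.lookup bs j
    b′ = nextFit it b
    change = nextFit-φ it 0≤s charges b (All-lookup ls j)
    Φ′ = Φ (updateAt bs j (nextFit it))
    eq : ∀ P p f f′ θ σ s → P + f ≡ p + f′ → P + (f + θ * s + θ * σ) ≡ θ * (σ + s) + (f′ + p)
    eq P p f f′ θ σ s e = trans (eq₁ P f θ σ s) (trans (cong (λ x → x + θ * s + θ * σ) e) (eq₂ p f′ θ σ s))
      where
      eq₁ : ∀ P f θ σ s → P + (f + θ * s + θ * σ) ≡ P + f + θ * s + θ * σ
      eq₁ = solve-∀ ℚ-ring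
      eq₂ : ∀ p f′ θ σ s → p + f′ + θ * s + θ * σ ≡ θ * (σ + s) + (f′ + p)
      eq₂ = solve-∀ ℚ-ring
    balance : Φ′ + (φ b + θ * s + θ * σ) ≡ θ * (σ + s) + (φ b′ + Φ bs)
    balance = eq Φ′ (Φ bs) (φ b) (φ b′) θ σ s (Φ-updateAt bs j (nextFit it))
    Change = nreal b′ ≡ nreal b × φ b′ ≤ φ b + θ * s ⊎ φ b′ < φ b + θ * s
    weaken : Change → φ b′ ≤ φ b + θ * s
    weaken = [ proj₂ , ℚP.<⇒≤ ]′
    charged′ : Change → Φ′ ≤ θ * (σ + s)
    charged′ c = linℚ (weaken c ⊞ ch) balance
    strictly′ : Change → All Single bs ⊎ Φ bs < θ * σ → All Single (updateAt bs j (nextFit it)) ⊎ Φ′ < θ * (σ + s)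
    strictly′ (inj₁ (same , _)) (inj₁ a) = inj₁ (All-updateAt a j (trans same))
    strictly′ (inj₂ lt)         (inj₁ _) = inj₂ (lin<ℚ (ℚP.+-mono-<-≤ lt ch) balance)
    strictly′ c                 (inj₂ p) = inj₂ (lin<ℚ (ℚP.+-mono-≤-< (weaken c) p) balance)

  run-invariants : ∀ {h bs L n σ} → All (λ it → 0ℚ ≤ size it × Charges θ ρ it) L → Invariant h bs → NextFit bs σ → Run h bs L n →
    ∃[ bs′ ] (Invariant (h ++ map colour L) bs′ × NextFit bs′ (σ + volume L) × n ≡ cost bs′)
  run-invariants {h} {bs} {σ = σ} [] inv nf finish =
    bs , subst (λ l → Invariant l bs) (sym (ListP.++-identityʳ h)) inv , subst (NextFit bs) (sym (ℚP.+-identityʳ σ)) nf , refl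
  run-invariants {h} {σ = σ} ((0≤s , charges) ∷ good) inv nf (step {s = s} {c = c} {L = L} ch allowed run)
    with run-invariants good (place-allowed inv c s allowed) (place-NextFit ch (s , c) 0≤s charges nf) run
  ... | bs′ , inv′ , nf′ , e = bs′ , subst (λ l → Invariant l bs′) (ListP.++-assoc h [ c ] (map colour L)) inv′ ,
        subst (NextFit bs′) (ℚP.+-assoc σ s (volume L)) nf′ , e

  PseudoBAF-bound : ∀ {L : List (Item k)} {m n} → All (λ it → 0ℚ ≤ size it × Charges θ ρ it) L → Packable L m → PseudoBAF L n →
    ∃[ T ] (T ℕ.+ T ℕ.≤ m ℕ.+ m ℕ.+ m ℕ.+ 1 × (n ≡ T ⊎ toℚ n < toℚ T + θ * toℚ m))
  PseudoBAF-bound {L} {m} good pk run = conclude (run-invariants good initial NextFit-initial run)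
    where
    h = map colour L
    d≤m : d h ℕ.≤ m
    d≤m = ℤP.drop‿+≤+ (subst (ℤ._≤ + m) (sym (+d h)) (Dval≤bins pk))
    ∑ℚ-zero : ∀ m → ∑ℚ {m} (λ _ → 0ℚ) ≡ 0ℚ
    ∑ℚ-zero zero    = refl
    ∑ℚ-zero (suc m) = trans (ℚP.+-identityˡ _) (∑ℚ-zero m)
    volume≤m : 0ℚ + volume L ≤ toℚ m
    volume≤m = subst (λ z → z + volume L ≤ toℚ m) (∑ℚ-zero m) (volume-bound pk (λ _ → ℚP.<⇒≤ (ℚP.positive⁻¹ 1ℚ)))
    θσ≤θm : θ * (0ℚ + volume L) ≤ θ * toℚ m
    θσ≤θm = ℚP.*-monoˡ-≤-nonNeg θ {{ℚ.nonNegative (ℚP.≤-trans 0≤ρ ρ≤θ)}} volume≤m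
    conclude : ∃[ bs ] (Invariant h bs × NextFit bs (0ℚ + volume L) × _ ≡ cost bs) → _
    conclude (bs , inv , nf , refl) = length bs , bound , result (strictly nf)
      where
      bound : length bs ℕ.+ length bs ℕ.≤ m ℕ.+ m ℕ.+ m ℕ.+ 1
      -- `2T ≤ 2D + 2⌈D/2⌉ ≤ 3D + 1 ≤ 3m + 1`.
      bound = lin 0 (total inv ⊕ total inv ⊕ hd+hd≤d+1 h ⊕ d≤m ⊕ d≤m ⊕ d≤m) (eq (length bs) (d h) (hd h) m)
        where
        eq : ∀ t d h m → t ℕ.+ t ℕ.+ (d ℕ.+ h ℕ.+ (d ℕ.+ h) ℕ.+ (d ℕ.+ 1) ℕ.+ m ℕ.+ m ℕ.+ m) ℕ.+ 0 ≡ m ℕ.+ m ℕ.+ m ℕ.+ 1 ℕ.+ (t ℕ.+ t ℕ.+ (h ℕ.+ h) ℕ.+ d ℕ.+ d ℕ.+ d)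
        eq = ℕS.solve-∀
      result : All Single bs ⊎ Φ bs < θ * (0ℚ + volume L) → cost bs ≡ length bs ⊎ toℚ (cost bs) < toℚ (length bs) + θ * toℚ m
      result (inj₁ a) = inj₁ (cost-single a)
      result (inj₂ p) = inj₂ (lin<ℚ (ℚP.+-mono-≤-< (cost≤Φ (loads nf)) (ℚP.<-≤-trans p θσ≤θm)) (eq (toℚ (cost bs)) (Φ bs) (toℚ (length bs)) (θ * toℚ m)))
        where
        eq : ∀ c p t x → c + (p + t + x) ≡ t + x + (c + p)
        eq = solve-∀ ℚ-ring

-- Upper bounds

halve : ∀ {p q} → p + p ≤ q + q → p ≤ q
halve p+p≤q+q = ℚP.≮⇒≥ λ q<p → ℚP.<-irrefl refl (ℚP.<-≤-trans (ℚP.+-mono-< q<p q<p) p+p≤q+q)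

upper-bound-7/2 : ∀ k (L : List (Item k)) → ValidSizes L → ∀ opt n → IsOPT L opt → PseudoBAF L n → toℚ n ≤ ((+ 7) // 2) * toℚ opt
upper-bound-7/2 k L valid m n (pk , _) run = conclude (PseudoBAF-bound (All.map (λ {it} v → proj₁ v , charges it) valid) pk run)
  where
  -- With `θ = 2` and `ρ = 1` the charging condition reads `1 < l + s`: an overflowing item and the
  -- bin it does not fit into exceed 1 together.
  open NextFitPotential {k} (1ℚ + 1ℚ) 1ℚ (toℚ-nonneg 1) (toℚ-mono {1} {2} (s≤s z≤n))
  charges : ∀ (it : Item k) → Charges (1ℚ + 1ℚ) 1ℚ it
  charges (s , _) l 1<l+s = lin<ℚ 1<l+s (eq l s)
    where
    eq : ∀ l s → 1ℚ + 1ℚ * s + (l + s) ≡ 1ℚ * l + (1ℚ + 1ℚ) * s + 1ℚ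
    eq = solve-∀ ℚ-ring
  x = toℚ m
  eq : ∀ x → x + (x + (x + (x + (x + (x + x))))) ≡ ((+ 7) // 2) * x + ((+ 7) // 2) * x
  eq = solve-∀ ℚ-ring
  seven : toℚ (m ℕ.+ (m ℕ.+ (m ℕ.+ (m ℕ.+ (m ℕ.+ (m ℕ.+ m)))))) ≡ ((+ 7) // 2) * x + ((+ 7) // 2) * x
  seven = trans (add (add (add (add (add (toℚ-+ m m)))))) (eq x)
    where
    add : ∀ {b y} → toℚ b ≡ y → toℚ (m ℕ.+ b) ≡ toℚ m + y
    add {b} e = trans (toℚ-+ m b) (cong (_+_ (toℚ m)) e)
  -- Without overflow the rounding unit is harmless for `m ≥ 1`; for `m = 0` parity forces `T = 0`.
  small : ∀ m T → T ℕ.+ T ℕ.≤ m ℕ.+ m ℕ.+ m ℕ.+ 1 → T ℕ.+ T ℕ.≤ m ℕ.+ (m ℕ.+ (m ℕ.+ (m ℕ.+ (m ℕ.+ (m ℕ.+ m)))))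
  small m       zero    _ = z≤n
  small zero    (suc T) (s≤s p) = contradiction (ℕP.≤-trans (ℕP.≤-reflexive (sym (ℕP.+-suc T T))) p) λ ()
  small (suc m) (suc T) p = lin (4 ℕ.* m ℕ.+ 3) p (eq′ m (suc T))
    where
    eq′ : ∀ m t → t ℕ.+ t ℕ.+ (suc m ℕ.+ suc m ℕ.+ suc m ℕ.+ 1) ℕ.+ (4 ℕ.* m ℕ.+ 3)
         ≡ suc m ℕ.+ (suc m ℕ.+ (suc m ℕ.+ (suc m ℕ.+ (suc m ℕ.+ (suc m ℕ.+ suc m))))) ℕ.+ (t ℕ.+ t)
    eq′ = ℕS.solve-∀
  doubled : ∀ {T} → T ℕ.+ T ℕ.≤ m ℕ.+ m ℕ.+ m ℕ.+ 1 → n ≡ T ⊎ toℚ n < toℚ T + (1ℚ + 1ℚ) * toℚ m → n ℕ.+ n ℕ.≤ m ℕ.+ (m ℕ.+ (m ℕ.+ (m ℕ.+ (m ℕ.+ (m ℕ.+ m)))))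
  doubled bound (inj₁ refl) = small m n bound
  -- Now `n ≤ T + 2m - 1`, so doubling gains 2 against the rounding loss of 1.
  doubled {T} bound (inj₂ p) = lin 1 (n< ⊕ n< ⊕ bound) (eq′ n T m)
    where
    double : ∀ x y → x + (1ℚ + 1ℚ) * y ≡ x + y + y
    double = solve-∀ ℚ-ring
    n< : n ℕ.< T ℕ.+ m ℕ.+ m
    n< = toℚ-cancel-< (subst (toℚ n <_) (trans (double (toℚ T) (toℚ m)) (sym (trans (toℚ-+ (T ℕ.+ m) m) (cong (_+ toℚ m) (toℚ-+ T m))))) p)
    eq′ : ∀ n t m → n ℕ.+ n ℕ.+ (t ℕ.+ m ℕ.+ m ℕ.+ (t ℕ.+ m ℕ.+ m) ℕ.+ (m ℕ.+ m ℕ.+ m ℕ.+ 1)) ℕ.+ 1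
      ≡ m ℕ.+ (m ℕ.+ (m ℕ.+ (m ℕ.+ (m ℕ.+ (m ℕ.+ m))))) ℕ.+ (suc n ℕ.+ suc n ℕ.+ (t ℕ.+ t))
    eq′ = ℕS.solve-∀
  conclude : ∃[ T ] (T ℕ.+ T ℕ.≤ m ℕ.+ m ℕ.+ m ℕ.+ 1 × (n ≡ T ⊎ toℚ n < toℚ T + (1ℚ + 1ℚ) * toℚ m)) → toℚ n ≤ ((+ 7) // 2) * toℚ m
  conclude (T , bound , alt) = halve (subst₂ _≤_ (toℚ-+ n n) seven (toℚ-mono (doubled {T} bound alt)))

module SizeBound (d : ℚ) (2≤d : ((+ 2) // 1) ≤ d) where
  u θ e : ℚ
  u = 1ℚ /q d
  e = d - 1ℚ
  θ = d /q e

  1≤e : 1ℚ ≤ e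
  1≤e = linℚ 2≤d (eq d)
    where
    eq : ∀ d → 1ℚ + d ≡ d - 1ℚ + ((+ 2) // 1)
    eq = solve-∀ ℚ-ring

  0<1 : 0ℚ < 1ℚ
  0<1 = ℚP.positive⁻¹ 1ℚ

  0<e : 0ℚ < e
  0<e = ℚP.<-≤-trans 0<1 1≤e

  0<d : 0ℚ < d
  0<d = ℚP.<-≤-trans (ℚP.positive⁻¹ ((+ 2) // 1)) 2≤d

  u*d : u * d ≡ 1ℚ
  u*d = /q-* 1ℚ 0<d

  θ*e : θ * e ≡ d
  θ*e = /q-* d 0<e

  0<θ : 0ℚ < θ
  0<θ = ℚP.≰⇒> λ θ≤0 → ℚP.<-irrefl refl (ℚP.<-≤-trans 0<d
    (subst₂ _≤_ θ*e (ℚP.*-zeroˡ e) (mulʳ-≤ (ℚP.<⇒≤ 0<e) θ≤0)))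

  -- A real bin closed by an item of size at most `1/d` holds more than `1 - 1/d`; the price `θ` is
  -- the reciprocal of that amount.
  θ*[1-u] : (1ℚ - u) * θ ≡ 1ℚ
  θ*[1-u] = cancelʳ-≡ 0<d (trans (eq u θ d) (trans (cong (λ x → θ * (d - x)) u*d) (trans θ*e (sym (ℚP.*-identityˡ d)))))
    where
    eq : ∀ u θ d → (1ℚ - u) * θ * d ≡ θ * (d - u * d)
    eq = solve-∀ ℚ-ring

upper-bound-d : ∀ k (L : List (Item k)) d → ((+ 2) // 1) ≤ d → ValidSizes L → All (λ it → size it ≤ (1ℚ /q d)) L →
  ∀ opt n → IsOPT L opt → PseudoBAF L n → + n ≤ℤ ceiling ((((+ 3) // 2) + (d /q (d - 1ℚ))) * toℚ opt)
upper-bound-d k L d 2≤d valid small m n (pk , _) run =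
  conclude (PseudoBAF-bound (All.zipWith (λ {it} (v , w) → proj₁ v , charges it w) (valid , small)) pk run)
  where
  open SizeBound d 2≤d
  -- When refund and price agree, the incoming size cancels from `Charges` and the closed bin alone
  -- has to pay for the new one.
  open NextFitPotential {k} θ θ (ℚP.<⇒≤ 0<θ) ℚP.≤-refl
  charges : ∀ (it : Item k) → size it ≤ u → Charges θ θ it
  charges (s , _) s≤u l 1<l+s = subst (λ x → x + θ * s < θ * l + θ * s) θ*[1-u]
    (ℚP.+-monoˡ-< (θ * s) (subst ((1ℚ - u) * θ <_) (ℚP.*-comm l θ) (mulʳ-< {1ℚ - u} {l} 0<θ (lin<ℚ (ℚP.+-mono-<-≤ 1<l+s s≤u) (eq l s u)))))
    where
    eq : ∀ l s u → 1ℚ - u + (l + s + u) ≡ l + (1ℚ + s)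
    eq = solve-∀ ℚ-ring
  x = toℚ m
  y = (((+ 3) // 2) + θ) * x
  c = ceiling y
  cast : ι (c ℤ.+ c ℤ.+ + 1) ≡ ι c + ι c + 1ℚ
  cast = trans (ι-+ (c ℤ.+ c) (+ 1)) (cong (_+ 1ℚ) (ι-+ c c))
  rational : ∀ {T} → T ℕ.+ T ℕ.≤ m ℕ.+ m ℕ.+ m ℕ.+ 1 → toℚ T + toℚ T ≤ x + x + x + 1ℚ
  rational {T} bound = subst₂ _≤_ (toℚ-+ T T) (trans (toℚ-+ (m ℕ.+ m ℕ.+ m) 1) (cong (_+ 1ℚ) (trans (toℚ-+ (m ℕ.+ m) m) (cong (_+ x) (toℚ-+ m m))))) (toℚ-mono bound)
  y≤c = ceiling-upper y
  doubled : ∀ {T} → toℚ T + toℚ T ≤ x + x + x + 1ℚ → n ≡ T ⊎ toℚ n < toℚ T + θ * x → toℚ n + toℚ n ≤ ι c + ι c + 1ℚ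
  doubled boundℚ (inj₁ refl) = linℚ (boundℚ ⊞ θx ⊞ θx ⊞ y≤c ⊞ y≤c) (eq (toℚ n) x θ (ι c))
    where
    θx = mul-nonneg (ℚP.<⇒≤ 0<θ) (toℚ-nonneg m)
    eq : ∀ t x θ c → t + t + (x + x + x + 1ℚ + θ * x + θ * x + c + c) ≡ c + c + 1ℚ + (t + t + 0ℚ + 0ℚ + (((+ 3) // 2) + θ) * x + (((+ 3) // 2) + θ) * x)
    eq = solve-∀ ℚ-ring
  doubled {T} boundℚ (inj₂ p) = linℚ (boundℚ ⊞ ℚP.<⇒≤ p ⊞ ℚP.<⇒≤ p ⊞ y≤c ⊞ y≤c) (eq (toℚ n) (toℚ T) x θ (ι c))
    where
    eq : ∀ n t x θ c → n + n + (x + x + x + 1ℚ + (t + θ * x) + (t + θ * x) + c + c) ≡ c + c + 1ℚ + (t + t + n + n + (((+ 3) // 2) + θ) * x + (((+ 3) // 2) + θ) * x)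
    eq = solve-∀ ℚ-ring
  -- Between integers, `2n ≤ 2c + 1` loses its surplus unit.
  integral : + n ℤ.+ + n ℤ.≤ c ℤ.+ c ℤ.+ + 1 → + n ℤ.≤ c
  integral p = ℤP.≮⇒≥ λ c<n → absurd
    (linℤ (ℤP.+-mono-≤ (ℤP.+-mono-≤ (ℤP.i<j⇒suc[i]≤j c<n) (ℤP.i<j⇒suc[i]≤j c<n)) p) (eq (+ n) c))
    where
    absurd : ¬ (+ 1 ℤ.≤ + 0)
    absurd (ℤ.+≤+ ())
    eq : ∀ n c → + 1 ℤ.+ (n ℤ.+ n ℤ.+ (c ℤ.+ c ℤ.+ + 1)) ≡ + 0 ℤ.+ (+ 1 ℤ.+ c ℤ.+ (+ 1 ℤ.+ c) ℤ.+ (n ℤ.+ n))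
    eq = ℤS.solve-∀
  conclude : ∃[ T ] (T ℕ.+ T ℕ.≤ m ℕ.+ m ℕ.+ m ℕ.+ 1 × (n ≡ T ⊎ toℚ n < toℚ T + θ * x)) → + n ≤ℤ c
  conclude (T , bound , alt) = integral (ι-cancel-≤ (subst₂ _≤_ (sym (ι-+ (+ n) (+ n))) (sym cast) (doubled {T} (rational {T} bound) alt)))

-- Online runs with three colours

record Triple {k} (x y z : Fin k) : Set where
  constructor triple
  field
    x≢y   : x ≢ y
    y≢z   : y ≢ z
    x≢z   : x ≢ z
    cover : ∀ c → c ≡ x ⊎ c ≡ y ⊎ c ≡ z
open Triple

rotate : ∀ {k} {x y z : Fin k} → Triple x y z → Triple y z x
rotate (triple p q r c) = triple q (≢-sym r) (≢-sym p)
  ([ inj₂ ∘ inj₂ , [ inj₁ , inj₂ ∘ inj₁ ]′ ]′ ∘ c)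

reverse : ∀ {k} {x y z : Fin k} → Triple x y z → Triple z y x
reverse (triple p q r c) = triple (≢-sym q) (≢-sym p) (≢-sym r)
  ([ inj₂ ∘ inj₂ , [ inj₂ ∘ inj₁ , inj₁ ]′ ]′ ∘ c)

zeros : ∀ {k} → ℕ → Fin k → List (Item k)
zeros n c = replicate n (0ℚ , c)

zeros-+ : ∀ {k} m n (c : Fin k) L → zeros m c ++ zeros n c ++ L ≡ zeros (m ℕ.+ n) c ++ L
zeros-+ zero    n c L = refl
zeros-+ (suc m) n c L = cong ((0ℚ , c) ∷_) (zeros-+ m n c L)

alternate : ∀ {k} → ℕ → Fin k → Fin k → List (Item k)
alternate zero    b o = []
alternate (suc i) b o = (0ℚ , b) ∷ (0ℚ , o) ∷ alternate i b o

Fresh : ∀ {k} → PseudoBin k → Set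
Fresh b = pload b ≡ 0ℚ × nreal b ≡ 1

nextFit-zero : ∀ {k} (c : Fin k) {t l n} → l ≤ 1ℚ → nextFit (0ℚ , c) (pbin t l n) ≡ pbin c l n
nextFit-zero c {t} {l} {n} l≤1 =
  [ (λ (e , _) → trans e (cong (λ x → pbin c x n) (ℚP.+-identityʳ l)))
  , (λ (_ , over) → ⊥-elim (ℚP.<-irrefl refl (ℚP.<-≤-trans (subst (1ℚ <_) (ℚP.+-identityʳ l) over) l≤1))) ]′
  (nextFit-cases 0ℚ c (pbin t l n))

module _ {k : ℕ} where

  find-top : ∀ (bs : List (PseudoBin k)) {y} → 0 ℕ.< Ncount bs y → ∃[ j ] topAt bs j ≡ y
  find-top (b ∷ bs) {y} pos with ptop b Fin.≟ y
  ... | yes e = Fin.zero , e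
  ... | no  _ with find-top bs pos
  ...   | j , e = Fin.suc j , e

  all-top : ∀ (bs : List (PseudoBin k)) {y} → (∀ {x} → x ≢ y → Ncount bs x ≡ 0) → All (λ b → ptop b ≡ y) bs
  all-top []       none = []
  all-top (b ∷ bs) {y} none with ptop b Fin.≟ y
  ... | yes e = e ∷ all-top bs λ {x} x≢y → ℕP.m+n≡0⇒n≡0 (δ x (ptop b)) (trans (sym (Ncount-∷ b bs x)) (none x≢y))
  ... | no  b≢y with trans (sym (Ncount-∷ b bs (ptop b))) (none b≢y)
  ...   | e rewrite δ-same (ptop b) = contradiction e λ ()

  -- Runs are built in continuation form for all histories and bin lists; this record is everything
  -- that is remembered about them. The invariant is carried along because `⌈D/2⌉` is estimated from
  -- it.
  record Counts (x y z : Fin k) (p q r : ℕ) (h : List (Fin k)) (bs : List (PseudoBin k)) : Set where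
    constructor counts
    field
      inv   : Invariant h bs
      Nx    : Ncount bs x ≡ p
      Ny    : Ncount bs y ≡ q
      Nz    : Ncount bs z ≡ r
      fresh : All Fresh bs
  open Counts public

  Counts-rotate : ∀ {x y z p q r h bs} → Counts x y z p q r h bs → Counts y z x q r p h bs
  Counts-rotate (counts i a b c f) = counts i b c a f

  Counts-reverse : ∀ {x y z p q r h bs} → Counts x y z p q r h bs → Counts z y x r q p h bs
  Counts-reverse (counts i a b c f) = counts i c b a f

  recount : ∀ {x y z p q r p′ q′ r′ h bs} → p ≡ p′ → q ≡ q′ → r ≡ r′ → Counts x y z p q r h bs → Counts x y z p′ q′ r′ h bs
  recount refl refl refl s = s

  -- This avoids evaluating `D` on the instance: the upper bound of three times `⌈D/2⌉` on the
  -- number of bins, read backwards, bounds `⌈D/2⌉` from below.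
  hd-bound : ∀ {x y z p q r h bs i} → Triple x y z → Counts x y z p q r h bs → i ℕ.+ i ℕ.+ i ℕ.≤ p ℕ.+ q ℕ.+ r → i ℕ.≤ hd h
  hd-bound {h = h} {bs} {i} t (counts inv refl refl refl _) p =
    ℕP.≮⇒≥ λ h<i → ℕP.<-irrefl refl (lin {1} {0} 2 (h<i ⊕ h<i ⊕ h<i ⊕ p ⊕ Ncount-three (x≢y t) (y≢z t) (x≢z t) bs ⊕ total≤3hd inv)
      (eq i (hd h) (Ncount bs _) (Ncount bs _) (Ncount bs _) (length bs)))
    where
    eq : ∀ i h a b c l → 1 ℕ.+ (i ℕ.+ i ℕ.+ i ℕ.+ (a ℕ.+ b ℕ.+ c) ℕ.+ l ℕ.+ (h ℕ.+ h ℕ.+ h)) ℕ.+ 2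
      ≡ 0 ℕ.+ (suc h ℕ.+ suc h ℕ.+ suc h ℕ.+ (i ℕ.+ i ℕ.+ i) ℕ.+ (a ℕ.+ b ℕ.+ c) ℕ.+ l)
    eq = ℕS.solve-∀

  -- At most one colour can lie above ⌈D/2⌉ once two of the three counts are at most a third of the total.
  move : ∀ {x y z p q r} i → Triple x y z → r ℕ.≤ suc p → i ℕ.+ i ℕ.+ i ℕ.≤ suc p ℕ.+ q ℕ.+ r → r ℕ.≤ i → q ℕ.≤ i ⊎ suc p ℕ.≤ i →
         ∀ {L n} → (∀ {h bs} → Counts x y z p (suc q) r h bs → Run h bs L n) →
         ∀ {h bs} → Counts x y z (suc p) q r h bs → Run h bs ((0ℚ , y) ∷ L) n
  move {x} {y} {z} {p} {q} {r} i t r≤p 3i≤ r≤i low continue {h} {bs} st@(counts inv Nx Ny Nz fresh) =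
    step (old j) allowed (continue (counts (place-allowed inv y 0ℚ allowed) Nx′ Ny′ Nz′ fresh′))
    where
    H = hd h
    i≤H : i ℕ.≤ H
    i≤H = hd-bound t st 3i≤
    found = find-top bs (subst (0 ℕ.<_) (sym Nx) (s≤s z≤n))
    j = proj₁ found
    j-top : topAt bs j ≡ x
    j-top = proj₂ found
    ¬all : ¬ All (λ b → ptop b ≡ y) bs
    ¬all a = contradiction (trans (sym (Ncount-absent a (x≢y t))) Nx) λ ()
    z-low : ∀ {c} → c ≡ z → ¬ (H ℕ.< Ncount bs c)
    z-low refl H<N = ℕP.<⇒≱ H<N (ℕP.≤-trans (ℕP.≤-reflexive Nz) (ℕP.≤-trans r≤i i≤H))
    one : ∀ c₁ c₂ → H ℕ.< Ncount bs c₁ → H ℕ.< Ncount bs c₂ → c₁ ≡ c₂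
    one c₁ c₂ h₁ h₂ = [ (λ q≤i → trans (is-x q≤i (cover t c₁) h₁) (sym (is-x q≤i (cover t c₂) h₂)))
                      , (λ p<i → trans (is-y p<i (cover t c₁) h₁) (sym (is-y p<i (cover t c₂) h₂))) ]′ low
      where
      is-x : ∀ {c} → q ℕ.≤ i → c ≡ x ⊎ c ≡ y ⊎ c ≡ z → H ℕ.< Ncount bs c → c ≡ x
      is-x q≤i (inj₁ e)           _   = e
      is-x q≤i (inj₂ (inj₁ refl)) H<N = contradiction (ℕP.≤-trans (ℕP.≤-reflexive Ny) (ℕP.≤-trans q≤i i≤H)) (ℕP.<⇒≱ H<N)
      is-x q≤i (inj₂ (inj₂ e))    H<N = ⊥-elim (z-low e H<N)
      is-y : ∀ {c} → suc p ℕ.≤ i → c ≡ x ⊎ c ≡ y ⊎ c ≡ z → H ℕ.< Ncount bs c → c ≡ y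
      is-y p<i (inj₁ refl)     H<N = contradiction (ℕP.≤-trans (ℕP.≤-reflexive Nx) (ℕP.≤-trans p<i i≤H)) (ℕP.<⇒≱ H<N)
      is-y p<i (inj₂ (inj₁ e)) _   = e
      is-y p<i (inj₂ (inj₂ e)) H<N = ⊥-elim (z-low e H<N)
    maximal : ∀ c → c ≢ y → Ncount bs c ℕ.≤ Ncount bs (topAt bs j)
    maximal c c≢y = subst (λ u → Ncount bs c ℕ.≤ Ncount bs u) (sym j-top) (go (cover t c))
      where
      go : c ≡ x ⊎ c ≡ y ⊎ c ≡ z → Ncount bs c ℕ.≤ Ncount bs x
      go (inj₁ refl)        = ℕP.≤-refl
      go (inj₂ (inj₁ e))    = contradiction e c≢y
      go (inj₂ (inj₂ refl)) = subst₂ ℕ._≤_ (sym Nz) (sym Nx) r≤p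
    allowed : BAFAllowed h bs y (old j)
    allowed = rule2 j ¬all (λ c₁ c₂ h₁ h₂ → one c₁ c₂ (above⇒ inv y 0ℚ h₁) (above⇒ inv y 0ℚ h₂))
      (λ e → x≢y t (trans (sym j-top) e)) maximal
    bs′ = updateAt bs j (nextFit (0ℚ , y))
    update : ∀ c → Ncount bs′ c ℕ.+ δ c x ≡ Ncount bs c ℕ.+ δ c y
    update c = trans (cong (λ u → Ncount bs′ c ℕ.+ δ c u) (sym j-top)) (trans (Ncount-updateAt bs j (nextFit (0ℚ , y)) c)
      (cong (λ u → Ncount bs c ℕ.+ δ c u) (nextFit-top 0ℚ y (List.lookup bs j))))
    shift : ∀ c {a b n} → δ c x ≡ a → δ c y ≡ b → Ncount bs c ≡ n → Ncount bs′ c ℕ.+ a ≡ n ℕ.+ b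
    shift c refl refl refl = update c
    Nx′ : Ncount bs′ x ≡ p
    Nx′ = ℕP.+-cancelʳ-≡ 1 _ _ (trans (shift x (δ-same x) (δ-diff (≢-sym (x≢y t))) Nx) (eq p))
      where
      eq : ∀ p → suc p ℕ.+ 0 ≡ p ℕ.+ 1
      eq = ℕS.solve-∀
    Ny′ : Ncount bs′ y ≡ suc q
    Ny′ = trans (sym (ℕP.+-identityʳ _)) (trans (shift y (δ-diff (x≢y t)) (δ-same y) Ny) (ℕP.+-comm q 1))
    Nz′ : Ncount bs′ z ≡ r
    Nz′ = ℕP.+-cancelʳ-≡ 0 _ _ (shift z (δ-diff (x≢z t)) (δ-diff (y≢z t)) Nz)
    stays-fresh : ∀ b → Fresh b → Fresh (nextFit (0ℚ , y) b)
    stays-fresh (pbin u _ _) (refl , refl) = subst Fresh (sym (nextFit-zero y {u} (toℚ-nonneg 1))) (refl , refl)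
    fresh′ : All Fresh bs′
    fresh′ = All-updateAt fresh j (stays-fresh (List.lookup bs j))

  open-new : ∀ {x y z} q n → Triple x y z →
             ∀ {L m} → (∀ {h bs} → Counts x y z 0 (q ℕ.+ n) 0 h bs → Run h bs L m) →
             ∀ {h bs} → Counts x y z 0 q 0 h bs → Run h bs (zeros n y ++ L) m
  open-new q zero    t continue st = continue (recount refl (sym (ℕP.+-identityʳ q)) refl st)
  open-new {x} {y} {z} q (suc n) t continue {h} {bs} (counts inv Nx Ny Nz fresh) =
    step new (rule1 all) (open-new (suc q) n t (λ st → continue (recount refl (sym (ℕP.+-suc q n)) refl st))
      (counts (place-allowed inv y 0ℚ (rule1 all)) (snoc x Nx (δ-diff (≢-sym (x≢y t))))
        (trans (snoc y Ny (δ-same y)) (ℕP.+-comm q 1)) (snoc z Nz (δ-diff (y≢z t))) (AllP.++⁺ fresh ((refl , refl) ∷ []))))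
    where
    all : All (λ b → ptop b ≡ y) bs
    all = all-top bs λ {c} c≢y → [ (λ { refl → Nx }) , [ (λ e → contradiction e c≢y) , (λ { refl → Nz }) ]′ ]′ (cover t c)
    snoc : ∀ c {a b} → Ncount bs c ≡ a → δ c y ≡ b → Ncount (bs ++ [ pbin y 0ℚ 1 ]) c ≡ a ℕ.+ b
    snoc c refl refl = Ncount-snoc bs (pbin y 0ℚ 1) c

  -- The `w`-bins remain the largest class whenever an item arrives, so each `b` and each `o` takes
  -- one of them, while `b` and `o` never exceed a third of all bins.
  balance : ∀ {w b o} → Triple w b o → ∀ j e →
            ∀ {L n} → (∀ {h bs} → Counts w b o (j ℕ.+ e) (j ℕ.+ e) (j ℕ.+ e) h bs → Run h bs L n) →
            ∀ {h bs} → Counts w b o (j ℕ.+ (e ℕ.+ e ℕ.+ e)) j j h bs → Run h bs (alternate e b o ++ L) n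
  balance t j zero    continue st = continue (recount refl (sym (ℕP.+-identityʳ j)) (sym (ℕP.+-identityʳ j)) st)
  balance {w} {b} {o} t j (suc e) {L} {n} continue st =
    move (j ℕ.+ suc e) t (lin (3 ℕ.* e ℕ.+ 3) (z≤n {0}) (eq₁ j e)) (ℕP.≤-reflexive (eq₂ j e)) (ℕP.m≤m+n j (suc e)) (inj₁ (ℕP.m≤m+n j (suc e)))
      (λ st₁ → move (j ℕ.+ suc e) t′ (lin (3 ℕ.* e ℕ.+ 1) (z≤n {0}) (eq₃ j e)) (ℕP.≤-reflexive (eq₄ j e))
        (lin e (z≤n {0}) (eq₅ j e)) (inj₁ (ℕP.m≤m+n j (suc e)))
        (λ st₂ → balance t (suc j) e (λ st₃ → continue (recount (sym (ℕP.+-suc j e)) (sym (ℕP.+-suc j e)) (sym (ℕP.+-suc j e)) st₃))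
          (recount (eq₆ j e) refl refl (Counts-reverse (Counts-rotate st₂))))
        (Counts-reverse (Counts-rotate st₁)))
      (recount (eq₇ j e) refl refl st)
    where
    t′ : Triple w o b
    t′ = reverse (rotate t)
    eq₁ : ∀ j e → j ℕ.+ 0 ℕ.+ (3 ℕ.* e ℕ.+ 3) ≡ suc (suc (suc (j ℕ.+ (e ℕ.+ e ℕ.+ e)))) ℕ.+ 0
    eq₁ = ℕS.solve-∀
    eq₂ : ∀ j e → j ℕ.+ suc e ℕ.+ (j ℕ.+ suc e) ℕ.+ (j ℕ.+ suc e) ≡ suc (suc (suc (j ℕ.+ (e ℕ.+ e ℕ.+ e)))) ℕ.+ j ℕ.+ j
    eq₂ = ℕS.solve-∀
    eq₃ : ∀ j e → suc j ℕ.+ 0 ℕ.+ (3 ℕ.* e ℕ.+ 1) ≡ suc (suc (j ℕ.+ (e ℕ.+ e ℕ.+ e))) ℕ.+ 0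
    eq₃ = ℕS.solve-∀
    eq₄ : ∀ j e → j ℕ.+ suc e ℕ.+ (j ℕ.+ suc e) ℕ.+ (j ℕ.+ suc e) ≡ suc (suc (j ℕ.+ (e ℕ.+ e ℕ.+ e))) ℕ.+ j ℕ.+ suc j
    eq₄ = ℕS.solve-∀
    eq₅ : ∀ j e → suc j ℕ.+ 0 ℕ.+ e ≡ j ℕ.+ suc e ℕ.+ 0
    eq₅ = ℕS.solve-∀
    eq₆ : ∀ j e → suc (j ℕ.+ (e ℕ.+ e ℕ.+ e)) ≡ suc j ℕ.+ (e ℕ.+ e ℕ.+ e)
    eq₆ = ℕS.solve-∀
    eq₇ : ∀ j e → j ℕ.+ (suc e ℕ.+ suc e ℕ.+ suc e) ≡ suc (suc (suc (j ℕ.+ (e ℕ.+ e ℕ.+ e))))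
    eq₇ = ℕS.solve-∀

  -- Items of colour `b` take a `w`-bin and an `o`-bin in turn, ties going to `w`. Only `b` can rise
  -- above a third of all bins, which keeps rule 2 in force.
  absorb : ∀ {w b o} → Triple w b o → ∀ i e q → e ℕ.≤ i → i ℕ.+ i ℕ.+ i ≡ e ℕ.+ q ℕ.+ e →
           ∀ {L n} → (∀ {h bs} → Counts w b o 0 (i ℕ.+ i ℕ.+ i) 0 h bs → Run h bs L n) →
           ∀ {h bs} → Counts w b o e q e h bs → Run h bs (zeros (e ℕ.+ e) b ++ L) n
  absorb t i zero    q e≤i 3i≡ continue st = continue (recount refl (trans (sym (ℕP.+-identityʳ q)) (sym 3i≡)) refl st)
  absorb {w} {b} {o} t i (suc e) q e<i 3i≡ {L} {n} continue {h} {bs} st =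
    subst (λ m → Run h bs (zeros (suc m) b ++ L) n) (sym (ℕP.+-suc e e))
      (move i t ℕP.≤-refl (ℕP.≤-reflexive 3i≡) e<i (inj₂ e<i)
        (λ st₁ → move i (reverse t) (ℕP.n≤1+n e) (ℕP.≤-reflexive (trans 3i≡ (eq₁ e q))) (ℕP.≤-trans (ℕP.n≤1+n e) e<i) (inj₂ e<i)
          (λ st₂ → absorb t i e (suc (suc q)) (ℕP.≤-trans (ℕP.n≤1+n e) e<i) (trans 3i≡ (eq₂ e q)) continue (Counts-reverse st₂))
          (Counts-reverse st₁))
        st)
    where
    eq₁ : ∀ e q → suc e ℕ.+ q ℕ.+ suc e ≡ suc e ℕ.+ suc q ℕ.+ e
    eq₁ = ℕS.solve-∀
    eq₂ : ∀ e q → suc e ℕ.+ q ℕ.+ suc e ≡ e ℕ.+ suc (suc q) ℕ.+ e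
    eq₂ = ℕS.solve-∀

  -- The final state has the shape of the initial one with `i + 1` for `i` and the colours rotated,
  -- so phases can be chained.
  phase : ∀ {w b o} → Triple w b o → ∀ i →
          ∀ {L n} → (∀ {h bs} → Counts b o w (suc i ℕ.+ suc i ℕ.+ suc i) 0 0 h bs → Run h bs L n) →
          ∀ {h bs} → Counts w b o (i ℕ.+ i ℕ.+ i) 0 0 h bs → Run h bs (alternate i b o ++ zeros (i ℕ.+ i ℕ.+ 3) b ++ L) n
  phase {w} {b} {o} t i {L} {n} continue =
    balance t 0 i λ {h} {bs} st → subst (λ l → Run h bs l n) (zeros-+ (i ℕ.+ i) 3 b L)
      (absorb t i i i ℕP.≤-refl refl
        (open-new (i ℕ.+ i ℕ.+ i) 3 t (λ st′ → continue (recount (eq i) refl refl (Counts-rotate st′)))) st)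
    where
    eq : ∀ i → i ℕ.+ i ℕ.+ i ℕ.+ 3 ≡ suc i ℕ.+ suc i ℕ.+ suc i
    eq = ℕS.solve-∀

-- Offline packings of the tight instances

module _ {k m : ℕ} where

  Packs-drop : ∀ {st : BinsState k m} A {B} → Packs st (A ++ B) → ∃[ st′ ] Packs {k} {m} st′ B
  Packs-drop []      pk            = _ , pk
  Packs-drop (x ∷ A) (put _ _ _ pk) = Packs-drop A pk

  sumS-replicate : ∀ (c : Fin k) n → sumS c (replicate n c) ≡ + n
  sumS-replicate c zero    = refl
  sumS-replicate c (suc n) = cong₂ ℤ._+_ (sgn-same c) (sumS-replicate c n)

  run-length : ∀ {st : BinsState k m} n c L → Packs st (zeros n c ++ L) → n ℕ.≤ m
  run-length n c L pk = ℤP.drop‿+≤+ (subst (ℤ._≤ + m) (sumS-replicate c n)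
    (sumS-segment c pk [] (replicate n c) (map colour L)
      (trans (ListP.map-++ colour (zeros n c) L) (cong (_++ map colour L) (ListP.map-replicate colour n (0ℚ , c))))))

  Unloaded : BinsState k m → Set
  Unloaded st = ∀ j → load st j ≡ 0ℚ

  put-zero : ∀ {st : BinsState k m} {c L} j → Unloaded st → top st j ≢ just c →
             (Unloaded (putIn st j (0ℚ , c)) → Packs (putIn st j (0ℚ , c)) L) → Packs st ((0ℚ , c) ∷ L)
  put-zero {st} {c} j empty t≢ continue = put j (subst (_≤ 1ℚ) (sym (stays j)) (toℚ-nonneg 1)) t≢ (continue empty′)
    where
    stays : ∀ j′ → load st j′ + 0ℚ ≡ 0ℚ
    stays j′ = trans (ℚP.+-identityʳ _) (empty j′)
    empty′ : Unloaded (putIn st j (0ℚ , c))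
    empty′ j′ with j′ Fin.≟ j
    ... | yes _ = stays j′
    ... | no  _ = empty j′

  pack-alternate : ∀ {b o} → b ≢ o → ∀ j i {L} {st : BinsState k m} → Unloaded st → top st j ≢ just b →
    (∀ {st′} → Unloaded st′ → top st′ j ≢ just b → (∀ j′ → j′ ≢ j → top st′ j′ ≡ top st j′) → Packs st′ L) →
    Packs st (alternate i b o ++ L)
  pack-alternate b≢o j zero    empty t≢ continue = continue empty t≢ λ _ _ → refl
  pack-alternate {b} {o} b≢o j (suc i) {st = st} empty t≢ continue =
    put-zero j empty t≢ λ empty₁ → put-zero j empty₁ (λ e → b≢o (just-eq (trans (sym (sel-same j)) e))) λ empty₂ →
      pack-alternate b≢o j i empty₂ (λ e → b≢o (sym (just-eq (trans (sym (sel-same j)) e))))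
        λ empty₃ t₃ same → continue empty₃ t₃ λ j′ j′≢j → trans (same j′ j′≢j) (trans (sel-other j′≢j) (sel-other j′≢j))
    where
    just-eq : ∀ {x y : Fin k} → just x ≡ just y → x ≡ y
    just-eq refl = refl

  -- The items of the run go to consecutive bins; those with index below `r` are already served.
  pack-run : ∀ {b} n r {L} {st : BinsState k m} → Unloaded st → r ℕ.+ n ℕ.≤ m →
    (∀ j → toℕ j ℕ.< r → top st j ≡ just b) → (∀ j → r ℕ.≤ toℕ j → top st j ≢ just b) →
    (∀ {st′} → Unloaded st′ → (∀ j → toℕ j ℕ.< r ℕ.+ n → top st′ j ≡ just b) →
      (∀ j → r ℕ.+ n ℕ.≤ toℕ j → top st′ j ≡ top st j) → Packs st′ L) →
    Packs st (zeros n b ++ L)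
  pack-run zero r empty bound below above continue =
    continue empty (λ j lt → below j (subst (toℕ j ℕ.<_) (ℕP.+-identityʳ r) lt)) (λ _ _ → refl)
  pack-run {b} (suc n) r {st = st} empty bound below above continue =
    put-zero jr empty (above jr (ℕP.≤-reflexive (sym toℕ-jr))) λ empty′ →
      pack-run n (suc r) empty′ bound′ below′ above′ λ empty″ t≡ same →
        continue empty″ (λ j lt → t≡ j (subst (toℕ j ℕ.<_) (ℕP.+-suc r n) lt))
          (λ j le → trans (same j (subst (ℕ._≤ toℕ j) (ℕP.+-suc r n) le)) (sel-other (later j (ℕP.≤-trans (ℕP.m≤m+n (suc r) n) (subst (ℕ._≤ toℕ j) (ℕP.+-suc r n) le)))))
    where
    bound′ : suc r ℕ.+ n ℕ.≤ m
    bound′ = subst (ℕ._≤ m) (ℕP.+-suc r n) bound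
    r<m : r ℕ.< m
    r<m = ℕP.≤-trans (ℕP.m≤m+n (suc r) n) bound′
    jr = fromℕ< r<m
    toℕ-jr : toℕ jr ≡ r
    toℕ-jr = FinP.toℕ-fromℕ< r<m
    later : ∀ j → r ℕ.< toℕ j → j ≢ jr
    later j r<j refl = ℕP.<-irrefl (sym toℕ-jr) r<j
    below′ : ∀ j → toℕ j ℕ.< suc r → top (putIn st jr (0ℚ , b)) j ≡ just b
    below′ j lt with j Fin.≟ jr
    ... | yes _  = refl
    ... | no  j≢ = below j (ℕP.≤∧≢⇒< (ℕP.≤-pred lt) (λ e → j≢ (FinP.toℕ-injective (trans e (sym toℕ-jr)))))
    above′ : ∀ j → suc r ℕ.≤ toℕ j → top (putIn st jr (0ℚ , b)) j ≢ just b
    above′ j le e = above j (ℕP.<⇒≤ le) (trans (sym (sel-other (later j le))) e)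

  -- After a phase with index `i - 1` its run of length `2(i - 1) + 3 = 2i + 1` has touched exactly
  -- the bins below that index.
  record Ready (w : Fin k) (i : ℕ) (st : BinsState k m) : Set where
    constructor ready
    field
      unloaded : Unloaded st
      tops     : ∀ j → top st j ≡ nothing ⊎ top st j ≡ just w
      untouched : ∀ j → suc (i ℕ.+ i) ℕ.≤ toℕ j → top st j ≡ nothing

  top-≢ : ∀ {w b : Fin k} {t} → w ≢ b → t ≡ nothing ⊎ t ≡ just w → t ≢ just b
  top-≢ w≢b (inj₁ refl) ()
  top-≢ w≢b (inj₂ refl) refl = w≢b refl

  pack-phase : ∀ {w b o} → Triple w b o → ∀ i {L} → i ℕ.+ i ℕ.+ 3 ℕ.≤ m →
    (∀ {st} → Ready b (suc i) st → Packs st L) →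
    ∀ {st} → Ready w i st → Packs st (alternate i b o ++ zeros (i ℕ.+ i ℕ.+ 3) b ++ L)
  pack-phase {w} {b} {o} t i {L} bound continue {st} (ready empty tops untouched) =
    pack-alternate (y≢z t) first i empty (not-b first) λ {st₁} empty₁ t₁ same₁ →
      pack-run (i ℕ.+ i ℕ.+ 3) 0 empty₁ bound (λ _ ()) (λ j _ → not-b₁ {st₁} t₁ same₁ j) λ {st₂} empty₂ run₂ same₂ →
        continue (ready empty₂ (λ j → tops₂ {st₁} {st₂} same₁ run₂ same₂ j (ℕP.<-≤-connex (toℕ j) (i ℕ.+ i ℕ.+ 3)))
          (λ j le → rest₂ {st₁} {st₂} same₁ same₂ j (ℕP.≤-trans (ℕP.≤-reflexive (eq i)) le)))
    where
    0<m : 0 ℕ.< m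
    0<m = ℕP.≤-trans (s≤s z≤n) (ℕP.≤-trans (ℕP.m≤n+m 3 (i ℕ.+ i)) bound)
    first : Fin m
    first = fromℕ< 0<m
    eq : ∀ i → i ℕ.+ i ℕ.+ 3 ≡ suc (suc i ℕ.+ suc i)
    eq = ℕS.solve-∀
    not-b : ∀ j → top st j ≢ just b
    not-b j = top-≢ (x≢y t) (tops j)
    not-b₁ : ∀ {st₁ : BinsState k m} → top st₁ first ≢ just b → (∀ j → j ≢ first → top st₁ j ≡ top st j) → ∀ j → top st₁ j ≢ just b
    not-b₁ t₁ same₁ j e with j Fin.≟ first
    ... | yes refl = t₁ e
    ... | no  j≢   = not-b j (trans (sym (same₁ j j≢)) e)
    rest₂ : ∀ {st₁ st₂ : BinsState k m} → (∀ j → j ≢ first → top st₁ j ≡ top st j) →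
      (∀ j → i ℕ.+ i ℕ.+ 3 ℕ.≤ toℕ j → top st₂ j ≡ top st₁ j) → ∀ j → i ℕ.+ i ℕ.+ 3 ℕ.≤ toℕ j → top st₂ j ≡ nothing
    rest₂ same₁ same₂ j le = trans (same₂ j le) (trans (same₁ j not-first) (untouched j (ℕP.≤-trans (lin 2 (z≤n {0}) (eq′ i)) le)))
      where
      eq′ : ∀ i → suc (i ℕ.+ i) ℕ.+ 0 ℕ.+ 2 ≡ i ℕ.+ i ℕ.+ 3 ℕ.+ 0
      eq′ = ℕS.solve-∀
      not-first : j ≢ first
      not-first refl = contradiction (ℕP.≤-trans (ℕP.m≤n+m 3 (i ℕ.+ i)) (ℕP.≤-trans le (ℕP.≤-reflexive (FinP.toℕ-fromℕ< 0<m)))) λ ()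
    tops₂ : ∀ {st₁ st₂ : BinsState k m} → (∀ j → j ≢ first → top st₁ j ≡ top st j) →
      (∀ j → toℕ j ℕ.< i ℕ.+ i ℕ.+ 3 → top st₂ j ≡ just b) → (∀ j → i ℕ.+ i ℕ.+ 3 ℕ.≤ toℕ j → top st₂ j ≡ top st₁ j) →
      ∀ j → toℕ j ℕ.< i ℕ.+ i ℕ.+ 3 ⊎ i ℕ.+ i ℕ.+ 3 ℕ.≤ toℕ j → top st₂ j ≡ nothing ⊎ top st₂ j ≡ just b
    tops₂ same₁ run₂ same₂ j (inj₁ lt) = inj₂ (run₂ j lt)
    tops₂ {st₁} {st₂} same₁ run₂ same₂ j (inj₂ le) = inj₁ (rest₂ {st₁} {st₂} same₁ same₂ j le)

-- Multiplicities of bins in lists of slots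

module _ {m : ℕ} where

  occ : Fin m → List (Fin m) → ℕ
  occ j []       = 0
  occ j (x ∷ xs) = sel x j 1 0 ℕ.+ occ j xs

  occ-++ : ∀ j xs ys → occ j (xs ++ ys) ≡ occ j xs ℕ.+ occ j ys
  occ-++ j []       ys = refl
  occ-++ j (x ∷ xs) ys = trans (cong (sel x j 1 0 ℕ.+_) (occ-++ j xs ys)) (sym (ℕP.+-assoc (sel x j 1 0) _ _))

  occ-take-drop : ∀ j n xs → occ j (take n xs) ℕ.+ occ j (drop n xs) ≡ occ j xs
  occ-take-drop j n xs = trans (sym (occ-++ j (take n xs) (drop n xs))) (cong (occ j) (ListP.take++drop≡id n xs))

  occ-tabulate-absent : ∀ j {n} (f : Fin n → Fin m) → (∀ i → f i ≢ j) → occ j (List.tabulate f) ≡ 0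
  occ-tabulate-absent j {zero}  f absent = refl
  occ-tabulate-absent j {suc n} f absent =
    cong₂ ℕ._+_ (sel-other (≢-sym (absent Fin.zero))) (occ-tabulate-absent j (f ∘ Fin.suc) (absent ∘ Fin.suc))

  occ-tabulate : ∀ j {n} (f : Fin n → Fin m) → (∀ {i i′} → f i ≡ f i′ → i ≡ i′) → occ j (List.tabulate f) ℕ.≤ 1
  occ-tabulate j {zero}  f inj = z≤n
  occ-tabulate j {suc n} f inj with j Fin.≟ f Fin.zero
  ... | yes refl = ℕP.≤-reflexive (cong suc (occ-tabulate-absent j (f ∘ Fin.suc) λ i e → FinP.0≢1+n (sym (inj e))))
  ... | no  _    = occ-tabulate j (f ∘ Fin.suc) (FinP.suc-injective ∘ inj)

  copies : ℕ → List (Fin m) → List (Fin m)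
  copies zero    xs = []
  copies (suc n) xs = xs ++ copies n xs

  occ-copies : ∀ j n xs → occ j (copies n xs) ≡ n ℕ.* occ j xs
  occ-copies j zero    xs = refl
  occ-copies j (suc n) xs = trans (occ-++ j xs (copies n xs)) (cong (occ j xs ℕ.+_) (occ-copies j n xs))

  length-copies : ∀ n (xs : List (Fin m)) → length (copies n xs) ≡ n ℕ.* length xs
  length-copies zero    xs = refl
  length-copies (suc n) xs = trans (ListP.length-++ xs) (cong (length xs ℕ.+_) (length-copies n xs))

  -- Each pair stands for one sized item: the bin it goes to and its number of grains.
  used : Fin m → List (Fin m × ℕ) → ℕ
  used j []             = 0
  used j ((x , a) ∷ as) = sel x j a 0 ℕ.+ used j as

  used-++ : ∀ j as bs → used j (as ++ bs) ≡ used j as ℕ.+ used j bs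
  used-++ j []             bs = refl
  used-++ j ((x , a) ∷ as) bs = trans (cong (sel x j a 0 ℕ.+_) (used-++ j as bs)) (sym (ℕP.+-assoc (sel x j a 0) _ _))

  used-units : ∀ j xs → used j (map (_, 1) xs) ≡ occ j xs
  used-units j []       = refl
  used-units j (x ∷ xs) = cong (sel x j 1 0 ℕ.+_) (used-units j xs)

  sel-* : ∀ (x j : Fin m) a → sel x j a 0 ≡ a ℕ.* sel x j 1 0
  sel-* x j a with j Fin.≟ x
  ... | yes _ = sym (ℕP.*-identityʳ a)
  ... | no  _ = sym (ℕP.*-zeroʳ a)

-- The tight instances

-- All sizes are multiples a · g of a grain g, and cap grains but not cap + 1 fit into a bin. The sized
-- part consists of blocks of one big item (K grains) and Q + 1 grains; a block and the big item after it
-- exceed a bin by exactly one grain, so that Next Fit opens a bin for each block.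
module Gadget (K′ Q : ℕ) (g : ℚ) (0≤g : 0ℚ ≤ g) where

  K cap : ℕ
  K   = suc K′
  cap = Q ℕ.+ K ℕ.+ K

  sz : ℕ → ℚ
  sz a = toℚ a * g

  sz-+ : ∀ a b → sz a + sz b ≡ sz (a ℕ.+ b)
  sz-+ a b = trans (sym (ℚP.*-distribʳ-+ g (toℚ a) (toℚ b))) (cong (_* g) (sym (toℚ-+ a b)))

  sz-mono : ∀ {a b} → a ℕ.≤ b → sz a ≤ sz b
  sz-mono p = mulʳ-≤ 0≤g (toℚ-mono p)

  sz-nonneg : ∀ a → 0ℚ ≤ sz a
  sz-nonneg a = mul-nonneg (toℚ-nonneg a) 0≤g

  sz-zero : sz 0 ≡ 0ℚ
  sz-zero = ℚP.*-zeroˡ g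

  blocks : ℕ → List ℕ
  blocks zero    = []
  blocks (suc r) = K ∷ replicate (suc Q) 1 ++ blocks r

  sized : ∀ {k} → Fin k → Fin k → List ℕ → List (Item k)
  sized w b []       = []
  sized w b (a ∷ us) = (sz a , b) ∷ (0ℚ , w) ∷ sized w b us

  full : ∀ {k} → ℕ → ℕ → Fin k → Fin k → Fin k → List (Item k)
  full i zero    w b o = sized w b (blocks (cap ℕ.+ cap))
  full i (suc n) w b o = alternate i b o ++ zeros (i ℕ.+ i ℕ.+ 3) b ++ full (suc i) n b o w

  module _ {k : ℕ} {P : Item k → Set} (P-zero : ∀ c → P (0ℚ , c)) (P-one : ∀ c → P (sz 1 , c)) (P-big : ∀ c → P (sz K , c)) where

    All-alternate : ∀ i b o → All P (alternate i b o)
    All-alternate zero    b o = []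
    All-alternate (suc i) b o = P-zero b ∷ P-zero o ∷ All-alternate i b o

    All-blocks : ∀ r w b → All P (sized w b (blocks r))
    All-blocks zero    w b = []
    All-blocks (suc r) w b = P-big b ∷ P-zero w ∷ ones (suc Q)
      where
      ones : ∀ q → All P (sized w b (replicate q 1 ++ blocks r))
      ones zero    = All-blocks r w b
      ones (suc q) = P-one b ∷ P-zero w ∷ ones q

    All-full : ∀ i n w b o → All P (full i n w b o)
    All-full i zero    w b o = All-blocks (cap ℕ.+ cap) w b
    All-full i (suc n) w b o = AllP.++⁺ (All-alternate i b o)
      (AllP.++⁺ (AllP.replicate⁺ (i ℕ.+ i ℕ.+ 3) (P-zero b)) (All-full (suc i) n b o w))

  module _ (fits : sz cap ≤ 1ℚ) (over : 1ℚ < sz (suc cap)) where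

    sz≤1 : ∀ {a} → a ℕ.≤ cap → sz a ≤ 1ℚ
    sz≤1 p = ℚP.≤-trans (sz-mono p) fits

    module _ {k : ℕ} {w b : Fin k} (w≢b : w ≢ b) where

      nextFit-fits : ∀ a s n → a ℕ.+ s ℕ.≤ cap → nextFit (sz s , b) (pbin w (sz a) n) ≡ pbin b (sz (a ℕ.+ s)) n
      nextFit-fits a s n p =
        [ (λ (e , _) → trans e (cong (λ l → pbin b l n) (sz-+ a s)))
        , (λ (_ , q) → ⊥-elim (ℚP.<-irrefl refl (ℚP.<-≤-trans (subst (1ℚ <_) (sz-+ a s) q) (sz≤1 p)))) ]′
        (nextFit-cases (sz s) b (pbin w (sz a) n))

      nextFit-over : ∀ a s n → cap ℕ.< a ℕ.+ s → nextFit (sz s , b) (pbin w (sz a) n) ≡ pbin b (sz s) (suc n)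
      nextFit-over a s n p =
        [ (λ (_ , q) → ⊥-elim (ℚP.<-irrefl refl (ℚP.<-≤-trans over (ℚP.≤-trans (sz-mono p) (subst (_≤ 1ℚ) (sz-+ a s) q)))))
        , proj₁ ]′
        (nextFit-cases (sz s) b (pbin w (sz a) n))

      module _ {rest : List (PseudoBin k)} (all-w : All (λ x → ptop x ≡ w) rest) where

        -- Between a sized item and the zero-size item after it there is a single `b`-bin;
        -- `⌈D/2⌉ ≥ 1` keeps `b` from counting as large, so rule 2 still applies.
        hd-pos : ∀ {h x} → Invariant h (x ∷ rest) → 1 ℕ.≤ hd h
        hd-pos {h} inv = ℕP.≮⇒≥ λ lt → ℕP.<-irrefl refl
          (lin {1} {0} (length rest) (total≤3hd inv ⊕ ℕP.≤-pred lt ⊕ ℕP.≤-pred lt ⊕ ℕP.≤-pred lt) (eq (length rest) (hd h)))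
          where
          eq : ∀ l h → 1 ℕ.+ (h ℕ.+ h ℕ.+ h ℕ.+ 0 ℕ.+ 0 ℕ.+ 0) ℕ.+ l ≡ 0 ℕ.+ (suc l ℕ.+ h ℕ.+ h ℕ.+ h)
          eq = ℕS.solve-∀

        allow-b : ∀ {h l n} → Invariant h (pbin w l n ∷ rest) → BAFAllowed h (pbin w l n ∷ rest) b (old Fin.zero)
        -- All bins are tied at this moment; the tie is always broken in favour of the first one.
        allow-b {h} {l} {n} inv = rule2 Fin.zero (λ { (e ∷ _) → w≢b e })
          (λ c₁ c₂ h₁ h₂ → trans (only (above⇒ inv b 0ℚ h₁)) (sym (only (above⇒ inv b 0ℚ h₂)))) w≢b (λ c _ → maximal c)
          where
          bs = pbin w l n ∷ rest
          absent : ∀ {c} → c ≢ w → Ncount bs c ≡ 0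
          absent = Ncount-absent (refl ∷ all-w)
          only : ∀ {c} → hd h ℕ.< Ncount bs c → c ≡ w
          only {c} lt with c Fin.≟ w
          ... | yes e   = e
          ... | no  c≢w = contradiction (subst (hd h ℕ.<_) (absent c≢w) lt) λ ()
          maximal : ∀ c → Ncount bs c ℕ.≤ Ncount bs w
          maximal c with c Fin.≟ w
          ... | yes refl = ℕP.≤-refl
          ... | no  c≢w  = subst (ℕ._≤ Ncount bs w) (sym (absent c≢w)) z≤n

        -- The first bin is the only one not topped by `w`, so the zero-size item has to return to
        -- it.
        allow-w : ∀ {h l n} → Invariant h (pbin b l n ∷ rest) → BAFAllowed h (pbin b l n ∷ rest) w (old Fin.zero)
        allow-w {h} {l} {n} inv = rule2 Fin.zero (λ { (e ∷ _) → w≢b (sym e) })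
          (λ c₁ c₂ h₁ h₂ → trans (only (above⇒ inv w 0ℚ h₁)) (sym (only (above⇒ inv w 0ℚ h₂)))) (≢-sym w≢b) maximal
          where
          bs = pbin b l n ∷ rest
          count : ∀ {c} → c ≢ w → Ncount bs c ≡ δ c b
          count {c} c≢w = trans (Ncount-∷ (pbin b l n) rest c) (trans (cong (δ c b ℕ.+_) (Ncount-absent all-w c≢w)) (ℕP.+-identityʳ _))
          δ≤1 : ∀ c → δ c b ℕ.≤ 1
          δ≤1 c with b Fin.≟ c
          ... | yes _ = ℕP.≤-refl
          ... | no  _ = z≤n
          only : ∀ {c} → hd h ℕ.< Ncount bs c → c ≡ w
          only {c} lt with c Fin.≟ w
          ... | yes e   = e
          ... | no  c≢w = contradiction (subst (hd h ℕ.<_) (count c≢w) lt) (ℕP.≤⇒≯ (ℕP.≤-trans (δ≤1 c) (hd-pos inv)))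
          maximal : ∀ c → c ≢ w → Ncount bs c ℕ.≤ Ncount bs b
          maximal c c≢w = subst₂ ℕ._≤_ (sym (count c≢w)) (sym (trans (count (≢-sym w≢b)) (δ-same b))) (δ≤1 c)

        Continue : ℕ → ℕ → List (Item k) → ℕ → Set
        Continue a n L N = ∀ {h} → Invariant h (pbin w (sz a) n ∷ rest) → Run h (pbin w (sz a) n ∷ rest) L N

        serve : ∀ s a n a′ n′ {L N} → nextFit (sz s , b) (pbin w (sz a) n) ≡ pbin b (sz a′) n′ → a′ ℕ.≤ cap →
                Continue a′ n′ L N → Continue a n ((sz s , b) ∷ (0ℚ , w) ∷ L) N
        serve s a n a′ n′ {L} {N} e p continue {h} inv = step (old Fin.zero) (allow-b inv)
          (subst (λ x → Run (h ++ [ b ]) (x ∷ rest) ((0ℚ , w) ∷ L) N) (sym e)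
            (step (old Fin.zero) (allow-w inv₁) (subst (λ x → Run ((h ++ [ b ]) ++ [ w ]) (x ∷ rest) L N) (sym e′)
              (continue inv₂))))
          where
          e′ : nextFit (0ℚ , w) (pbin b (sz a′) n′) ≡ pbin w (sz a′) n′
          e′ = nextFit-zero w {b} (sz≤1 p)
          inv₁ : Invariant (h ++ [ b ]) (pbin b (sz a′) n′ ∷ rest)
          inv₁ = subst (λ x → Invariant (h ++ [ b ]) (x ∷ rest)) e (place-allowed inv b (sz s) (allow-b inv))
          inv₂ : Invariant ((h ++ [ b ]) ++ [ w ]) (pbin w (sz a′) n′ ∷ rest)
          inv₂ = subst (λ x → Invariant ((h ++ [ b ]) ++ [ w ]) (x ∷ rest)) e′ (place-allowed inv₁ w 0ℚ (allow-w inv₁))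

        serve-ones : ∀ q a n {us N} → a ℕ.+ q ℕ.≤ cap → Continue (a ℕ.+ q) n (sized w b us) N →
                     Continue a n (sized w b (replicate q 1 ++ us)) N
        serve-ones zero    a n {us} {N} p continue = subst (λ a → Continue a n (sized w b us) N) (ℕP.+-identityʳ a) continue
        serve-ones (suc q) a n {us} {N} p continue =
          serve 1 a n (a ℕ.+ 1) n (nextFit-fits a 1 n le) le
            (serve-ones q (a ℕ.+ 1) n (subst (ℕ._≤ cap) (eq a q) p) (subst (λ a → Continue a n (sized w b us) N) (eq a q) continue))
          where
          eq : ∀ a q → a ℕ.+ suc q ≡ a ℕ.+ 1 ℕ.+ q
          eq = ℕS.solve-∀
          le : a ℕ.+ 1 ℕ.≤ cap
          le = ℕP.≤-trans (ℕP.m≤m+n (a ℕ.+ 1) q) (subst (ℕ._≤ cap) (eq a q) p)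

        K+1+Q≤cap : K ℕ.+ suc Q ℕ.≤ cap
        K+1+Q≤cap = lin K′ (z≤n {0}) (eq K′ Q)
          where
          eq : ∀ k q → suc k ℕ.+ suc q ℕ.+ 0 ℕ.+ k ≡ q ℕ.+ suc k ℕ.+ suc k ℕ.+ 0
          eq = ℕS.solve-∀

        K≤cap : K ℕ.≤ cap
        K≤cap = ℕP.m≤n+m K (Q ℕ.+ K)

        serve-blocks : ∀ r n {N} → Continue (K ℕ.+ suc Q) (n ℕ.+ r) [] N → Continue (K ℕ.+ suc Q) n (sized w b (blocks r)) N
        serve-blocks zero    n {N} continue = subst (λ n → Continue (K ℕ.+ suc Q) n [] N) (ℕP.+-identityʳ n) continue
        serve-blocks (suc r) n {N} continue =
          serve K (K ℕ.+ suc Q) n K (suc n) (nextFit-over (K ℕ.+ suc Q) K n (ℕP.≤-reflexive (eq K Q))) K≤cap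
            (serve-ones (suc Q) K (suc n) K+1+Q≤cap
              (serve-blocks r (suc n) (subst (λ n → Continue (K ℕ.+ suc Q) n [] N) (ℕP.+-suc n r) continue)))
          where
          eq : ∀ k q → suc (q ℕ.+ k ℕ.+ k) ≡ k ℕ.+ suc q ℕ.+ k
          eq = ℕS.solve-∀

        serve-all : ∀ r {N} → Continue (K ℕ.+ suc Q) (suc r) [] N → Continue 0 1 (sized w b (blocks (suc r))) N
        serve-all r continue = serve K 0 1 K 1 (nextFit-fits 0 K 1 K≤cap) K≤cap
          (serve-ones (suc Q) K 1 K+1+Q≤cap (serve-blocks r 1 continue))

    -- Of the `3X` pseudo bins one ends with `2·cap` real bins and the others with one each, hence
    -- the `pred`.
    total-cost : ℕ → ℕ
    total-cost X = ℕ.pred (cap ℕ.+ cap ℕ.+ (X ℕ.+ X ℕ.+ X))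

    run-sized : ∀ {k} {w b o : Fin k} → Triple w b o → ∀ X {h bs} → Counts w b o (suc X ℕ.+ suc X ℕ.+ suc X) 0 0 h bs →
                Run h bs (sized w b (blocks (cap ℕ.+ cap))) (total-cost (suc X))
    run-sized {k} {w} {b} {o} t X {h} {bs} (counts inv Nw Nb No fresh) =
      go bs inv Nw (all-top bs λ {c} c≢w → [ (λ e → contradiction e c≢w) , [ (λ { refl → Nb }) , (λ { refl → No }) ]′ ]′ (cover t c)) fresh
      where
      cost-fresh : ∀ {bs : List (PseudoBin k)} → All Fresh bs → cost bs ≡ length bs
      cost-fresh = cost-single ∘ All.map proj₂
      go : ∀ bs → Invariant h bs → Ncount bs w ≡ suc X ℕ.+ suc X ℕ.+ suc X → All (λ x → ptop x ≡ w) bs → All Fresh bs →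
           Run h bs (sized w b (blocks (cap ℕ.+ cap))) (total-cost (suc X))
      go [] inv () all fresh
      go (pbin _ _ _ ∷ rest) inv Nw (refl ∷ all) ((refl , refl) ∷ fresh) =
        subst (λ r → Run h (pbin w 0ℚ 1 ∷ rest) (sized w b (blocks r)) (total-cost (suc X))) (sym r≡)
          (subst (λ l → Invariant h (pbin w l 1 ∷ rest) → Run h (pbin w l 1 ∷ rest) (sized w b (blocks (suc r))) (total-cost (suc X))) sz-zero
            (serve-all (x≢y t) all r (λ _ → finish′)) inv)
        where
        r = Q ℕ.+ K ℕ.+ K′ ℕ.+ cap
        r≡ : cap ℕ.+ cap ≡ suc r
        r≡ = eq Q K K′ cap
          where
          eq : ∀ q k k′ c → q ℕ.+ k ℕ.+ suc k′ ℕ.+ c ≡ suc (q ℕ.+ k ℕ.+ k′ ℕ.+ c)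
          eq = ℕS.solve-∀
        length≡ : suc (length rest) ≡ suc X ℕ.+ suc X ℕ.+ suc X
        length≡ = trans (sym (Ncount-all (refl ∷ all))) Nw
        cost≡ : suc r ℕ.+ cost rest ≡ total-cost (suc X)
        cost≡ = cong ℕ.pred (trans (sym (ℕP.+-suc (suc r) (cost rest)))
          (cong₂ ℕ._+_ (sym r≡) (trans (cong suc (cost-fresh fresh)) length≡)))
        finish′ : ∀ {h} → Run h (pbin w (sz (K ℕ.+ suc Q)) (suc r) ∷ rest) [] (total-cost (suc X))
        finish′ = subst (Run _ _ []) cost≡ finish

    run-full : ∀ {k} {w b o : Fin k} → Triple w b o → ∀ i n {h bs} → Counts w b o (i ℕ.+ i ℕ.+ i) 0 0 h bs →
               Run h bs (full i (suc n) w b o) (total-cost (suc (i ℕ.+ n)))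
    run-full {w = w} {b} {o} t i zero {h} {bs} st =
      subst (λ x → Run h bs (full i 1 w b o) (total-cost (suc x))) (sym (ℕP.+-identityʳ i)) (phase t i (run-sized (rotate t) i) st)
    run-full {w = w} {b} {o} t i (suc n) {h} {bs} st =
      subst (λ x → Run h bs (full i (suc (suc n)) w b o) (total-cost (suc x))) (sym (ℕP.+-suc i n)) (phase t i (run-full (rotate t) (suc i) n) st)

    -- The run of the last phase, which has index `i + n`, consists of that many items of equal
    -- colour.
    bins-needed : ∀ {k m} {w b o : Fin k} {st : BinsState k m} i n → Packs st (full i (suc n) w b o) → i ℕ.+ n ℕ.+ (i ℕ.+ n) ℕ.+ 3 ℕ.≤ m
    bins-needed {m = m} {b = b} {o} i zero pk with Packs-drop (alternate i b o) pk
    ... | _ , pk′ = subst (λ x → x ℕ.+ x ℕ.+ 3 ℕ.≤ m) (sym (ℕP.+-identityʳ i)) (run-length (i ℕ.+ i ℕ.+ 3) b _ pk′)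
    bins-needed {m = m} {b = b} {o} i (suc n) pk with Packs-drop (alternate i b o) pk
    ... | _ , pk′ with Packs-drop (zeros (i ℕ.+ i ℕ.+ 3) b) pk′
    ...   | _ , pk″ = subst (λ x → x ℕ.+ x ℕ.+ 3 ℕ.≤ m) (sym (ℕP.+-suc i n)) (bins-needed (suc i) n pk″)

    module _ {k m : ℕ} {w b : Fin k} (w≢b : w ≢ b) where

      -- Each sized item and the zero-size item after it share a bin, which restores its top to `w`;
      -- colours then never obstruct and only the grain counts matter.
      pack-sized : ∀ (as : List (Fin m × ℕ)) (ℓ : Fin m → ℕ) {st : BinsState k m} → (∀ j → load st j ≡ sz (ℓ j)) →
        (∀ j → top st j ≡ nothing ⊎ top st j ≡ just w) → (∀ j → ℓ j ℕ.+ used j as ℕ.≤ cap) → Packs st (sized w b (map proj₂ as))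
      pack-sized []             ℓ loads tops bound = done
      pack-sized ((x , a) ∷ as) ℓ {st} loads tops bound =
        put x (subst (_≤ 1ℚ) (sym (trans (cong (_+ sz a) (loads x)) (sz-+ (ℓ x) a))) (sz≤1 le)) (top-≢ {k} {m} w≢b (tops x))
          (put x (subst (_≤ 1ℚ) (sym (trans (ℚP.+-identityʳ _) (loads₁ x))) (sz≤1 {ℓ′ x} (ℕP.≤-trans (ℕP.m≤m+n _ _) (bound′ x))))
            (λ e → w≢b (sym (just-eq (trans (sym (sel-same x)) e))))
            (pack-sized as ℓ′ loads₂ tops₂ bound′))
        where
        just-eq : ∀ {x y : Fin k} → just x ≡ just y → x ≡ y
        just-eq refl = refl
        ℓ′ : Fin m → ℕ
        ℓ′ j = ℓ j ℕ.+ sel x j a 0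
        bound′ : ∀ j → ℓ′ j ℕ.+ used j as ℕ.≤ cap
        bound′ j = subst (ℕ._≤ cap) (sym (ℕP.+-assoc (ℓ j) _ _)) (bound j)
        le : ℓ x ℕ.+ a ℕ.≤ cap
        le = ℕP.≤-trans (ℕP.≤-reflexive (cong (ℓ x ℕ.+_) (sym (sel-same x)))) (ℕP.≤-trans (ℕP.m≤m+n (ℓ′ x) _) (bound′ x))
        st₁ = putIn st x (sz a , b)
        loads₁ : ∀ j → load st₁ j ≡ sz (ℓ′ j)
        loads₁ j with j Fin.≟ x
        ... | yes _ = trans (cong (_+ sz a) (loads j)) (sz-+ (ℓ j) a)
        ... | no  _ = trans (loads j) (cong sz (sym (ℕP.+-identityʳ (ℓ j))))
        loads₂ : ∀ j → load (putIn st₁ x (0ℚ , w)) j ≡ sz (ℓ′ j)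
        loads₂ j = trans (unchanged j) (loads₁ j)
          where
          unchanged : ∀ j → load (putIn st₁ x (0ℚ , w)) j ≡ load st₁ j
          unchanged j with j Fin.≟ x
          ... | yes _ = ℚP.+-identityʳ _
          ... | no  _ = refl
        tops₂ : ∀ j → top (putIn st₁ x (0ℚ , w)) j ≡ nothing ⊎ top (putIn st₁ x (0ℚ , w)) j ≡ just w
        tops₂ j with j Fin.≟ x
        ... | yes _ = inj₂ refl
        ... | no  _ = tops j

    module _ {m : ℕ} where

      -- The first list supplies bins for big items, the second for grains: each block draws one
      -- entry from the former and `Q + 1` from the latter.
      assign : List (Fin m) → List (Fin m) → List (Fin m × ℕ)
      assign []       gs = []
      assign (x ∷ xs) gs = (x , K) ∷ map (_, 1) (take (suc Q) gs) ++ assign xs (drop (suc Q) gs)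

      assign-sizes : ∀ xs gs → length xs ℕ.* suc Q ℕ.≤ length gs → map proj₂ (assign xs gs) ≡ blocks (length xs)
      assign-sizes []       gs p = refl
      assign-sizes (x ∷ xs) gs p = cong (K ∷_) (trans (ListP.map-++ proj₂ (map (_, 1) (take (suc Q) gs)) _)
        (cong₂ _++_ (units (suc Q) gs (ℕP.≤-trans (ℕP.m≤m+n (suc Q) _) p))
          (assign-sizes xs (drop (suc Q) gs) (subst (length xs ℕ.* suc Q ℕ.≤_) (sym (ListP.length-drop (suc Q) gs)) (ℕP.m+n≤o⇒m≤o∸n _ (subst (ℕ._≤ length gs) (ℕP.+-comm (suc Q) _) p))))))
        where
        units : ∀ q (gs : List (Fin m)) → q ℕ.≤ length gs → map proj₂ (map (_, 1) (take q gs)) ≡ replicate q 1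
        units zero    gs       p       = refl
        units (suc q) (_ ∷ gs) (s≤s p) = cong (1 ∷_) (units q gs p)

      used-assign : ∀ j xs gs → used j (assign xs gs) ℕ.≤ K ℕ.* occ j xs ℕ.+ occ j gs
      used-assign j []       gs = z≤n
      used-assign j (x ∷ xs) gs = lin 0
        (ℕP.≤-reflexive (trans (cong (sel x j K 0 ℕ.+_) (used-++ j (map (_, 1) (take (suc Q) gs)) (assign xs (drop (suc Q) gs))))
            (cong₂ (λ u v → u ℕ.+ (v ℕ.+ used j (assign xs (drop (suc Q) gs)))) (sel-* x j K) (used-units j (take (suc Q) gs))))
          ⊕ used-assign j xs (drop (suc Q) gs) ⊕ ℕP.≤-reflexive (occ-take-drop j (suc Q) gs))
        (eq (sel x j K 0 ℕ.+ used j (map (_, 1) (take (suc Q) gs) ++ assign xs (drop (suc Q) gs)))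
          K (sel x j 1 0) (occ j (take (suc Q) gs)) (used j (assign xs (drop (suc Q) gs))) (occ j xs) (occ j (drop (suc Q) gs)) (occ j gs))
        where
        eq : ∀ u k s t v x d g → u ℕ.+ (k ℕ.* s ℕ.+ (t ℕ.+ v) ℕ.+ (k ℕ.* x ℕ.+ d) ℕ.+ g) ℕ.+ 0 ≡ k ℕ.* (s ℕ.+ x) ℕ.+ g ℕ.+ (u ℕ.+ v ℕ.+ (t ℕ.+ d))
        eq = ℕS.solve-∀

    -- In the offline packing, cap bins hold two big items and Q grains each, and Q + 2 bins hold cap grains each.
    X m : ℕ
    X = Q ℕ.+ K′
    m = X ℕ.+ X ℕ.+ 5

    pairs-bins grain-bins big-slots grain-slots : List (Fin m)
    pairs-bins  = take cap (allFin m)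
    grain-bins  = take (Q ℕ.+ 2) (drop cap (allFin m))
    big-slots   = copies 2 pairs-bins
    grain-slots = copies Q pairs-bins ++ copies cap grain-bins

    -- One bin is left without sized items, since `m` is dictated by the length of the last colour
    -- run.
    m-split : cap ℕ.+ (Q ℕ.+ 2) ℕ.+ 1 ≡ m
    m-split = eq Q K′
      where
      eq : ∀ q k → q ℕ.+ suc k ℕ.+ suc k ℕ.+ (q ℕ.+ 2) ℕ.+ 1 ≡ q ℕ.+ k ℕ.+ (q ℕ.+ k) ℕ.+ 5
      eq = ℕS.solve-∀

    length-pairs-bins : length pairs-bins ≡ cap
    length-pairs-bins = trans (ListP.length-take cap (allFin m)) (ℕP.m≤n⇒m⊓n≡m
      (subst (cap ℕ.≤_) (sym (ListP.length-tabulate {n = m} id)) (subst (cap ℕ.≤_) m-split (ℕP.≤-trans (ℕP.m≤m+n cap _) (ℕP.m≤m+n _ 1)))))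

    length-grain-bins : length grain-bins ≡ Q ℕ.+ 2
    length-grain-bins = trans (ListP.length-take (Q ℕ.+ 2) (drop cap (allFin m))) (ℕP.m≤n⇒m⊓n≡m
      (subst (Q ℕ.+ 2 ℕ.≤_) (sym (trans (ListP.length-drop cap (allFin m)) (cong (ℕ._∸ cap) (ListP.length-tabulate {n = m} id))))
        (ℕP.m+n≤o⇒m≤o∸n _ (subst (ℕ._≤ m) (ℕP.+-comm cap (Q ℕ.+ 2)) (subst (cap ℕ.+ (Q ℕ.+ 2) ℕ.≤_) m-split (ℕP.m≤m+n _ 1))))))

    slot-loads : ∀ j → K ℕ.* occ j big-slots ℕ.+ occ j grain-slots ℕ.≤ cap
    slot-loads j = lin 0
      (ℕP.≤-reflexive (cong₂ (λ u v → K ℕ.* u ℕ.+ v) (occ-copies j 2 pairs-bins)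
          (trans (occ-++ j (copies Q pairs-bins) (copies cap grain-bins)) (cong₂ ℕ._+_ (occ-copies j Q pairs-bins) (occ-copies j cap grain-bins))))
        ⊕ scaled)
      (eq (K ℕ.* occ j big-slots ℕ.+ occ j grain-slots) Q K (occ j pairs-bins) (occ j grain-bins))
      where
      once : occ j pairs-bins ℕ.+ occ j grain-bins ℕ.≤ 1
      once = ℕP.≤-trans (ℕP.+-monoʳ-≤ (occ j pairs-bins)
          (ℕP.≤-trans (ℕP.m≤m+n (occ j grain-bins) _) (ℕP.≤-reflexive (occ-take-drop j (Q ℕ.+ 2) (drop cap (allFin m))))))
        (ℕP.≤-trans (ℕP.≤-reflexive (occ-take-drop j cap (allFin m))) (occ-tabulate j id id))
      scaled : cap ℕ.* (occ j pairs-bins ℕ.+ occ j grain-bins) ℕ.≤ cap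
      scaled = subst (cap ℕ.* (occ j pairs-bins ℕ.+ occ j grain-bins) ℕ.≤_) (ℕP.*-identityʳ cap) (ℕP.*-monoʳ-≤ cap once)
      eq : ∀ u q k a b → u ℕ.+ (k ℕ.* (2 ℕ.* a) ℕ.+ (q ℕ.* a ℕ.+ (q ℕ.+ k ℕ.+ k) ℕ.* b) ℕ.+ (q ℕ.+ k ℕ.+ k)) ℕ.+ 0
        ≡ q ℕ.+ k ℕ.+ k ℕ.+ (u ℕ.+ (q ℕ.+ k ℕ.+ k) ℕ.* (a ℕ.+ b))
      eq = ℕS.solve-∀

    pack-tail : ∀ {k} {w b : Fin k} i → w ≢ b → ∀ {st : BinsState k m} → Ready w i st → Packs st (sized w b (blocks (cap ℕ.+ cap)))
    pack-tail {w = w} {b} i w≢b {st} (ready empty tops _) = subst (Packs st) (cong (sized w b) sizes)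
      (pack-sized w≢b (assign big-slots grain-slots) (λ _ → 0) (λ j → trans (empty j) (sym sz-zero)) tops
        (λ j → ℕP.≤-trans (used-assign j big-slots grain-slots) (slot-loads j)))
      where
      length-big : length big-slots ≡ cap ℕ.+ cap
      length-big = trans (length-copies 2 pairs-bins) (trans (cong (2 ℕ.*_) length-pairs-bins) (cong (cap ℕ.+_) (ℕP.+-identityʳ cap)))
      length-grain : length grain-slots ≡ Q ℕ.* cap ℕ.+ cap ℕ.* (Q ℕ.+ 2)
      length-grain = trans (ListP.length-++ (copies Q pairs-bins)) (cong₂ ℕ._+_
        (trans (length-copies Q pairs-bins) (cong (Q ℕ.*_) length-pairs-bins)) (trans (length-copies cap grain-bins) (cong (cap ℕ.*_) length-grain-bins)))
      -- The grains of all `2·cap` blocks fill the grain slots exactly.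
      eq : ∀ c q → (c ℕ.+ c) ℕ.* suc q ≡ q ℕ.* c ℕ.+ c ℕ.* (q ℕ.+ 2)
      eq = ℕS.solve-∀
      enough : length big-slots ℕ.* suc Q ℕ.≤ length grain-slots
      enough = ℕP.≤-reflexive (trans (cong (ℕ._* suc Q) length-big) (trans (eq cap Q) (sym length-grain)))
      sizes : map proj₂ (assign big-slots grain-slots) ≡ blocks (cap ℕ.+ cap)
      sizes = trans (assign-sizes big-slots grain-slots enough) (cong blocks length-big)

    pack-full : ∀ {k} {w b o : Fin k} → Triple w b o → ∀ i n → i ℕ.+ n ≡ suc (suc X) → ∀ {st : BinsState k m} → Ready w i st → Packs st (full i n w b o)
    pack-full t i zero    e st = pack-tail i (x≢y t) st
    pack-full t i (suc n) e st = pack-phase t i bound (pack-full (rotate t) (suc i) n (trans (sym (ℕP.+-suc i n)) e)) st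
      where
      bound : i ℕ.+ i ℕ.+ 3 ℕ.≤ m
      bound = lin (n ℕ.+ n) (ℕP.≤-reflexive (trans (sym (ℕP.+-suc i n)) e) ⊕ ℕP.≤-reflexive (trans (sym (ℕP.+-suc i n)) e)) (eq i n X)
        where
        eq : ∀ i n x → i ℕ.+ i ℕ.+ 3 ℕ.+ (suc (suc x) ℕ.+ suc (suc x)) ℕ.+ (n ℕ.+ n) ≡ x ℕ.+ x ℕ.+ 5 ℕ.+ (suc i ℕ.+ n ℕ.+ (suc i ℕ.+ n))
        eq = ℕS.solve-∀

    three : Triple {3} Fin.zero (Fin.suc Fin.zero) (Fin.suc (Fin.suc Fin.zero))
    three = triple (λ ()) (λ ()) (λ ()) λ where
      Fin.zero                     → inj₁ refl
      (Fin.suc Fin.zero)           → inj₂ (inj₁ refl)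
      (Fin.suc (Fin.suc Fin.zero)) → inj₂ (inj₂ refl)

    instance-list : List (Item 3)
    instance-list = full 0 (suc (suc X)) Fin.zero (Fin.suc Fin.zero) (Fin.suc (Fin.suc Fin.zero))

    instance-OPT : IsOPT instance-list m
    instance-OPT = pack-full three 0 (suc (suc X)) refl (ready (λ _ → refl) (λ _ → inj₁ refl) (λ _ _ → refl)) ,
      λ m′ pk → ℕP.≤-trans (ℕP.≤-reflexive (eq X)) (bins-needed 0 (suc X) pk)
      where
      eq : ∀ x → x ℕ.+ x ℕ.+ 5 ≡ suc x ℕ.+ suc x ℕ.+ 3
      eq = ℕS.solve-∀

    instance-run : PseudoBAF instance-list (total-cost (suc (suc X)))
    instance-run = run-full three 0 (suc X) (counts initial refl refl refl [])

    All-instance : ∀ {P : Item 3 → Set} → (∀ c → P (0ℚ , c)) → (∀ c → P (sz 1 , c)) → (∀ c → P (sz K , c)) → All P instance-list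
    All-instance zero-item one-item big-item =
      All-full zero-item one-item big-item 0 (suc (suc X)) Fin.zero (Fin.suc Fin.zero) (Fin.suc (Fin.suc Fin.zero))

-- Choice of the parameters

nat-floor : ∀ y → 0ℚ ≤ y → ∃[ n ] (toℚ n ≤ y × y < toℚ n + 1ℚ)
nat-floor y 0≤y = ℤ.∣ floor y ∣ , subst (λ z → ι z ≤ y) (sym floor≡) (floor-lower y) ,
  subst (λ z → y < ι z + 1ℚ) (sym floor≡) (subst (y <_) (ι-+ (floor y) (+ 1)) (floor-upper y))
  where
  nonneg : ∀ z → + 0 ℤ.< z ℤ.+ + 1 → + 0 ℤ.≤ z
  nonneg (+ n)          _           = ℤ.+≤+ z≤n
  nonneg -[1+ zero ]    (ℤ.+<+ ())
  nonneg -[1+ suc n ]   ()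
  floor≡ : + ℤ.∣ floor y ∣ ≡ floor y
  floor≡ = ℤP.0≤i⇒+∣i∣≡i (nonneg (floor y) (ι-cancel-< {+ 0} (ℚP.≤-<-trans 0≤y (floor-upper y))))

TightWithin : ℚ → ℕ → ℚ → Set
TightWithin ε M d = ∃[ k ] Σ (List (Item k)) λ L → ValidSizes L × All (λ it → size it ≤ (1ℚ /q d)) L ×
  ∃[ opt ] ∃[ n ] (IsOPT L opt × M ℕ.≤ opt × PseudoBAF L n ×
  ((((+ 3) // 2) + (d /q (d - 1ℚ))) - ε) * toℚ opt ≤ toℚ n)

lower-bound-d : ∀ (d : ℚ) → ((+ 2) // 1) ≤ d → ∀ (ε : ℚ) → 0ℚ < ε → ∀ (M : ℕ) → TightWithin ε M d
lower-bound-d d 2≤d ε 0<ε M = build (nat-floor (c11 /q ε) 0≤11/ε)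
  where
  open SizeBound d 2≤d
  c11 : ℚ
  c11 = (+ 11) // 1
  0≤11/ε : 0ℚ ≤ c11 /q ε
  0≤11/ε = cancelʳ-≤ 0<ε (subst₂ _≤_ (sym (ℚP.*-zeroˡ ε)) (sym (/q-* c11 0<ε)) (toℚ-nonneg 11))

  -- The two bounds on `Q` say `cap ≤ dK < cap + 1`, which for grains of size `1/(dK)` are `fits`
  -- and `over`. A large `K` lets `ε·OPT` cover the constant 11 lost by rounding.
  module Parameters (K′ Q : ℕ) (M≤K′ : M ℕ.≤ K′) (11≤Kε : c11 ≤ toℚ (suc K′) * ε)
                    (Q-lower : toℚ Q ≤ (d - ((+ 2) // 1)) * toℚ (suc K′)) (Q-upper : (d - ((+ 2) // 1)) * toℚ (suc K′) < toℚ Q + 1ℚ) where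

    q κ P g : ℚ
    q = toℚ Q
    κ = toℚ (suc K′)
    P = d * κ
    g = 1ℚ /q P

    0<κ : 0ℚ < κ
    0<κ = ι-mono-< {+ 0} {+ suc K′} (ℤ.+<+ (s≤s z≤n))

    0<P : 0ℚ < P
    0<P = mul-pos 0<d 0<κ

    g*P : g * P ≡ 1ℚ
    g*P = /q-* 1ℚ 0<P

    0<g : 0ℚ < g
    0<g = ℚP.≰⇒> λ g≤0 → ℚP.<-irrefl refl (ℚP.<-≤-trans 0<1
      (subst₂ _≤_ g*P (ℚP.*-zeroˡ P) (mulʳ-≤ (ℚP.<⇒≤ 0<P) g≤0)))

    open Gadget K′ Q g (ℚP.<⇒≤ 0<g)

    toℚ-cap : toℚ cap ≡ q + κ + κ
    toℚ-cap = trans (toℚ-+ (Q ℕ.+ K) K) (cong (_+ κ) (toℚ-+ Q K))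

    fits : sz cap ≤ 1ℚ
    fits = subst (sz cap ≤_) (trans (ℚP.*-comm P g) g*P) (mulʳ-≤ (ℚP.<⇒≤ 0<g) (subst (_≤ P) (sym toℚ-cap) (linℚ Q-lower (eq q κ d))))
      where
      eq : ∀ q k d → q + k + k + (d - ((+ 2) // 1)) * k ≡ d * k + q
      eq = solve-∀ ℚ-ring

    over : 1ℚ < sz (suc cap)
    over = subst (_< sz (suc cap)) (trans (ℚP.*-comm P g) g*P) (mulʳ-< 0<g
      (subst (P <_) (sym (trans (toℚ-+ 1 cap) (cong (_+_ 1ℚ) toℚ-cap))) (lin<ℚ Q-upper (eq q κ d))))
      where
      eq : ∀ q k d → d * k + (q + 1ℚ) ≡ 1ℚ + (q + k + k) + (d - ((+ 2) // 1)) * k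
      eq = solve-∀ ℚ-ring

    sz-K : sz K ≡ u
    sz-K = cancelʳ-≡ 0<d (trans (eq κ g d) (trans g*P (sym u*d)))
      where
      eq : ∀ k g d → k * g * d ≡ g * (d * k)
      eq = solve-∀ ℚ-ring

    sz1≤szK : sz 1 ≤ sz K
    sz1≤szK = sz-mono {1} {K} (s≤s z≤n)

    sz-K≤1 : sz K ≤ 1ℚ
    sz-K≤1 = ℚP.≤-trans (sz-mono (ℕP.m≤n+m K (Q ℕ.+ K))) fits

    L : List (Item 3)
    L = instance-list fits over

    opt n : ℕ
    opt = m fits over
    n   = total-cost fits over (suc (suc (X fits over)))

    valid : ValidSizes L
    valid = All-instance fits over (λ _ → ℚP.≤-refl , toℚ-nonneg 1) (λ _ → sz-nonneg 1 , ℚP.≤-trans sz1≤szK sz-K≤1) (λ _ → sz-nonneg K , sz-K≤1)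

    small : All (λ it → size it ≤ (1ℚ /q d)) L
    small = All-instance fits over (λ _ → subst (0ℚ ≤_) sz-K (sz-nonneg K)) (λ _ → subst (sz 1 ≤_) sz-K sz1≤szK) (λ _ → ℚP.≤-reflexive sz-K)

    M≤opt : M ℕ.≤ opt
    M≤opt = ℕP.≤-trans M≤K′ (ℕP.≤-trans (ℕP.m≤n+m K′ Q) (ℕP.≤-trans (ℕP.m≤m+n (Q ℕ.+ K′) (Q ℕ.+ K′)) (ℕP.m≤m+n _ 5)))

    toℚ-opt : toℚ opt ≡ q + κ + (q + κ) + toℚ 3
    toℚ-opt = trans (cong toℚ (eq Q K′)) (trans (toℚ-+ (Q ℕ.+ K ℕ.+ (Q ℕ.+ K)) 3)
      (cong (_+ toℚ 3) (trans (toℚ-+ (Q ℕ.+ K) (Q ℕ.+ K)) (cong₂ _+_ (toℚ-+ Q K) (toℚ-+ Q K)))))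
      where
      eq : ∀ q k → q ℕ.+ k ℕ.+ (q ℕ.+ k) ℕ.+ 5 ≡ q ℕ.+ suc k ℕ.+ (q ℕ.+ suc k) ℕ.+ 3
      eq = ℕS.solve-∀

    toℚ-n : toℚ n ≡ (q + κ + κ) + (q + κ + κ) + (q + κ + (q + κ + (q + κ + toℚ 2)))
    toℚ-n = trans (cong (toℚ ∘ ℕ.pred) (eq Q K′)) (trans (toℚ-+ (cap ℕ.+ cap) _)
      (cong₂ _+_ (trans (toℚ-+ cap cap) (cong₂ _+_ toℚ-cap toℚ-cap)) (add (add (add refl)))))
      where
      eq : ∀ q k → (q ℕ.+ suc k ℕ.+ suc k) ℕ.+ (q ℕ.+ suc k ℕ.+ suc k) ℕ.+ (suc (suc (q ℕ.+ k)) ℕ.+ suc (suc (q ℕ.+ k)) ℕ.+ suc (suc (q ℕ.+ k)))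
        ≡ suc ((q ℕ.+ suc k ℕ.+ suc k) ℕ.+ (q ℕ.+ suc k ℕ.+ suc k) ℕ.+ (q ℕ.+ suc k ℕ.+ (q ℕ.+ suc k ℕ.+ (q ℕ.+ suc k ℕ.+ 2))))
      eq = ℕS.solve-∀
      add : ∀ {a x} → toℚ a ≡ x → toℚ (Q ℕ.+ K ℕ.+ a) ≡ q + κ + x
      add {a} refl = trans (toℚ-+ (Q ℕ.+ K) a) (cong (_+ toℚ a) (toℚ-+ Q K))

    θ≤2 : θ ≤ (+ 2) // 1
    θ≤2 = cancelʳ-≤ 0<e (subst (_≤ ((+ 2) // 1) * e) (sym θ*e) (linℚ 2≤d (eq d)))
      where
      eq : ∀ d → d + d ≡ ((+ 2) // 1) * (d - 1ℚ) + ((+ 2) // 1)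
      eq = solve-∀ ℚ-ring

    o : ℚ
    o = q + κ + (q + κ) + toℚ 3

    θ*o : o * θ ≤ (P + P) + toℚ 6
    θ*o = ℚP.≤-trans (mulʳ-≤ (ℚP.<⇒≤ 0<θ) o≤) (ℚP.≤-trans (ℚP.≤-reflexive expand) (ℚP.+-monoʳ-≤ (P + P) (linℚ (θ≤2 ⊞ θ≤2 ⊞ θ≤2) (eq₆ θ))))
      where
      o≤ : o ≤ e * (κ + κ) + toℚ 3
      o≤ = linℚ (Q-lower ⊞ Q-lower) (eq q κ d)
        where
        eq : ∀ q k d → q + k + (q + k) + ((+ 3) // 1) + ((d - ((+ 2) // 1)) * k + (d - ((+ 2) // 1)) * k)
          ≡ (d - 1ℚ) * (k + k) + ((+ 3) // 1) + (q + q)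
        eq = solve-∀ ℚ-ring
      eq₁ : ∀ e k θ → (e * (k + k) + ((+ 3) // 1)) * θ ≡ (θ * e) * k + (θ * e) * k + ((+ 3) // 1) * θ
      eq₁ = solve-∀ ℚ-ring
      expand : (e * (κ + κ) + toℚ 3) * θ ≡ P + P + toℚ 3 * θ
      expand = trans (eq₁ e κ θ) (cong (λ x → x * κ + x * κ + toℚ 3 * θ) θ*e)
      eq₆ : ∀ θ → ((+ 3) // 1) * θ + (((+ 2) // 1) + ((+ 2) // 1) + ((+ 2) // 1)) ≡ ((+ 6) // 1) + (θ + θ + θ)
      eq₆ = solve-∀ ℚ-ring

    ε*o : c11 ≤ o * ε
    ε*o = ℚP.≤-trans 11≤Kε (mulʳ-≤ {κ} {o} (ℚP.<⇒≤ 0<ε) (linℚ (toℚ-nonneg Q ⊞ toℚ-nonneg Q ⊞ ℚP.<⇒≤ 0<κ ⊞ toℚ-nonneg 3) (eq q κ)))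
      where
      eq : ∀ q k → k + (q + q + k + ((+ 3) // 1)) ≡ q + k + (q + k) + ((+ 3) // 1) + (0ℚ + 0ℚ + 0ℚ + 0ℚ)
      eq = solve-∀ ℚ-ring

    -- The loss is constant: `3/2` of the additive 3 in `opt` gives `9/2`, the same 3 times `θ ≤ 2`
    -- gives 6, and replacing `2dK` by `2·cap` costs at most 2. Against the additive 2 in `n` this
    -- leaves `21/2`, which is below 11.
    ratio : ((((+ 3) // 2) + θ) - ε) * toℚ opt ≤ toℚ n
    ratio = subst₂ _≤_ (cong (λ x → ((((+ 3) // 2) + θ) - ε) * x) (sym toℚ-opt)) (sym toℚ-n)
      (linℚ (θ*o ⊞ ε*o ⊞ ℚP.<⇒≤ Q-upper ⊞ ℚP.<⇒≤ Q-upper ⊞ toWitness {a? = ((+ 3) // 2) ℚP.≤? ((+ 2) // 1)} _) (eq q κ d θ ε))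
      where
      eq : ∀ q k d θ ε →
        ((((+ 3) // 2) + θ) - ε) * (q + k + (q + k) + ((+ 3) // 1))
          + ((d * k + d * k) + ((+ 6) // 1) + (q + k + (q + k) + ((+ 3) // 1)) * ε + (q + 1ℚ) + (q + 1ℚ) + ((+ 2) // 1))
        ≡ (q + k + k) + (q + k + k) + (q + k + (q + k + (q + k + ((+ 2) // 1))))
          + ((q + k + (q + k) + ((+ 3) // 1)) * θ + ((+ 11) // 1) + (d - ((+ 2) // 1)) * k + (d - ((+ 2) // 1)) * k + ((+ 3) // 2))
      eq = solve-∀ ℚ-ring

    result : TightWithin ε M d
    result = 3 , L , valid , small , opt , n , instance-OPT fits over , M≤opt , instance-run fits over , ratio

  build : ∃[ a ] (toℚ a ≤ c11 /q ε × c11 /q ε < toℚ a + 1ℚ) → TightWithin ε M d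
  build (a , _ , a-upper) = choose (nat-floor ((d - ((+ 2) // 1)) * toℚ (suc (a ℕ.+ M))) (mul-nonneg 0≤d-2 (toℚ-nonneg (suc (a ℕ.+ M)))))
    where
    -- The summand `a` makes `Kε` at least 11, and `M` makes OPT large enough.
    K′ = a ℕ.+ M
    0≤d-2 : 0ℚ ≤ d - ((+ 2) // 1)
    0≤d-2 = linℚ 2≤d (eq d)
      where
      eq : ∀ d → 0ℚ + d ≡ d - ((+ 2) // 1) + ((+ 2) // 1)
      eq = solve-∀ ℚ-ring
    11≤Kε : c11 ≤ toℚ (suc K′) * ε
    11≤Kε = subst (_≤ toℚ (suc K′) * ε) (/q-* c11 0<ε) (mulʳ-≤ (ℚP.<⇒≤ 0<ε) (ℚP.≤-trans (ℚP.<⇒≤ a-upper)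
      (ℚP.≤-trans (ℚP.≤-reflexive (trans (sym (toℚ-+ a 1)) (cong toℚ (ℕP.+-comm a 1)))) (toℚ-mono (s≤s (ℕP.m≤m+n a M))))))
    choose : ∃[ Q ] (toℚ Q ≤ (d - ((+ 2) // 1)) * toℚ (suc K′) × (d - ((+ 2) // 1)) * toℚ (suc K′) < toℚ Q + 1ℚ) → TightWithin ε M d
    choose (Q , lower , upper) = Parameters.result K′ Q (ℕP.m≤n+m M a) 11≤Kε lower upper

theorem4p4 : (∀ (k : ℕ) (L : List (Item k)) → ValidSizes L →
    ∀ (opt n : ℕ) → IsOPT L opt → PseudoBAF L n →
    toℚ n ≤ ((+ 7) // 2) * toℚ opt)
    ×
    (∀ (k : ℕ) (L : List (Item k)) (d : ℚ) → ((+ 2) // 1) ≤ d →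
    ValidSizes L → All (λ it → size it ≤ (1ℚ /q d)) L →
    ∀ (opt n : ℕ) → IsOPT L opt → PseudoBAF L n →
    + n ≤ℤ ceiling ((((+ 3) // 2) + (d /q (d - 1ℚ))) * toℚ opt))
    ×
    (∀ (ε : ℚ) → 0ℚ < ε → ∀ (M : ℕ) →
    ∃[ k ] Σ (List (Item k)) λ L → ValidSizes L ×
    ∃[ opt ] ∃[ n ] (IsOPT L opt × M Data.Nat.≤ opt × PseudoBAF L n ×
    (((+ 7) // 2) - ε) * toℚ opt ≤ toℚ n))
    ×
    (∀ (d : ℚ) → ((+ 2) // 1) ≤ d → ∀ (ε : ℚ) → 0ℚ < ε → ∀ (M : ℕ) →
    ∃[ k ] Σ (List (Item k)) λ L → ValidSizes L ×
    All (λ it → size it ≤ (1ℚ /q d)) L ×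
    ∃[ opt ] ∃[ n ] (IsOPT L opt × M Data.Nat.≤ opt × PseudoBAF L n ×
    ((((+ 3) // 2) + (d /q (d - 1ℚ))) - ε) * toℚ opt ≤ toℚ n))
theorem4p4 = upper-bound-7/2 , upper-bound-d , lower-bound-7/2 , lower-bound-d
  where
  lower-bound-7/2 : ∀ (ε : ℚ) → 0ℚ < ε → ∀ (M : ℕ) → ∃[ k ] Σ (List (Item k)) λ L → ValidSizes L ×
    ∃[ opt ] ∃[ n ] (IsOPT L opt × M Data.Nat.≤ opt × PseudoBAF L n × (((+ 7) // 2) - ε) * toℚ opt ≤ toℚ n)
  lower-bound-7/2 ε 0<ε M =
    -- At `d = 2` the ratio `3/2 + d/(d-1)` evaluates to `7/2`.
    let k , L , valid , _ , opt , n , is-opt , M≤opt , run , ratio = lower-bound-d ((+ 2) // 1) ℚP.≤-refl ε 0<ε M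
    in  k , L , valid , opt , n , is-opt , M≤opt , run , ratio
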